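{- Let $q$ be a prime power, let $n\ge 2$ be an integer, and let $v=\frac{q^{n+1}-1}{q-1}$ denote the number of points of $\mathrm{PG}(n,q)$. \begin{enumerate} \item If $n=3\cdot 2^{i}-1$ for some integer $i\ge 1$, then $$c_n\,\frac{1}{q}\,v^{\frac{4}{3}+\frac{1}{3n}} \leq \alpha'(\mathrm{PG}(n,q)),$$ where $c_n$ is a constant depending only on $n$ and satisfying $\frac{1}{2^{7/5}}\leq c_n< \frac{1}{2^{4/3}}$. \item For every integer $n\geq 2$, $$\psi'(\mathrm{PG}(n,q))\leq\frac{1}{q}\,v^{\frac{3}{2}}.$$ \end{enumerate}
   Context: $\mathrm{PG}(n,q)$ is the $n$-dimensional projective space over $\mathrm{GF}(q)$, viewed as a linear space whose points and lines are the $1$- and $2$-dimensional subspaces of $\mathrm{GF}(q)^{n+1}$. A coloring with $k$ colors is a map from the set of lines to $\{1,\dots,k\}$ (all $k$ colors being used). A coloring is proper if any two distinct intersecting lines receive different colors. A coloring is complete if for every pair of distinct colors $c_1,c_2$ there is a point lying on a line of color $c_1$ and on a line of color $c_2$. The achromatic index $\alpha'(\mathrm{PG}(n,q))$ is the largest $k$ such that there is a proper and complete coloring with $k$ colors; the pseudoachromatic index $\psi'(\mathrm{PG}(n,q))$ is the largest $k$ such that there is a complete (not necessarily proper) coloring with $k$ colors. -}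

module Defs where

open import Data.Nat using (ℕ; zero; suc; _+_; _*_; _^_; _≤_)
open import Data.Fin using (Fin)
open import Data.Vec using (Vec; map; zipWith; replicate)
open import Data.List using (upTo)
open import Data.Nat.ListAction using (sum)
import Data.List as List
open import Data.Product using (Σ; _×_; _,_; ∃; proj₁; proj₂)
open import Relation.Binary.PropositionalEquality using (_≡_; _≢_)
open import Relation.Nullary using (¬_)
open import Algebra.Structures using (IsCommutativeRing)

-- A finite field with exactly q elements, realised on the carrier Fin q
-- (so |F| = q), with propositional equality.  Such a field exists iff q is a
-- prime power, and it is unique up to isomorphism: it is GF(q).
record FiniteField (q : ℕ) : Set where
  field
    _+F_ _*F_ : Fin q → Fin q → Fin q
    -F_ : Fin q → Fin q
    0F 1F : Fin q
    isCommutativeRing : IsCommutativeRing _≡_ _+F_ _*F_ -F_ 0F 1F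
    0≢1 : 0F ≢ 1F
    inverse : ∀ x → x ≢ 0F → ∃ λ y → x *F y ≡ 1F

numPoints : ℕ → ℕ → ℕ
numPoints q n = sum (List.map (q ^_) (upTo (suc n)))

module PG {q : ℕ} (F : FiniteField q) (n : ℕ) where
  open FiniteField F

  V : Set
  V = Vec (Fin q) (suc n)

  zeroV : V
  zeroV = replicate (suc n) 0F

  _⊕_ : V → V → V
  _⊕_ = zipWith _+F_

  _·_ : Fin q → V → V
  a · u = map (a *F_) u

  -- a line is a 2-dimensional subspace, given by a basis (u , w)
  Line : Set
  Line = Σ (V × V) λ uw →
           ∀ a b → (a · proj₁ uw) ⊕ (b · proj₂ uw) ≡ zeroV → (a ≡ 0F) × (b ≡ 0F)

  _∈L_ : V → Line → Set
  x ∈L ((u , w) , _) = ∃ λ a → ∃ λ b → x ≡ (a · u) ⊕ (b · w)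

  SameLine : Line → Line → Set
  SameLine L M = (∀ x → x ∈L L → x ∈L M) × (∀ x → x ∈L M → x ∈L L)

  -- a projective point (1-dim subspace spanned by nonzero x) lies on L
  OnLine : V → Line → Set
  OnLine x L = (x ≢ zeroV) × (x ∈L L)

  Intersect : Line → Line → Set
  Intersect L M = ∃ λ x → OnLine x L × OnLine x M

  record Coloring (k : ℕ) : Set where
    field
      col : Line → Fin k
      wellDefined : ∀ L M → SameLine L M → col L ≡ col M
      surjective : ∀ c → ∃ λ L → col L ≡ c

  Proper : ∀ {k} → Coloring k → Set
  Proper C = ∀ L M → ¬ SameLine L M → Intersect L M → col L ≢ col M
    where open Coloring C

  Complete : ∀ {k} → Coloring k → Set
  Complete {k} C = ∀ (c₁ c₂ : Fin k) → c₁ ≢ c₂ →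
    ∃ λ x → ∃ λ L → ∃ λ M →
      OnLine x L × OnLine x M × col L ≡ c₁ × col M ≡ c₂
    where open Coloring C

  IsAchromaticIndex : ℕ → Set
  IsAchromaticIndex a =
    (Σ (Coloring a) λ C → Proper C × Complete C) ×
    (∀ k → (C : Coloring k) → Proper C → Complete C → k ≤ a)

  IsPseudoachromaticIndex : ℕ → Set
  IsPseudoachromaticIndex a =
    (Σ (Coloring a) λ C → Complete C) ×
    (∀ k → (C : Coloring k) → Complete C → k ≤ a)

{-# OPTIONS --safe #-}
module Submission where

-- Upper bound.  Send a pair of colours (c , c′) to a point x together with a line
-- of colour c and a line of colour c′ through x (if c = c′, any point of a line of
-- colour c).  The colours of the two lines recover the pair, so k² ≤ v r², where
-- r = (v - 1) / q is the number of lines through a point.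
--
-- Lower bound.  Let E be the quadratic extension of F = GF(q).  The F-lines of the
-- plane E² that are not contained in an E-point admit a parallelism: they are
-- partitioned into q² + q classes, each of which is a spread of E².  (For q > 2 this is
-- Johnson's construction: derive a Desarguesian spread sharing a regulus with E²
-- and move it by the central collineations of E² with a fixed axis.)  Given a
-- proper complete colouring of the E-lines of E^d, put such a parallelism on every
-- E-line and colour an F-line by the colour of the E-line it spans and by its
-- class; the F-lines inside E-points share one further colour.  Each new class
-- covers the same points as the old one, so the colouring of F^2d is again proper
-- and complete.  Starting from the plane over GF(q^m), m = 2^i, where all lines
-- have different colours, one reaches F^3m with at least q^(4m-2) colours.

open import Defs
open import Algebra.Bundles using (CommutativeRing)
open import Algebra.Structures using (IsCommutativeRing)
import Algebra.Properties.Ring as RingProperties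
import Algebra.Solver.Ring as RingSolver
open import Algebra.Solver.Ring.AlmostCommutativeRing using (AlmostCommutativeRing; fromCommutativeRing; _-Raw-AlmostCommutative⟶_)
open import Data.Empty using (⊥-elim)
open import Data.Fin.Base using (Fin; zero; suc)
import Data.Fin.Properties as Finₚ
open import Data.Integer.Base as ℤ using (ℤ; -[1+_])
import Data.Integer.Properties as ℤₚ
open import Data.List.Base as List using (List; []; _∷_; upTo)
import Data.List.Properties as Listₚ
open import Data.List.Membership.Propositional using (_∈_)
open import Data.List.Membership.Propositional.Properties using (∈-cartesianProductWith⁺; ∈-cartesianProduct⁺; ∈-map⁺; ∈-allFin; ∈-filter⁺; ∈-filter⁻)
open import Data.List.Relation.Unary.Any using (here)
open import Data.Maybe.Base using (Maybe; just; nothing)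
open import Data.Nat.Base as ℕ using (ℕ; zero; suc; _∸_; _≤_; z≤n; s≤s)
open import Data.Nat.ListAction using (sum)
open import Data.Nat.ListAction.Properties using (sum-++)
import Data.Nat.Properties as ℕₚ
open import Data.Nat.Tactic.RingSolver using (solve-∀)
open import Data.Product.Base using (∃; _×_; _,_; proj₁; proj₂)
open import Data.Product.Function.NonDependent.Propositional using (_×-↔_)
open import Data.Product.Properties using (,-injectiveˡ; ,-injectiveʳ)
open import Data.Sum.Base using (_⊎_; inj₁; inj₂)
open import Data.Sum.Function.Propositional using (_⊎-↔_)
open import Data.Sum.Properties using (inj₁-injective)
open import Data.Unit.Base using (⊤; tt)
open import Data.Vec.Base using (Vec; []; _∷_; map; zipWith; replicate; _++_; take; drop)
import Data.Vec.Properties as Vecₚ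
open import Function.Base using (_∘_)
open import Function.Bundles using (_↔_; Inverse; mk↔ₛ′)
open import Function.Construct.Composition using (_↔-∘_)
import Function.Construct.Symmetry as Symm
open import Relation.Binary.PropositionalEquality
open import Relation.Nullary using (Dec; yes; no; ¬_; ¬?)
open import Relation.Nullary.Decidable using (_×-dec_; map′)

-- The number of classes is forced: an `E`-point is itself a single `F`-line, the `E`-points form
-- one spread, and `E²` has q² + q + 1 times as many `F`-lines as a spread. The classes are the
-- images of one spread under the maps (x , y) ↦ (l x , y + s x) with l ≠ 0. There are (q² - 1) q²
-- such maps; the (q - 1) q of them with l and s in `F` preserve the spread, which leaves q² + q
-- images. Derivation needs a scalar ρ in `F` other than 0 and 1, so q = 2 gets a spread of its own.
-- The extension is given by X² - X - t, so that characteristic two is no separate case. The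
-- exponent: n + 1 = 3m gives 4n + 1 = 3 (4m - 1), so q^(4m-2) colours mean a q ≥ q^((4n+1)/3).
-- Since v ≤ 2 q^n, the loss is a factor 2^(4/3 + 1/(3n)), and 4/3 + 1/(3n) ≤ 7/5 holds exactly when
-- n ≥ 5, the smallest dimension that occurs.

-- The carrier is free, unlike in `FiniteField`, so that a quadratic extension can live on pairs and
-- the extension can be iterated.
record FField (q : ℕ) : Set₁ where
  infixl 6 _+_
  infixl 7 _*_
  infix  8 -_
  field
    Carrier : Set
    _+_ _*_ : Carrier → Carrier → Carrier
    -_ : Carrier → Carrier
    0# 1# : Carrier
    isCommutativeRing : IsCommutativeRing _≡_ _+_ _*_ -_ 0# 1#
    0≢1 : 0# ≢ 1#
    inverse : ∀ x → x ≢ 0# → ∃ λ y → x * y ≡ 1#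
    finite : Carrier ↔ Fin q

fromFiniteField : ∀ {q} → FiniteField q → FField q
fromFiniteField F = record
  { isCommutativeRing = FiniteField.isCommutativeRing F
  ; 0≢1 = FiniteField.0≢1 F
  ; inverse = FiniteField.inverse F
  ; finite = record { to = λ x → x ; from = λ x → x ; to-cong = λ e → e ; from-cong = λ e → e
                    ; inverse = (λ e → e) , (λ e → e) }
  }

-- Ring solver, decidable equality and division in a finite field

module FieldTheory {q : ℕ} (K : FField q) where
  open FField K public
  open IsCommutativeRing isCommutativeRing public
    using (+-assoc; +-comm; *-assoc; *-comm; +-identityˡ; +-identityʳ; *-identityˡ; *-identityʳ;
           distribʳ; -‿inverseˡ; -‿inverseʳ; zeroˡ; zeroʳ)

  commutativeRing : CommutativeRing _ _
  commutativeRing = record { isCommutativeRing = isCommutativeRing }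

  open RingProperties (CommutativeRing.ring commutativeRing) using (-‿distribˡ-*; -‿distribʳ-*; -0#≈0#; -‿involutive; -‿anti-homo-+)

  acr : AlmostCommutativeRing _ _
  acr = fromCommutativeRing commutativeRing

  private
    ℕ⇒ : ℕ → Carrier
    ℕ⇒ zero = 0#
    -- A clause of its own for one: the constant 1 of the solver is then `1#` and not `1# + 0#`.
    ℕ⇒ (suc zero) = 1#
    ℕ⇒ (suc n@(suc _)) = 1# + ℕ⇒ n

    ℕ⇒-suc : ∀ n → ℕ⇒ (suc n) ≡ 1# + ℕ⇒ n
    ℕ⇒-suc zero = sym (+-identityʳ 1#)
    ℕ⇒-suc (suc n) = refl

    ℤ⇒ : ℤ → Carrier
    ℤ⇒ (ℤ.+ n) = ℕ⇒ n
    ℤ⇒ -[1+ n ] = - ℕ⇒ (suc n)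

    open ≡-Reasoning

    +-homoℕ : ∀ m n → ℕ⇒ (m ℕ.+ n) ≡ ℕ⇒ m + ℕ⇒ n
    +-homoℕ zero n = sym (+-identityˡ _)
    +-homoℕ (suc m) n = begin
      ℕ⇒ (suc (m ℕ.+ n)) ≡⟨ ℕ⇒-suc (m ℕ.+ n) ⟩
      1# + ℕ⇒ (m ℕ.+ n) ≡⟨ cong (1# +_) (+-homoℕ m n) ⟩
      1# + (ℕ⇒ m + ℕ⇒ n) ≡⟨ +-assoc _ _ _ ⟨
      1# + ℕ⇒ m + ℕ⇒ n ≡⟨ cong (_+ ℕ⇒ n) (ℕ⇒-suc m) ⟨
      ℕ⇒ (suc m) + ℕ⇒ n ∎

    *-homoℕ : ∀ m n → ℕ⇒ (m ℕ.* n) ≡ ℕ⇒ m * ℕ⇒ n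
    *-homoℕ zero n = sym (zeroˡ _)
    *-homoℕ (suc m) n = begin
      ℕ⇒ (n ℕ.+ m ℕ.* n) ≡⟨ +-homoℕ n _ ⟩
      ℕ⇒ n + ℕ⇒ (m ℕ.* n) ≡⟨ cong₂ _+_ (sym (*-identityˡ _)) (*-homoℕ m n) ⟩
      1# * ℕ⇒ n + ℕ⇒ m * ℕ⇒ n ≡⟨ distribʳ _ _ _ ⟨
      (1# + ℕ⇒ m) * ℕ⇒ n ≡⟨ cong (_* ℕ⇒ n) (ℕ⇒-suc m) ⟨
      ℕ⇒ (suc m) * ℕ⇒ n ∎

    -‿+ : ∀ x y → - (x + y) ≡ - x + - y
    -‿+ x y = trans (-‿anti-homo-+ x y) (+-comm _ _)

    cancel : ∀ x y → (1# + x) + - (1# + y) ≡ x + - y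
    cancel x y = begin
      (1# + x) + - (1# + y) ≡⟨ cong₂ _+_ (+-comm _ _) (-‿+ _ _) ⟩
      (x + 1#) + (- 1# + - y) ≡⟨ +-assoc _ _ _ ⟩
      x + (1# + (- 1# + - y)) ≡⟨ cong (x +_) (sym (+-assoc _ _ _)) ⟩
      x + ((1# + - 1#) + - y) ≡⟨ cong (λ z → x + (z + - y)) (-‿inverseʳ _) ⟩
      x + (0# + - y) ≡⟨ cong (x +_) (+-identityˡ _) ⟩
      x + - y ∎

    ⊖-homo : ∀ m n → ℤ⇒ (m ℤ.⊖ n) ≡ ℕ⇒ m + - ℕ⇒ n
    ⊖-homo m zero = sym (trans (cong (ℕ⇒ m +_) -0#≈0#) (+-identityʳ _))
    ⊖-homo zero (suc n) = sym (+-identityˡ _)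
    ⊖-homo (suc m) (suc n) = begin
      ℤ⇒ (suc m ℤ.⊖ suc n) ≡⟨ cong ℤ⇒ (ℤₚ.[1+m]⊖[1+n]≡m⊖n m n) ⟩
      ℤ⇒ (m ℤ.⊖ n) ≡⟨ ⊖-homo m n ⟩
      ℕ⇒ m + - ℕ⇒ n ≡⟨ cancel _ _ ⟨
      (1# + ℕ⇒ m) + - (1# + ℕ⇒ n) ≡⟨ cong₂ (λ x y → x + - y) (ℕ⇒-suc m) (ℕ⇒-suc n) ⟨
      ℕ⇒ (suc m) + - ℕ⇒ (suc n) ∎

    +-homoℤ : ∀ i j → ℤ⇒ (i ℤ.+ j) ≡ ℤ⇒ i + ℤ⇒ j
    +-homoℤ (ℤ.+ m) (ℤ.+ n) = +-homoℕ m n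
    +-homoℤ (ℤ.+ m) -[1+ n ] = ⊖-homo m (suc n)
    +-homoℤ -[1+ m ] (ℤ.+ n) = trans (⊖-homo n (suc m)) (+-comm _ _)
    +-homoℤ -[1+ m ] -[1+ n ] = begin
      - ℕ⇒ (suc (suc (m ℕ.+ n))) ≡⟨ cong (-_ ∘ ℕ⇒) (sym (ℕₚ.+-suc (suc m) n)) ⟩
      - ℕ⇒ (suc m ℕ.+ suc n) ≡⟨ cong -_ (+-homoℕ (suc m) (suc n)) ⟩
      - (ℕ⇒ (suc m) + ℕ⇒ (suc n)) ≡⟨ -‿+ _ _ ⟩
      - ℕ⇒ (suc m) + - ℕ⇒ (suc n) ∎

    -‿homoℤ : ∀ i → ℤ⇒ (ℤ.- i) ≡ - ℤ⇒ i
    -‿homoℤ (ℤ.+ zero) = sym -0#≈0#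
    -‿homoℤ (ℤ.+ (suc n)) = refl
    -‿homoℤ -[1+ n ] = sym (-‿involutive _)

    *-homo+ : ∀ m j → ℤ⇒ (ℤ.+ m ℤ.* j) ≡ ℕ⇒ m * ℤ⇒ j
    *-homo+ m (ℤ.+ n) = trans (cong ℤ⇒ (sym (ℤₚ.pos-* m n))) (*-homoℕ m n)
    *-homo+ m -[1+ n ] = begin
      ℤ⇒ (ℤ.+ m ℤ.* ℤ.- (ℤ.+ suc n)) ≡⟨ cong ℤ⇒ (sym (ℤₚ.neg-distribʳ-* (ℤ.+ m) (ℤ.+ suc n))) ⟩
      ℤ⇒ (ℤ.- (ℤ.+ m ℤ.* ℤ.+ suc n)) ≡⟨ -‿homoℤ (ℤ.+ m ℤ.* ℤ.+ suc n) ⟩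
      - ℤ⇒ (ℤ.+ m ℤ.* ℤ.+ suc n) ≡⟨ cong -_ (*-homo+ m (ℤ.+ suc n)) ⟩
      - (ℕ⇒ m * ℕ⇒ (suc n)) ≡⟨ -‿distribʳ-* _ _ ⟩
      ℕ⇒ m * - ℕ⇒ (suc n) ∎

    *-homoℤ : ∀ i j → ℤ⇒ (i ℤ.* j) ≡ ℤ⇒ i * ℤ⇒ j
    *-homoℤ (ℤ.+ m) j = *-homo+ m j
    *-homoℤ -[1+ m ] j = begin
      ℤ⇒ (ℤ.- (ℤ.+ suc m) ℤ.* j) ≡⟨ cong ℤ⇒ (sym (ℤₚ.neg-distribˡ-* (ℤ.+ suc m) j)) ⟩
      ℤ⇒ (ℤ.- (ℤ.+ suc m ℤ.* j)) ≡⟨ -‿homoℤ (ℤ.+ suc m ℤ.* j) ⟩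
      - ℤ⇒ (ℤ.+ suc m ℤ.* j) ≡⟨ cong -_ (*-homo+ (suc m) j) ⟩
      - (ℕ⇒ (suc m) * ℤ⇒ j) ≡⟨ -‿distribˡ-* _ _ ⟩
      - ℕ⇒ (suc m) * ℤ⇒ j ∎

    morphism : CommutativeRing.rawRing ℤₚ.+-*-commutativeRing -Raw-AlmostCommutative⟶ acr
    morphism = record
      { ⟦_⟧ = ℤ⇒
      ; +-homo = +-homoℤ
      ; *-homo = *-homoℤ
      ; -‿homo = -‿homoℤ
      ; 0-homo = refl
      ; 1-homo = refl
      }

    -- A sufficient test is enough. Integers that agree only modulo the characteristic stay
    -- distinct, so the solver proves just those identities that hold over the integers.
    weak≟ : ∀ i j → Maybe (ℤ⇒ i ≡ ℤ⇒ j)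
    weak≟ i j with i ℤₚ.≟ j
    ... | yes e = just (cong ℤ⇒ e)
    ... | no _ = nothing

  module Solver = RingSolver (CommutativeRing.rawRing ℤₚ.+-*-commutativeRing) acr morphism weak≟

  open Solver using (solve; _:=_; _:*_; _:+_; :-_; Polynomial; con)

  :0 :1 : ∀ {n} → Polynomial n
  :0 = con (ℤ.+ 0)
  :1 = con (ℤ.+ 1)

  private
    to = Inverse.to finite
    from = Inverse.from finite

  from∘to : ∀ x → from (to x) ≡ x
  from∘to = Inverse.strictlyInverseʳ finite

  infix 4 _≟_
  _≟_ : ∀ (x y : Carrier) → Dec (x ≡ y)
  x ≟ y = map′ (λ e → trans (sym (from∘to x)) (trans (cong from e) (from∘to y))) (cong to) (to x Finₚ.≟ to y)

  any? : ∀ {P : Carrier → Set} → (∀ x → Dec (P x)) → Dec (∃ P)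
  any? {P} P? = map′ (λ { (i , p) → from i , p }) (λ { (x , p) → to x , subst P (sym (from∘to x)) p })
                  (Finₚ.any? (P? ∘ from))

  infix 9 _⁻¹
  _⁻¹ : Carrier → Carrier
  x ⁻¹ with x ≟ 0#
  ... | yes _ = 0#
  ... | no x≢0 = proj₁ (inverse x x≢0)

  *-inverseʳ : ∀ {x} → x ≢ 0# → x * x ⁻¹ ≡ 1#
  *-inverseʳ {x} x≢0 with x ≟ 0#
  ... | yes e = ⊥-elim (x≢0 e)
  ... | no ne = proj₂ (inverse x ne)

  *-inverseˡ : ∀ {x} → x ≢ 0# → x ⁻¹ * x ≡ 1#
  *-inverseˡ x≢0 = trans (*-comm _ _) (*-inverseʳ x≢0)

  cancel-*ˡ : ∀ {x y z} → x ≢ 0# → x * y ≡ x * z → y ≡ z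
  cancel-*ˡ {x} {y} {z} x≢0 e = begin
    y ≡⟨ *-identityˡ y ⟨
    1# * y ≡⟨ cong (_* y) (*-inverseˡ x≢0) ⟨
    x ⁻¹ * x * y ≡⟨ *-assoc _ _ _ ⟩
    x ⁻¹ * (x * y) ≡⟨ cong (x ⁻¹ *_) e ⟩
    x ⁻¹ * (x * z) ≡⟨ *-assoc _ _ _ ⟨
    x ⁻¹ * x * z ≡⟨ cong (_* z) (*-inverseˡ x≢0) ⟩
    1# * z ≡⟨ *-identityˡ z ⟩
    z ∎
    where open ≡-Reasoning

  cancel-*ʳ : ∀ {x y z} → x ≢ 0# → y * x ≡ z * x → y ≡ z
  cancel-*ʳ x≢0 e = cancel-*ˡ x≢0 (trans (*-comm _ _) (trans e (*-comm _ _)))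

  x*y≡0 : ∀ {x y} → x ≢ 0# → x * y ≡ 0# → y ≡ 0#
  x*y≡0 {x} x≢0 e = cancel-*ˡ x≢0 (trans e (sym (zeroʳ x)))

  *-≢0 : ∀ {x y} → x ≢ 0# → y ≢ 0# → x * y ≢ 0#
  *-≢0 x≢0 y≢0 e = y≢0 (x*y≡0 x≢0 e)

  *-≢0ˡ : ∀ {x y} → x * y ≢ 0# → x ≢ 0#
  *-≢0ˡ {y = y} ne refl = ne (zeroˡ y)

  *-≢0ʳ : ∀ {x y} → x * y ≢ 0# → y ≢ 0#
  *-≢0ʳ {x} ne refl = ne (zeroʳ x)

  1≢0 : 1# ≢ 0#
  1≢0 e = 0≢1 (sym e)

  ⁻¹-≢0 : ∀ {x} → x ≢ 0# → x ⁻¹ ≢ 0#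
  ⁻¹-≢0 {x} x≢0 = *-≢0ʳ {x} (subst (_≢ 0#) (sym (*-inverseʳ x≢0)) 1≢0)

  x-y≡0 : ∀ {x y} → x + - y ≡ 0# → x ≡ y
  x-y≡0 {x} {y} e = begin
    x ≡⟨ solve 2 (λ a b → a := (a :+ :- b) :+ b) refl x y ⟩
    (x + - y) + y ≡⟨ cong (_+ y) e ⟩
    0# + y ≡⟨ +-identityˡ y ⟩
    y ∎
    where open ≡-Reasoning

  x≡y⇒0 : ∀ {x y} → x ≡ y → x + - y ≡ 0#
  x≡y⇒0 {x} refl = -‿inverseʳ x

  by-diff : ∀ {x y d} → x + - y ≡ d → d ≡ 0# → x ≡ y
  by-diff e e' = x-y≡0 (trans e e')

  ≢0-cong : ∀ {x y} → x ≡ y → x ≢ 0# → y ≢ 0#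
  ≢0-cong refl ne = ne

  -- An equation X ≡ Y follows from P ≡ Q once X - Y is a multiple of P - Q, which is
  -- an identity for the ring solver.
  combine₁ : ∀ {P Q X Y} m → P ≡ Q → X + - Y ≡ m * (P + - Q) → X ≡ Y
  combine₁ m refl e = by-diff e (trans (cong (m *_) (-‿inverseʳ _)) (zeroʳ m))

  combine₂ : ∀ {P Q P′ Q′ X Y} m m′ → P ≡ Q → P′ ≡ Q′ →
             X + - Y ≡ m * (P + - Q) + m′ * (P′ + - Q′) → X ≡ Y
  combine₂ m m′ refl refl e = by-diff e
    (trans (cong₂ (λ x y → m * x + m′ * y) (-‿inverseʳ _) (-‿inverseʳ _))
           (trans (cong₂ _+_ (zeroʳ m) (zeroʳ m′)) (+-identityʳ 0#)))

-- Quadratic extensions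

-- `ω` is a root of X² - X - t, which has no root in `F` by `t-missed`; adjoining a square root
-- would fail in characteristic two. `σ` is the conjugation over `F`, which sends `ω` to the other
-- root 1 - ω.
record QuadraticExtension {q r : ℕ} (F : FField q) (E : FField r) : Set where
  private
    module F = FieldTheory F
    module E = FieldTheory E
  field
    ι : F.Carrier → E.Carrier
    ι-+ : ∀ x y → ι (x F.+ y) ≡ ι x E.+ ι y
    ι-* : ∀ x y → ι (x F.* y) ≡ ι x E.* ι y
    ι-neg : ∀ x → ι (F.- x) ≡ E.- ι x
    ι-0 : ι F.0# ≡ E.0#
    ι-1 : ι F.1# ≡ E.1#
    ω : E.Carrier
    t : F.Carrier
    t-missed : ∀ z → z F.* z F.+ F.- z ≢ t
    ω² : ω E.* ω ≡ ω E.+ ι t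
    π₀ π₁ : E.Carrier → F.Carrier
    decompose : ∀ x → x ≡ ι (π₀ x) E.+ ι (π₁ x) E.* ω
    π₀-compose : ∀ a b → π₀ (ι a E.+ ι b E.* ω) ≡ a
    π₁-compose : ∀ a b → π₁ (ι a E.+ ι b E.* ω) ≡ b
    σ : E.Carrier → E.Carrier
    σ-+ : ∀ x y → σ (x E.+ y) ≡ σ x E.+ σ y
    σ-* : ∀ x y → σ (x E.* y) ≡ σ x E.* σ y
    σ-ι : ∀ x → σ (ι x) ≡ ι x
    σ-ω : σ ω ≡ E.1# E.+ E.- ω

-- A self-map of a finite set that is not injective is not surjective. If all values were hit, a
-- section `g` would be injective; as `f` agrees at 0 and 1, `g` would avoid one of them, and q + 1
-- elements would embed into q.
missed-value : ∀ {q} (F : FField q) → let open FieldTheory F in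
               ∀ (f : Carrier → Carrier) → f 0# ≡ f 1# → ∃ λ t → ∀ z → f z ≢ t
missed-value {q} F f f0≡f1 with any? (λ t → ¬? (any? (λ z → f z ≟ t)))
  where open FieldTheory F
... | yes (t , ¬hit) = t , λ z e → ¬hit (z , e)
... | no ¬missed = ⊥-elim (ℕₚ.1+n≰n (Finₚ.injective⇒≤ h-injective))
  where
  open FieldTheory F
  hit : ∀ t → ∃ λ z → f z ≡ t
  hit t with any? (λ z → f z ≟ t)
  ... | yes z = z
  ... | no ¬z = ⊥-elim (¬missed (t , ¬z))
  g : Carrier → Carrier
  g t = proj₁ (hit t)
  fg : ∀ t → f (g t) ≡ t
  fg t = proj₂ (hit t)
  avoided : ∃ λ w → ∀ t → g t ≢ w
  avoided with g (f 0#) ≟ 0#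
  ... | yes e = 1# , λ s e' → 0≢1 (trans (sym e) (trans (cong g (trans f0≡f1 (trans (cong f (sym e')) (fg s)))) e'))
  ... | no ne = 0# , λ s e' → ne (trans (cong g (trans (cong f (sym e')) (fg s))) e')
  to = Inverse.to finite
  from = Inverse.from finite
  to-injective : ∀ {x y} → to x ≡ to y → x ≡ y
  to-injective e = trans (sym (Inverse.strictlyInverseʳ finite _)) (trans (cong from e) (Inverse.strictlyInverseʳ finite _))
  h : Fin (suc q) → Fin q
  h zero = to (proj₁ avoided)
  h (suc i) = to (g (from i))
  h-injective : ∀ {i j} → h i ≡ h j → i ≡ j
  h-injective {zero} {zero} _ = refl
  h-injective {zero} {suc j} e = ⊥-elim (proj₂ avoided _ (sym (to-injective e)))
  h-injective {suc i} {zero} e = ⊥-elim (proj₂ avoided _ (to-injective e))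
  h-injective {suc i} {suc j} e = cong suc (trans (sym (Inverse.strictlyInverseˡ finite i))
    (trans (cong to (trans (sym (fg _)) (trans (cong f (to-injective e)) (fg _)))) (Inverse.strictlyInverseˡ finite j)))

module Quadratic {q : ℕ} (F : FField q) where
  open FieldTheory F
  open Solver using (solve; _:=_; _:*_; _:+_; :-_)

  private
    missed : ∃ λ t → ∀ z → z * z + - z ≢ t
    missed = missed-value F (λ z → z * z + - z)
      (solve 0 (:0 :* :0 :+ :- :0 := :1 :* :1 :+ :- :1) refl)

    t = proj₁ missed

    A : Set
    A = Carrier × Carrier

    _⊕_ _⊗_ : A → A → A
    (a , b) ⊕ (c , d) = a + c , b + d
    (a , b) ⊗ (c , d) = a * c + t * b * d , a * d + b * c + b * d

    ⊖_ : A → A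
    ⊖ (a , b) = - a , - b

    0ₑ 1ₑ : A
    0ₑ = 0# , 0#
    1ₑ = 1# , 0#

    norm : A → Carrier
    norm (a , b) = a * a + a * b + - (t * b * b)

    -- For nonzero `b`, dividing norm zero by b² makes `- a * b ⁻¹` a solution of z² - z = t.
    norm≢0 : ∀ x → x ≢ 0ₑ → norm x ≢ 0#
    norm≢0 (a , b) ne e with b ≟ 0#
    ... | yes refl = ne (cong (_, 0#) (a≡0 (a ≟ 0#)))
      where
      a≡0 : Dec (a ≡ 0#) → a ≡ 0#
      a≡0 (yes p) = p
      a≡0 (no p) = ⊥-elim (*-≢0 p p (trans (solve 2 (λ a t → a :* a := a :* a :+ a :* :0 :+ :- (t :* :0 :* :0)) refl a t) e))
    ... | no b≢0 = proj₂ missed (- a * b ⁻¹) (by-diff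
        (trans (solve 4 (λ a b c t → (:- a :* c) :* (:- a :* c) :+ :- (:- a :* c) :+ :- t
                  := (a :* a :+ a :* b :+ :- (t :* b :* b)) :* c :* c
                     :+ (:1 :+ :- (b :* c)) :* (a :* c :+ :- t :+ :- (t :* b :* c))) refl a b (b ⁻¹) t)
               (cong₂ (λ x y → x * b ⁻¹ * b ⁻¹ + (1# + - y) * (a * b ⁻¹ + - t + - (t * b * b ⁻¹))) e (*-inverseʳ b≢0)))
        (solve 3 (λ c t s → :0 :* c :* c :+ (:1 :+ :- :1) :* s := :0) refl (b ⁻¹) t _))

    inverseₑ : ∀ x → x ≢ 0ₑ → ∃ λ y → x ⊗ y ≡ 1ₑ
    -- The conjugate (a + b , - b) divided by the norm.
    inverseₑ x@(a , b) ne = ((a + b) * n , - b * n) , cong₂ _,_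
        (trans (solve 4 (λ a b n t → a :* ((a :+ b) :* n) :+ t :* b :* (:- b :* n)
                  := (a :* a :+ a :* b :+ :- (t :* b :* b)) :* n) refl a b n t) (*-inverseʳ (norm≢0 x ne)))
        (solve 3 (λ a b n → a :* (:- b :* n) :+ b :* ((a :+ b) :* n) :+ b :* (:- b :* n) := :0) refl a b n)
      where n = norm x ⁻¹

    isCommutativeRingₑ : IsCommutativeRing _≡_ _⊕_ _⊗_ ⊖_ 0ₑ 1ₑ
    isCommutativeRingₑ = record
      { isRing = record
        { +-isAbelianGroup = record
          { isGroup = record
            { isMonoid = record
              { isSemigroup = record
                { isMagma = record { isEquivalence = isEquivalence ; ∙-cong = cong₂ _⊕_ }
                ; assoc = λ _ _ _ → cong₂ _,_ (+-assoc _ _ _) (+-assoc _ _ _) }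
              ; identity = (λ _ → cong₂ _,_ (+-identityˡ _) (+-identityˡ _))
                         , (λ _ → cong₂ _,_ (+-identityʳ _) (+-identityʳ _)) }
            ; inverse = (λ _ → cong₂ _,_ (-‿inverseˡ _) (-‿inverseˡ _))
                      , (λ _ → cong₂ _,_ (-‿inverseʳ _) (-‿inverseʳ _))
            ; ⁻¹-cong = cong ⊖_ }
          ; comm = λ _ _ → cong₂ _,_ (+-comm _ _) (+-comm _ _) }
        ; *-cong = cong₂ _⊗_
        ; *-assoc = λ { (a , b) (c , d) (e , f) → cong₂ _,_
            (solve 7 (λ t a b c d e f → (a :* c :+ t :* b :* d) :* e :+ t :* (a :* d :+ b :* c :+ b :* d) :* f
               := a :* (c :* e :+ t :* d :* f) :+ t :* b :* (c :* f :+ d :* e :+ d :* f)) refl t a b c d e f)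
            (solve 7 (λ t a b c d e f →
               (a :* c :+ t :* b :* d) :* f :+ (a :* d :+ b :* c :+ b :* d) :* e :+ (a :* d :+ b :* c :+ b :* d) :* f
               := a :* (c :* f :+ d :* e :+ d :* f) :+ b :* (c :* e :+ t :* d :* f) :+ b :* (c :* f :+ d :* e :+ d :* f))
               refl t a b c d e f) }
        ; *-identity = (λ { (a , b) → cong₂ _,_
              (solve 3 (λ t a b → :1 :* a :+ t :* :0 :* b := a) refl t a b)
              (solve 2 (λ a b → :1 :* b :+ :0 :* a :+ :0 :* b := b) refl a b) })
            , (λ { (a , b) → cong₂ _,_
              (solve 3 (λ t a b → a :* :1 :+ t :* b :* :0 := a) refl t a b)
              (solve 2 (λ a b → a :* :0 :+ b :* :1 :+ b :* :0 := b) refl a b) })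
        ; distrib = (λ { (a , b) (c , d) (e , f) → cong₂ _,_
              (solve 7 (λ t a b c d e f → a :* (c :+ e) :+ t :* b :* (d :+ f)
                 := (a :* c :+ t :* b :* d) :+ (a :* e :+ t :* b :* f)) refl t a b c d e f)
              (solve 6 (λ a b c d e f → a :* (d :+ f) :+ b :* (c :+ e) :+ b :* (d :+ f)
                 := (a :* d :+ b :* c :+ b :* d) :+ (a :* f :+ b :* e :+ b :* f)) refl a b c d e f) })
            , (λ { (a , b) (c , d) (e , f) → cong₂ _,_
              (solve 7 (λ t a b c d e f → (c :+ e) :* a :+ t :* (d :+ f) :* b
                 := (c :* a :+ t :* d :* b) :+ (e :* a :+ t :* f :* b)) refl t a b c d e f)
              (solve 6 (λ a b c d e f → (c :+ e) :* b :+ (d :+ f) :* a :+ (d :+ f) :* b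
                 := (c :* b :+ d :* a :+ d :* b) :+ (e :* b :+ f :* a :+ f :* b)) refl a b c d e f) })
        }
      ; *-comm = λ { (a , b) (c , d) → cong₂ _,_
          (solve 5 (λ t a b c d → a :* c :+ t :* b :* d := c :* a :+ t :* d :* b) refl t a b c d)
          (solve 4 (λ a b c d → a :* d :+ b :* c :+ b :* d := c :* b :+ d :* a :+ d :* b) refl a b c d) }
      }

  extension : FField (q ℕ.* q)
  extension = record
    { isCommutativeRing = isCommutativeRingₑ
    ; 0≢1 = λ e → 0≢1 (cong proj₁ e)
    ; inverse = inverseₑ
    ; finite = Symm.↔-sym Finₚ.*↔× ↔-∘ (finite ×-↔ finite)
    }

  isQuadratic : QuadraticExtension F extension
  isQuadratic = record
    { ι = λ x → x , 0#
    ; ι-+ = λ x y → cong (_ ,_) (sym (+-identityˡ 0#))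
    ; ι-* = λ x y → cong₂ _,_ (solve 3 (λ t x y → x :* y := x :* y :+ t :* :0 :* :0) refl t x y)
                              (solve 2 (λ x y → :0 := x :* :0 :+ :0 :* y :+ :0 :* :0) refl x y)
    ; ι-neg = λ x → cong (_ ,_) (solve 0 (:0 := :- :0) refl)
    ; ι-0 = refl
    ; ι-1 = refl
    ; ω = 0# , 1#
    ; t = t
    ; t-missed = proj₂ missed
    ; ω² = cong₂ _,_ (solve 1 (λ t → :0 :* :0 :+ t :* :1 :* :1 := :0 :+ t) refl t)
                     (solve 0 (:0 :* :1 :+ :1 :* :0 :+ :1 :* :1 := :1 :+ :0) refl)
    ; π₀ = proj₁
    ; π₁ = proj₂
    ; decompose = λ { (a , b) → sym (cong₂ _,_ (first a b) (second a b)) }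
    ; π₀-compose = first
    ; π₁-compose = second
    ; σ = λ { (a , b) → a + b , - b }
    ; σ-+ = λ { (a , b) (c , d) → cong₂ _,_
        (solve 4 (λ a b c d → a :+ c :+ (b :+ d) := a :+ b :+ (c :+ d)) refl a b c d)
        (solve 2 (λ b d → :- (b :+ d) := :- b :+ :- d) refl b d) }
    ; σ-* = λ { (a , b) (c , d) → cong₂ _,_
        (solve 5 (λ t a b c d → a :* c :+ t :* b :* d :+ (a :* d :+ b :* c :+ b :* d)
           := (a :+ b) :* (c :+ d) :+ t :* (:- b) :* (:- d)) refl t a b c d)
        (solve 4 (λ a b c d → :- (a :* d :+ b :* c :+ b :* d)
           := (a :+ b) :* (:- d) :+ (:- b) :* (c :+ d) :+ (:- b) :* (:- d)) refl a b c d) }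
    ; σ-ι = λ x → cong₂ _,_ (+-identityʳ x) (solve 0 (:- :0 := :0) refl)
    ; σ-ω = cong₂ _,_ (solve 0 (:0 :+ :1 := :1 :+ :- :0) refl) (solve 0 (:- :1 := :0 :+ :- :1) refl)
    }
    where
    first : ∀ a b → a + (b * 0# + t * 0# * 1#) ≡ a
    first a b = solve 3 (λ t a b → a :+ (b :* :0 :+ t :* :0 :* :1) := a) refl t a b
    second : ∀ a b → 0# + (b * 1# + 0# * 0# + 0# * 1#) ≡ b
    second a b = solve 1 (λ b → :0 :+ (b :* :1 :+ :0 :* :0 :+ :0 :* :1) := b) refl b

module QuadraticTheory {q r} {F : FField q} {E : FField r} (Q : QuadraticExtension F E) where
  module F = FieldTheory F
  open FieldTheory E
  open QuadraticExtension Q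
  open Solver using (solve; _:=_; _:*_; _:+_; :-_)

  private
    module FS = F.Solver

  ι-linear : ∀ a b x z → ι (a F.* x F.+ b F.* z) ≡ ι a * ι x + ι b * ι z
  ι-linear a b x z = trans (ι-+ _ _) (cong₂ _+_ (ι-* _ _) (ι-* _ _))

  compose : F.Carrier → F.Carrier → Carrier
  compose a b = ι a + ι b * ω

  compose-linear : ∀ a b x z → ι a * x + ι b * z ≡
    compose (a F.* π₀ x F.+ b F.* π₀ z) (a F.* π₁ x F.+ b F.* π₁ z)
  compose-linear a b x z = begin
    ι a * x + ι b * z
      ≡⟨ cong₂ (λ x z → ι a * x + ι b * z) (decompose x) (decompose z) ⟩
    ι a * compose (π₀ x) (π₁ x) + ι b * compose (π₀ z) (π₁ z)
      ≡⟨ solve 7 (λ a b x₀ x₁ z₀ z₁ w → a :* (x₀ :+ x₁ :* w) :+ b :* (z₀ :+ z₁ :* w)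
           := (a :* x₀ :+ b :* z₀) :+ (a :* x₁ :+ b :* z₁) :* w) refl _ _ _ _ _ _ _ ⟩
    (ι a * ι (π₀ x) + ι b * ι (π₀ z)) + (ι a * ι (π₁ x) + ι b * ι (π₁ z)) * ω
      ≡⟨ cong₂ (λ y y′ → y + y′ * ω) (ι-linear _ _ _ _) (ι-linear _ _ _ _) ⟨
    compose (a F.* π₀ x F.+ b F.* π₀ z) (a F.* π₁ x F.+ b F.* π₁ z) ∎
    where open ≡-Reasoning

  π₀-linear : ∀ a b x z → π₀ (ι a * x + ι b * z) ≡ a F.* π₀ x F.+ b F.* π₀ z
  π₀-linear a b x z = trans (cong π₀ (compose-linear a b x z)) (π₀-compose _ _)

  π₁-linear : ∀ a b x z → π₁ (ι a * x + ι b * z) ≡ a F.* π₁ x F.+ b F.* π₁ z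
  π₁-linear a b x z = trans (cong π₁ (compose-linear a b x z)) (π₁-compose _ _)

  ι-as-compose : ∀ a → ι a ≡ compose a F.0#
  ι-as-compose a = trans (solve 2 (λ a w → a := a :+ :0 :* w) refl (ι a) ω) (cong (λ z → ι a + z * ω) (sym ι-0))

  π₀-ι : ∀ a → π₀ (ι a) ≡ a
  π₀-ι a = trans (cong π₀ (ι-as-compose a)) (π₀-compose _ _)

  π₁-ι : ∀ a → π₁ (ι a) ≡ F.0#
  π₁-ι a = trans (cong π₁ (ι-as-compose a)) (π₁-compose _ _)

  ω-as-compose : ω ≡ compose F.0# F.1#
  ω-as-compose = trans (solve 1 (λ w → w := :0 :+ :1 :* w) refl ω) (cong₂ (λ x y → x + y * ω) (sym ι-0) (sym ι-1))

  π₀-ω : π₀ ω ≡ F.0#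
  π₀-ω = trans (cong π₀ ω-as-compose) (π₀-compose _ _)

  π₁-ω : π₁ ω ≡ F.1#
  π₁-ω = trans (cong π₁ ω-as-compose) (π₁-compose _ _)

  π₁-scale : ∀ a x → π₁ (ι a * x) ≡ a F.* π₁ x
  π₁-scale a x = trans (cong π₁ (trans (solve 2 (λ a x → a :* x := a :* x :+ :0 :* x) refl (ι a) x)
                                      (cong (λ z → ι a * x + z * x) (sym ι-0))))
                 (trans (π₁-linear a F.0# x x) (FS.solve 2 (λ a x → a FS.:* x FS.:+ F.:0 FS.:* x FS.:= a FS.:* x) refl a (π₁ x)))

  π₀-scale : ∀ a x → π₀ (ι a * x) ≡ a F.* π₀ x
  π₀-scale a x = trans (cong π₀ (trans (solve 2 (λ a x → a :* x := a :* x :+ :0 :* x) refl (ι a) x)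
                                      (cong (λ z → ι a * x + z * x) (sym ι-0))))
                 (trans (π₀-linear a F.0# x x) (FS.solve 2 (λ a x → a FS.:* x FS.:+ F.:0 FS.:* x FS.:= a FS.:* x) refl a (π₀ x)))

  ι-injective : ∀ {a b} → ι a ≡ ι b → a ≡ b
  ι-injective e = trans (sym (π₀-ι _)) (trans (cong π₀ e) (π₀-ι _))

  ι-≢0 : ∀ {a} → a ≢ F.0# → ι a ≢ 0#
  ι-≢0 a≢0 e = a≢0 (ι-injective (trans e (sym ι-0)))

  ι-≢0⁻¹ : ∀ {a} → ι a ≢ 0# → a ≢ F.0#
  ι-≢0⁻¹ ne refl = ne ι-0

  ι-inverse : ∀ {a} → a ≢ F.0# → ι (a F.⁻¹) * ι a ≡ 1#
  ι-inverse a≢0 = trans (sym (ι-* _ _)) (trans (cong ι (F.*-inverseˡ a≢0)) ι-1)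

  π-unique : ∀ {x y} → π₀ x ≡ π₀ y → π₁ x ≡ π₁ y → x ≡ y
  π-unique {x} {y} e e′ = trans (decompose x) (trans (cong₂ compose e e′) (sym (decompose y)))

  π₁≡0⇒ι : ∀ {x} → π₁ x ≡ F.0# → x ≡ ι (π₀ x)
  π₁≡0⇒ι {x} e = trans (decompose x) (trans (cong (compose (π₀ x)) e) (sym (ι-as-compose _)))

  π₀-0 : π₀ 0# ≡ F.0#
  π₀-0 = trans (cong π₀ (sym ι-0)) (π₀-ι _)

  π₁-0 : π₁ 0# ≡ F.0#
  π₁-0 = trans (cong π₁ (sym ι-0)) (π₁-ι _)

  π₁-1 : π₁ 1# ≡ F.0#
  π₁-1 = trans (cong π₁ (sym ι-1)) (π₁-ι _)

  π-≢0 : ∀ {x} → x ≢ 0# → π₀ x ≡ F.0# → π₁ x ≢ F.0#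
  π-≢0 ne e₀ e₁ = ne (π-unique (trans e₀ (sym π₀-0)) (trans e₁ (sym π₁-0)))

  σ-linear : ∀ a b x z → σ (ι a * x + ι b * z) ≡ ι a * σ x + ι b * σ z
  σ-linear a b x z = trans (σ-+ _ _) (cong₂ _+_ (trans (σ-* _ _) (cong (_* σ x) (σ-ι a)))
                                              (trans (σ-* _ _) (cong (_* σ z) (σ-ι b))))

  σ-scale : ∀ a x → σ (ι a * x) ≡ ι a * σ x
  σ-scale a x = trans (σ-* _ _) (cong (_* σ x) (σ-ι a))

  σ-0 : σ 0# ≡ 0#
  σ-0 = trans (cong σ (sym ι-0)) (trans (σ-ι _) ι-0)

  σ-1 : σ 1# ≡ 1#
  σ-1 = trans (cong σ (sym ι-1)) (trans (σ-ι _) ι-1)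

  σ-decompose : ∀ x → σ x ≡ ι (π₀ x) + ι (π₁ x) * σ ω
  σ-decompose x = begin
    σ x ≡⟨ cong σ (decompose x) ⟩
    σ (ι (π₀ x) + ι (π₁ x) * ω) ≡⟨ σ-+ _ _ ⟩
    σ (ι (π₀ x)) + σ (ι (π₁ x) * ω) ≡⟨ cong₂ _+_ (σ-ι _) (σ-scale _ _) ⟩
    ι (π₀ x) + ι (π₁ x) * σ ω ∎
    where open ≡-Reasoning

  σ-σ : ∀ x → σ (σ x) ≡ x
  σ-σ x = begin
    σ (σ x) ≡⟨ cong σ (σ-decompose x) ⟩
    σ (ι (π₀ x) + ι (π₁ x) * σ ω) ≡⟨ trans (σ-+ _ _) (cong₂ _+_ (σ-ι _) (σ-scale _ _)) ⟩
    ι (π₀ x) + ι (π₁ x) * σ (σ ω) ≡⟨ cong (λ z → ι (π₀ x) + ι (π₁ x) * z) σσω ⟩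
    ι (π₀ x) + ι (π₁ x) * ω ≡⟨ decompose x ⟨
    x ∎
    where
    open ≡-Reasoning
    σσω : σ (σ ω) ≡ ω
    σσω = begin
      σ (σ ω) ≡⟨ cong σ σ-ω ⟩
      σ (1# + - ω) ≡⟨ cong σ (trans (solve 1 (λ w → :1 :+ :- w := :1 :* :1 :+ (:- :1) :* w) refl ω)
                          (cong₂ (λ u v → u * 1# + v * ω) (sym ι-1) (trans (cong -_ (sym ι-1)) (sym (ι-neg _))))) ⟩
      σ (ι F.1# * 1# + ι (F.- F.1#) * ω) ≡⟨ σ-linear _ _ _ _ ⟩
      ι F.1# * σ 1# + ι (F.- F.1#) * σ ω ≡⟨ cong₂ _+_ (cong₂ _*_ ι-1 σ-1) (cong₂ _*_ (trans (ι-neg _) (cong -_ ι-1)) σ-ω) ⟩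
      1# * 1# + - 1# * (1# + - ω) ≡⟨ solve 1 (λ w → :1 :* :1 :+ (:- :1) :* (:1 :+ :- w) := w) refl ω ⟩
      ω ∎

  -- The difference is 1 - 2 ω, whose coordinate at 1 is 1 in every characteristic.
  σω-ω≢0 : σ ω + - ω ≢ 0#
  σω-ω≢0 e = F.0≢1 (trans (sym π₀≡0) π₀≡1)
    where
    open ≡-Reasoning
    rewritten : 0# ≡ compose F.1# (F.- F.1# F.+ F.- F.1#)
    rewritten = begin
      0# ≡⟨ e ⟨
      σ ω + - ω ≡⟨ cong (_+ - ω) σ-ω ⟩
      1# + - ω + - ω ≡⟨ solve 1 (λ w → :1 :+ :- w :+ :- w := :1 :+ (:- :1 :+ :- :1) :* w) refl ω ⟩
      1# + (- 1# + - 1#) * ω ≡⟨ cong (λ z → z + (- z + - z) * ω) (sym ι-1) ⟩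
      ι F.1# + (- ι F.1# + - ι F.1#) * ω ≡⟨ cong (λ z → ι F.1# + z * ω) (trans (cong₂ _+_ (sym (ι-neg _)) (sym (ι-neg _))) (sym (ι-+ _ _))) ⟩
      compose F.1# (F.- F.1# F.+ F.- F.1#) ∎
    π₀≡1 : π₀ 0# ≡ F.1#
    π₀≡1 = trans (cong π₀ rewritten) (π₀-compose _ _)
    π₀≡0 : π₀ 0# ≡ F.0#
    π₀≡0 = π₀-0

  σ-≢0 : ∀ {x} → x ≢ 0# → σ x ≢ 0#
  σ-≢0 {x} ne e = ne (trans (sym (σ-σ x)) (trans (cong σ e) σ-0))

  detF : Carrier → Carrier → F.Carrier
  detF x z = π₀ x F.* π₁ z F.+ F.- (π₁ x F.* π₀ z)

  ι-detF : ∀ x z → ι (detF x z) ≡ ι (π₀ x) * ι (π₁ z) + - (ι (π₁ x) * ι (π₀ z))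
  ι-detF x z = trans (ι-+ _ _) (cong₂ _+_ (ι-* _ _) (trans (ι-neg _) (cong -_ (ι-* _ _))))

  -- Both sides are alternating and `F`-bilinear, and they agree at 1, `ω`. This translates
  -- independence over `F` into an equation over `E`.
  detF-σ : ∀ x z → x * σ z + - (z * σ x) ≡ ι (detF x z) * (σ ω + - ω)
  detF-σ x z = begin
    x * σ z + - (z * σ x)
      ≡⟨ cong₂ (λ u v → u * σ z + - (v * σ x)) (decompose x) (decompose z) ⟩
    (ι (π₀ x) + ι (π₁ x) * ω) * σ z + - ((ι (π₀ z) + ι (π₁ z) * ω) * σ x)
      ≡⟨ cong₂ (λ u v → (ι (π₀ x) + ι (π₁ x) * ω) * v + - ((ι (π₀ z) + ι (π₁ z) * ω) * u)) (σ-decompose x) (σ-decompose z) ⟩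
    (ι (π₀ x) + ι (π₁ x) * ω) * (ι (π₀ z) + ι (π₁ z) * σ ω) + - ((ι (π₀ z) + ι (π₁ z) * ω) * (ι (π₀ x) + ι (π₁ x) * σ ω))
      ≡⟨ solve 6 (λ x₀ x₁ z₀ z₁ w s → (x₀ :+ x₁ :* w) :* (z₀ :+ z₁ :* s) :+ :- ((z₀ :+ z₁ :* w) :* (x₀ :+ x₁ :* s))
           := (x₀ :* z₁ :+ :- (x₁ :* z₀)) :* (s :+ :- w)) refl _ _ _ _ _ _ ⟩
    (ι (π₀ x) * ι (π₁ z) + - (ι (π₁ x) * ι (π₀ z))) * (σ ω + - ω)
      ≡⟨ cong (_* (σ ω + - ω)) (ι-detF x z) ⟨
    ι (detF x z) * (σ ω + - ω) ∎
    where open ≡-Reasoning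

  cramer : ∀ x z y → detF x z ≢ F.0# → ∃ λ a → ∃ λ b → y ≡ ι a * x + ι b * z
  cramer x z y D≢0 = a , b , sym (π-unique (trans (π₀-linear a b x z) e₀) (trans (π₁-linear a b x z) e₁))
    where
    D = detF x z
    a = detF y z F.* D F.⁻¹
    b = detF x y F.* D F.⁻¹
    e₀ : a F.* π₀ x F.+ b F.* π₀ z ≡ π₀ y
    e₀ = F.combine₁ (π₀ y) (F.*-inverseʳ D≢0)
      (FS.solve 7 (λ x₀ x₁ z₀ z₁ y₀ y₁ d →
        (y₀ FS.:* z₁ FS.:+ FS.:- (y₁ FS.:* z₀)) FS.:* d FS.:* x₀ FS.:+ (x₀ FS.:* y₁ FS.:+ FS.:- (x₁ FS.:* y₀)) FS.:* d FS.:* z₀ FS.:+ FS.:- y₀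
        FS.:= y₀ FS.:* ((x₀ FS.:* z₁ FS.:+ FS.:- (x₁ FS.:* z₀)) FS.:* d FS.:+ FS.:- F.:1)) refl _ _ _ _ _ _ _)
    e₁ : a F.* π₁ x F.+ b F.* π₁ z ≡ π₁ y
    e₁ = F.combine₁ (π₁ y) (F.*-inverseʳ D≢0)
      (FS.solve 7 (λ x₀ x₁ z₀ z₁ y₀ y₁ d →
        (y₀ FS.:* z₁ FS.:+ FS.:- (y₁ FS.:* z₀)) FS.:* d FS.:* x₁ FS.:+ (x₀ FS.:* y₁ FS.:+ FS.:- (x₁ FS.:* y₀)) FS.:* d FS.:* z₁ FS.:+ FS.:- y₁
        FS.:= y₁ FS.:* ((x₀ FS.:* z₁ FS.:+ FS.:- (x₁ FS.:* z₀)) FS.:* d FS.:+ FS.:- F.:1)) refl _ _ _ _ _ _ _)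

  independent-partner : ∀ x → x ≢ 0# → ∃ λ z → detF x z ≢ F.0#
  independent-partner x x≢0 with π₀ x F.≟ F.0#
  ... | no ne = ω , λ e → ne (trans (sym (trans (cong₂ (λ u v → π₀ x F.* u F.+ F.- (π₁ x F.* v)) π₁-ω π₀-ω)
          (FS.solve 2 (λ a b → a FS.:* F.:1 FS.:+ FS.:- (b FS.:* F.:0) FS.:= a) refl (π₀ x) (π₁ x)))) e)
  ... | yes e₀ = ι F.1# , λ e → x≢0 (π-unique (trans e₀ (sym π₀-0)) (trans (trans
          (FS.solve 2 (λ a b → b FS.:= FS.:- (a FS.:* F.:0 FS.:+ FS.:- (b FS.:* F.:1))) refl (π₀ x) (π₁ x))
          (trans (cong F.-_ (trans (cong₂ (λ u v → π₀ x F.* u F.+ F.- (π₁ x F.* v)) (sym (π₁-ι F.1#)) (sym (π₀-ι F.1#))) e))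
                 (FS.solve 0 (FS.:- F.:0 FS.:= F.:0) refl))) (sym π₁-0)))

-- A parallelism of E² relative to its E-points

-- With T x = a x + b σ x, consider the F-lines of E² spanned by (0 , y), (y , c y ω y)
-- and the graphs of α + β T, β ≠ 0.  Over a given x ≠ 0 their slopes modulo F are
-- c x and β π₁ (κ x); they form a spread because these exhaust F without repetition.
record SpreadData {q r} {F : FField q} {E : FField r} (Q : QuadraticExtension F E) : Set where
  open QuadraticTheory Q
  open FieldTheory E
  open QuadraticExtension Q
  field
    a b : Carrier
    b≢0 : b ≢ 0#
    c : Carrier → F.Carrier
    -- Any ρ other than 0 and 1 forces `c x` to vanish here, so a nonzero `c` is possible only over
    -- the field of two elements. The two constructions of a spread thus share one record.
    c-fixed : ∀ {ρ} x → ρ ≢ F.0# → ρ F.* c x ≡ c x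
    c-scale : ∀ {ρ} x → ρ ≢ F.0# → c (ι ρ * x) ≡ c x
  κ : Carrier → Carrier
  κ x = a + b * (σ x * x ⁻¹)
  field
    slope-avoids : ∀ x {β} → x ≢ 0# → β ≢ F.0# → c x ≢ β F.* π₁ (κ x)
    slope-injective : ∀ x {β γ} → x ≢ 0# → β ≢ F.0# → γ ≢ F.0# → β F.* π₁ (κ x) ≡ γ F.* π₁ (κ x) → β ≡ γ
    slope-covers : ∀ x k → x ≢ 0# → (k ≡ c x) ⊎ (∃ λ β → (β ≢ F.0#) × (k ≡ β F.* π₁ (κ x)))

module Parallelism {q r} {F : FField q} {E : FField r} {Q : QuadraticExtension F E} (S : SpreadData Q) where
  open QuadraticTheory Q
  open FieldTheory E
  open QuadraticExtension Q
  open SpreadData S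
  open Solver using (solve; _:=_; _:*_; _:+_; :-_)
  private
    module FS = F.Solver
    open ≡-Reasoning

  E² : Set
  E² = Carrier × Carrier

  T : Carrier → Carrier
  T x = a * x + b * σ x

  combine : F.Carrier → F.Carrier → E² → E² → E²
  combine k l (u₁ , u₂) (w₁ , w₂) = ι k * u₁ + ι l * w₁ , ι k * u₂ + ι l * w₂

  det : E² → E² → Carrier
  det (u₁ , u₂) (w₁ , w₂) = u₁ * w₂ + - (u₂ * w₁)

  -- inj₁ y : the line through (0 , y) and (λ y , (c y ω + s) y);
  -- inj₂ (α , β) : the line { (λ x , α x + β T x + s x) }.
  Index : Set
  Index = Carrier ⊎ (F.Carrier × F.Carrier)

  Valid : Index → Set
  Valid (inj₁ y) = y ≢ 0#
  Valid (inj₂ (α , β)) = β ≢ F.0#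

  slope : Carrier → Carrier → Carrier → Carrier
  slope s x y = ι (π₀ x) * (ι (c y) * ω + s) + ι (π₁ x)

  -- The image of a line of the base spread (l = 1, s = 0) under (x , y) ↦ (l x , y + s x). The last
  -- argument runs through `E` as a two-dimensional space over `F` and parametrises the line
  -- linearly, whichever kind of line it is.
  Φ : Carrier → Carrier → Index → Carrier → E²
  Φ l s (inj₁ y) x = l * (ι (π₀ x) * y) , slope s x y * y
  Φ l s (inj₂ (α , β)) x = l * x , (ι α + s) * x + ι β * T x

  T-linear : ∀ k l x z → T (ι k * x + ι l * z) ≡ ι k * T x + ι l * T z
  T-linear k l x z = trans (cong (λ y → a * (ι k * x + ι l * z) + b * y) (σ-linear k l x z))
    (solve 8 (λ a b k l x z x′ z′ → a :* (k :* x :+ l :* z) :+ b :* (k :* x′ :+ l :* z′)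
       := k :* (a :* x :+ b :* x′) :+ l :* (a :* z :+ b :* z′)) refl a b (ι k) (ι l) x z (σ x) (σ z))

  Φ-linear : ∀ l s i k m x z → Φ l s i (ι k * x + ι m * z) ≡ combine k m (Φ l s i x) (Φ l s i z)
  Φ-linear l s (inj₁ y) k m x z = cong₂ _,_
    (trans (cong (λ u → l * (u * y)) e₀)
      (solve 6 (λ l y k m x z → l :* ((k :* x :+ m :* z) :* y) := k :* (l :* (x :* y)) :+ m :* (l :* (z :* y)))
        refl l y (ι k) (ι m) (ι (π₀ x)) (ι (π₀ z))))
    (trans (cong₂ (λ u v → (u * g + v) * y) e₀ e₁)
      (solve 8 (λ g y k m x z x′ z′ → ((k :* x :+ m :* z) :* g :+ (k :* x′ :+ m :* z′)) :* y
          := k :* ((x :* g :+ x′) :* y) :+ m :* ((z :* g :+ z′) :* y))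
        refl g y (ι k) (ι m) (ι (π₀ x)) (ι (π₀ z)) (ι (π₁ x)) (ι (π₁ z))))
    where
    g = ι (c y) * ω + s
    e₀ = trans (cong ι (π₀-linear k m x z)) (ι-linear k m (π₀ x) (π₀ z))
    e₁ = trans (cong ι (π₁-linear k m x z)) (ι-linear k m (π₁ x) (π₁ z))
  Φ-linear l s (inj₂ (α , β)) k m x z = cong₂ _,_
    (solve 5 (λ l k m x z → l :* (k :* x :+ m :* z) := k :* (l :* x) :+ m :* (l :* z)) refl l (ι k) (ι m) x z)
    (trans (cong (λ u → (ι α + s) * (ι k * x + ι m * z) + ι β * u) (T-linear k m x z))
      (solve 8 (λ g h k m x z x′ z′ → g :* (k :* x :+ m :* z) :+ h :* (k :* x′ :+ m :* z′)
          := k :* (g :* x :+ h :* x′) :+ m :* (g :* z :+ h :* z′))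
        refl (ι α + s) (ι β) (ι k) (ι m) x z (T x) (T z)))

  -- For a graph, the terms with `α`, `s` and `a` cancel and the rest is the expression of `detF-σ`.
  -- The factor is nonzero for nonzero `l` and a valid index, so that no line of the spread lies in
  -- an `E`-point.
  det-Φ : ∀ l s i x z → ∃ λ m → det (Φ l s i x) (Φ l s i z) ≡ ι (detF x z) * (l * m)
  det-Φ l s (inj₁ y) x z = y * y ,
    trans (solve 7 (λ l y g x z x′ z′ → l :* (x :* y) :* ((z :* g :+ z′) :* y) :+ :- ((x :* g :+ x′) :* y :* (l :* (z :* y)))
             := (x :* z′ :+ :- (x′ :* z)) :* (l :* (y :* y))) refl l y (ι (c y) * ω + s) _ _ _ _)
      (cong (_* (l * (y * y))) (sym (ι-detF x z)))
  det-Φ l s (inj₂ (α , β)) x z = ι β * b * (σ ω + - ω) , (begin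
    l * x * (g * z + ι β * T z) + - ((g * x + ι β * T x) * (l * z))
      ≡⟨ solve 9 (λ l g h a b x z x′ z′ → l :* x :* (g :* z :+ h :* (a :* z :+ b :* z′)) :+ :- ((g :* x :+ h :* (a :* x :+ b :* x′)) :* (l :* z))
            := (x :* z′ :+ :- (z :* x′)) :* (l :* (h :* b))) refl l g (ι β) a b x z (σ x) (σ z) ⟩
    (x * σ z + - (z * σ x)) * (l * (ι β * b)) ≡⟨ cong (_* (l * (ι β * b))) (detF-σ x z) ⟩
    ι (detF x z) * (σ ω + - ω) * (l * (ι β * b))
      ≡⟨ solve 5 (λ d w l h b → d :* w :* (l :* (h :* b)) := d :* (l :* (h :* b :* w))) refl _ _ _ _ _ ⟩
    ι (detF x z) * (l * (ι β * b * (σ ω + - ω))) ∎)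
    where g = ι α + s

  det-Φ-≢0 : ∀ {l s} i {x z} → l ≢ 0# → Valid i → detF x z ≢ F.0# → det (Φ l s i x) (Φ l s i z) ≢ 0#
  det-Φ-≢0 {l} {s} i@(inj₁ y) {x} {z} l≢0 v D≢0 =
    ≢0-cong (sym (proj₂ (det-Φ l s i x z))) (*-≢0 (ι-≢0 D≢0) (*-≢0 l≢0 (*-≢0 v v)))
  det-Φ-≢0 {l} {s} i@(inj₂ (α , β)) {x} {z} l≢0 v D≢0 =
    ≢0-cong (sym (proj₂ (det-Φ l s i x z))) (*-≢0 (ι-≢0 D≢0) (*-≢0 l≢0 (*-≢0 (*-≢0 (ι-≢0 v) b≢0) σω-ω≢0)))

  detF-Φ : ∀ {l s} i {x z} → det (Φ l s i x) (Φ l s i z) ≢ 0# → detF x z ≢ F.0#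
  detF-Φ {l} {s} i {x} {z} ne D≡0 = ne (trans (proj₂ (det-Φ l s i x z))
    (trans (cong (_* (l * proj₁ (det-Φ l s i x z))) (trans (cong ι D≡0) ι-0)) (zeroˡ _)))

  -- Independence of the two vectors is not part of the relation, only that one line of the spread
  -- contains both; hence it is stable under `F`-combinations.
  Class : Carrier → Carrier → E² → E² → Set
  Class l s u w = ∃ λ i → Valid i × (∃ λ x → ∃ λ z → (u ≡ Φ l s i x) × (w ≡ Φ l s i z))

  Class-combine : ∀ {l s u w} k₁ m₁ k₂ m₂ → Class l s u w → Class l s (combine k₁ m₁ u w) (combine k₂ m₂ u w)
  Class-combine {l} {s} k₁ m₁ k₂ m₂ (i , v , x , z , refl , refl) =
    i , v , _ , _ , sym (Φ-linear l s i k₁ m₁ x z) , sym (Φ-linear l s i k₂ m₂ x z)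

  T-scale : ∀ k x → T (ι k * x) ≡ ι k * T x
  T-scale k x = trans (cong (λ y → a * (ι k * x) + b * y) (σ-scale k x))
    (solve 5 (λ a b k x x′ → a :* (k :* x) :+ b :* (k :* x′) := k :* (a :* x :+ b :* x′)) refl a b (ι k) x (σ x))

  T-κ : ∀ {x} → x ≢ 0# → T x ≡ κ x * x
  T-κ {x} x≢0 = combine₁ (- (b * σ x)) (*-inverseʳ x≢0)
    (solve 5 (λ a b x x′ y → a :* x :+ b :* x′ :+ :- ((a :+ b :* (x′ :* y)) :* x) := :- (b :* x′) :* (x :* y :+ :- :1))
      refl a b x (σ x) (x ⁻¹))

  -- Two maps (x , y) ↦ (l x , y + s x) in the same coset of the subgroup with `l` = ρ and `s` = f
  -- in `F`, which preserves the base spread.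
  data Equivalent (l s : Carrier) : Carrier → Carrier → Set where
    rescale : ∀ {ρ} f → ρ ≢ F.0# → Equivalent l s (ι ρ * l) (ι ρ * s + ι f)

  -- The graph of α + β T becomes the one with parameters ρ α - f and ρ β. A line of the other kind
  -- keeps its index and only changes its parameter, thanks to `c-fixed`.
  Class-equivalent : ∀ {l s l′ s′ u w} → Equivalent l s l′ s′ → Class l s u w → Class l′ s′ u w
  Class-equivalent {l} {s} (rescale {ρ} f ρ≢0) (i@(inj₁ y) , v , x , z , refl , refl) =
    i , v , _ , _ , moved x , moved z
    where
    j = ι (ρ F.⁻¹)
    j*ρ : j * ι ρ ≡ 1#
    j*ρ = ι-inverse ρ≢0
    cy : ι ρ * ι (c y) ≡ ι (c y)
    cy = trans (sym (ι-* _ _)) (cong ι (c-fixed y ρ≢0))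
    y₀ y₁ : Carrier → F.Carrier
    y₀ x = ρ F.⁻¹ F.* π₀ x
    y₁ x = π₁ x F.+ F.- (ρ F.⁻¹ F.* π₀ x F.* f)
    moved : ∀ x → Φ l s i x ≡ Φ (ι ρ * l) (ι ρ * s + ι f) i (compose (y₀ x) (y₁ x))
    moved x = sym (cong₂ _,_
      (trans (cong (λ u → ι ρ * l * (u * y)) e₀)
        (combine₁ (ι (π₀ x) * l * y) j*ρ
          (solve 5 (λ r j l x y → r :* l :* (j :* x :* y) :+ :- (l :* (x :* y)) := x :* l :* y :* (j :* r :+ :- :1)) refl (ι ρ) j l (ι (π₀ x)) y)))
      (cong (_* y) (trans (cong₂ (λ u v → u * (ι (c y) * ω + (ι ρ * s + ι f)) + v) e₀ e₁)
        (combine₂ (ι (π₀ x) * (s + ι (c y) * ω)) (- (j * ι (π₀ x) * ω)) j*ρ cy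
          (solve 8 (λ r j s x₀ x₁ g w f → j :* x₀ :* (g :* w :+ (r :* s :+ f)) :+ (x₁ :+ :- (j :* x₀ :* f)) :+ :- (x₀ :* (g :* w :+ s) :+ x₁)
            := x₀ :* (s :+ g :* w) :* (j :* r :+ :- :1) :+ (:- (j :* x₀ :* w)) :* (r :* g :+ :- g))
            refl (ι ρ) j s (ι (π₀ x)) (ι (π₁ x)) (ι (c y)) ω (ι f))))))
      where
      e₀ : ι (π₀ (compose (y₀ x) (y₁ x))) ≡ j * ι (π₀ x)
      e₀ = trans (cong ι (π₀-compose _ _)) (ι-* _ _)
      e₁ : ι (π₁ (compose (y₀ x) (y₁ x))) ≡ ι (π₁ x) + - (j * ι (π₀ x) * ι f)
      e₁ = trans (cong ι (π₁-compose _ _)) (trans (ι-+ _ _) (cong (ι (π₁ x) +_)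
        (trans (ι-neg _) (cong -_ (trans (ι-* _ _) (cong (_* ι f) (ι-* _ _)))))))
  Class-equivalent {l} {s} (rescale {ρ} f ρ≢0) (i@(inj₂ (α , β)) , v , x , z , refl , refl) =
    inj₂ (ρ F.* α F.+ F.- f , ρ F.* β) , F.*-≢0 ρ≢0 v , _ , _ , moved x , moved z
    where
    j = ι (ρ F.⁻¹)
    j*ρ : j * ι ρ ≡ 1#
    j*ρ = ι-inverse ρ≢0
    moved : ∀ x → Φ l s i x ≡ Φ (ι ρ * l) (ι ρ * s + ι f) (inj₂ (ρ F.* α F.+ F.- f , ρ F.* β)) (j * x)
    moved x = sym (cong₂ _,_
      (combine₁ (l * x) j*ρ (solve 4 (λ r j l x → r :* l :* (j :* x) :+ :- (l :* x) := l :* x :* (j :* r :+ :- :1)) refl (ι ρ) j l x))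
      (trans (cong₂ (λ u v → (u + (ι ρ * s + ι f)) * (j * x) + v)
          (trans (ι-+ _ _) (cong₂ _+_ (ι-* _ _) (ι-neg _))) (cong₂ _*_ (ι-* _ _) (T-scale _ x)))
        (combine₁ ((ι α + s) * x + ι β * T x) j*ρ
          (solve 8 (λ r j s f p h x y → (r :* p :+ :- f :+ (r :* s :+ f)) :* (j :* x) :+ r :* h :* (j :* y) :+ :- ((p :+ s) :* x :+ h :* y)
            := ((p :+ s) :* x :+ h :* y) :* (j :* r :+ :- :1)) refl (ι ρ) j s (ι f) (ι α) (ι β) x (T x)))))

  SameImage : Carrier → Carrier → Index → Index → Set
  SameImage l s i j = ∀ z → ∃ λ z′ → Φ l s j z ≡ Φ l s i z′

  axis-rescale : ∀ {l s y y′ ρ} → ρ ≢ F.0# → y ≡ ι ρ * y′ → SameImage l s (inj₁ y) (inj₁ y′)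
  axis-rescale {l} {s} {y} {y′} {ρ} ρ≢0 refl z = j * z , sym (cong₂ _,_
      (trans (cong (λ u → l * (u * (ι ρ * y′))) e₀)
        (combine₁ (l * (ι (π₀ z) * y′)) j*ρ (solve 5 (λ r j l x y → l :* (j :* x :* (r :* y)) :+ :- (l :* (x :* y)) := l :* (x :* y) :* (j :* r :+ :- :1))
           refl (ι ρ) j l (ι (π₀ z)) y′)))
      (trans (cong₂ (λ u v → (u * (ι (c (ι ρ * y′)) * ω + s) + v) * (ι ρ * y′)) e₀ e₁)
        (trans (cong (λ g → (j * ι (π₀ z) * (ι g * ω + s) + j * ι (π₁ z)) * (ι ρ * y′)) (c-scale y′ ρ≢0))
        (combine₁ ((ι (π₀ z) * h + ι (π₁ z)) * y′) j*ρ
          (solve 6 (λ r j x₀ x₁ h y → (j :* x₀ :* h :+ j :* x₁) :* (r :* y) :+ :- ((x₀ :* h :+ x₁) :* y) := (x₀ :* h :+ x₁) :* y :* (j :* r :+ :- :1))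
            refl (ι ρ) j (ι (π₀ z)) (ι (π₁ z)) h y′)))))
    where
    j = ι (ρ F.⁻¹)
    j*ρ : j * ι ρ ≡ 1#
    j*ρ = ι-inverse ρ≢0
    h = ι (c y′) * ω + s
    e₀ : ι (π₀ (j * z)) ≡ j * ι (π₀ z)
    e₀ = trans (cong ι (π₀-scale _ z)) (ι-* _ _)
    e₁ : ι (π₁ (j * z)) ≡ j * ι (π₁ z)
    e₁ = trans (cong ι (π₁-scale _ z)) (ι-* _ _)

  ratio : ∀ {x x′ y y′} → y ≢ 0# → x ≢ F.0# → ι x * y ≡ ι x′ * y′ → ∃ λ ρ → (ρ ≢ F.0#) × (y ≡ ι ρ * y′)
  ratio {x} {x′} {y} {y′} y≢0 x≢0 e = ρ , ι-≢0⁻¹ (*-≢0ˡ (≢0-cong eq y≢0)) , eq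
    where
    ρ = x F.⁻¹ F.* x′
    eq : y ≡ ι ρ * y′
    eq = cancel-*ˡ (ι-≢0 x≢0) (trans e (sym (trans (cong (λ u → ι x * (u * y′)) (ι-* _ _))
      (combine₁ (ι x′ * y′) (ι-inverse x≢0)
        (solve 4 (λ x j x′ y → x :* (j :* x′ :* y) :+ :- (x′ :* y) := x′ :* y :* (j :* x :+ :- :1)) refl _ _ _ _)))))

  slope-0 : ∀ {s x y} → π₀ x ≡ F.0# → slope s x y ≡ ι (π₁ x)
  slope-0 {s} {x} {y} e = trans (cong (λ u → u * (ι (c y) * ω + s) + ι (π₁ x)) (trans (cong ι e) ι-0))
    (solve 2 (λ g x → :0 :* g :+ x := x) refl _ _)

  -- A common nonzero vector has first coordinate an `F`-multiple of `l * y`; dividing by that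
  -- multiple of `y` and working modulo `F`, the two slopes over `y` would be `c y` and
  -- `β π₁ (κ y)`, which `slope-avoids` excludes.
  axis≢graph : ∀ {l s y α β x x′} → l ≢ 0# → y ≢ 0# → β ≢ F.0# → x ≢ 0# →
               Φ l s (inj₁ y) x ≢ Φ l s (inj₂ (α , β)) x′
  axis≢graph {l} {s} {y} {α} {β} {x} {x′} l≢0 y≢0 β≢0 x≢0 e = slope-avoids y y≢0 β≢0 slopes
    where
    x′-def : ι (π₀ x) * y ≡ x′
    x′-def = cancel-*ˡ l≢0 (cong proj₁ e)
    second : slope s x y ≡ ((ι α + s) + ι β * κ y) * ι (π₀ x)
    second = cancel-*ʳ y≢0 (begin
      slope s x y * y ≡⟨ cong proj₂ e ⟩
      (ι α + s) * x′ + ι β * T x′ ≡⟨ cong (λ u → (ι α + s) * u + ι β * T u) (sym x′-def) ⟩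
      (ι α + s) * (ι (π₀ x) * y) + ι β * T (ι (π₀ x) * y)
        ≡⟨ cong (λ u → (ι α + s) * (ι (π₀ x) * y) + ι β * u) (trans (T-scale _ y) (cong (ι (π₀ x) *_) (T-κ y≢0))) ⟩
      (ι α + s) * (ι (π₀ x) * y) + ι β * (ι (π₀ x) * (κ y * y))
        ≡⟨ solve 5 (λ g h x k y → g :* (x :* y) :+ h :* (x :* (k :* y)) := (g :+ h :* k) :* x :* y) refl (ι α + s) (ι β) (ι (π₀ x)) (κ y) y ⟩
      ((ι α + s) + ι β * κ y) * ι (π₀ x) * y ∎)
    -- Otherwise the first coordinate is zero, and a graph has only the zero vector there.
    π₀x≢0 : π₀ x ≢ F.0#
    π₀x≢0 p = π-≢0 x≢0 p (ι-injective (begin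
      ι (π₁ x) ≡⟨ slope-0 {s} {x} {y} p ⟨
      slope s x y ≡⟨ second ⟩
      ((ι α + s) + ι β * κ y) * ι (π₀ x) ≡⟨ cong ((ι α + s + ι β * κ y) *_) (trans (cong ι p) ι-0) ⟩
      ((ι α + s) + ι β * κ y) * 0# ≡⟨ zeroʳ _ ⟩
      0# ≡⟨ ι-0 ⟨
      ι F.0# ∎))
    -- `s` has cancelled. Both sides are `F`-combinations of `ω`, 1 and `κ y`, so `π₁` applies and
    -- removes the terms at 1.
    balanced : ι (π₀ x F.* c y) * ω + ι (π₁ x) * 1# ≡ ι (α F.* π₀ x) * 1# + ι (π₀ x F.* β) * κ y
    balanced = begin
      ι (π₀ x F.* c y) * ω + ι (π₁ x) * 1# ≡⟨ cong (λ u → u * ω + ι (π₁ x) * 1#) (ι-* _ _) ⟩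
      ι (π₀ x) * ι (c y) * ω + ι (π₁ x) * 1#
        ≡⟨ combine₁ 1# second (solve 8 (λ x x′ c w s α β k → x :* c :* w :+ x′ :* :1 :+ :- (α :* x :* :1 :+ x :* β :* k)
             := :1 :* (x :* (c :* w :+ s) :+ x′ :+ :- ((α :+ s :+ β :* k) :* x))) refl (ι (π₀ x)) (ι (π₁ x)) (ι (c y)) ω s (ι α) (ι β) (κ y)) ⟩
      ι α * ι (π₀ x) * 1# + ι (π₀ x) * ι β * κ y ≡⟨ cong₂ (λ u v → u * 1# + v * κ y) (ι-* _ _) (ι-* _ _) ⟨
      ι (α F.* π₀ x) * 1# + ι (π₀ x F.* β) * κ y ∎
    slopes : c y ≡ β F.* π₁ (κ y)
    slopes = F.cancel-*ˡ π₀x≢0 (begin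
      π₀ x F.* c y ≡⟨ FS.solve 2 (λ p q → p FS.:= p FS.:* F.:1 FS.:+ q FS.:* F.:0) refl _ (π₁ x) ⟩
      π₀ x F.* c y F.* F.1# F.+ π₁ x F.* F.0# ≡⟨ cong₂ (λ u v → π₀ x F.* c y F.* u F.+ π₁ x F.* v) (sym π₁-ω) (sym π₁-1) ⟩
      π₀ x F.* c y F.* π₁ ω F.+ π₁ x F.* π₁ 1# ≡⟨ π₁-linear _ _ _ _ ⟨
      π₁ (ι (π₀ x F.* c y) * ω + ι (π₁ x) * 1#) ≡⟨ cong π₁ balanced ⟩
      π₁ (ι (α F.* π₀ x) * 1# + ι (π₀ x F.* β) * κ y) ≡⟨ π₁-linear _ _ _ _ ⟩
      α F.* π₀ x F.* π₁ 1# F.+ π₀ x F.* β F.* π₁ (κ y) ≡⟨ cong (λ u → α F.* π₀ x F.* u F.+ π₀ x F.* β F.* π₁ (κ y)) π₁-1 ⟩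
      α F.* π₀ x F.* F.0# F.+ π₀ x F.* β F.* π₁ (κ y)
        ≡⟨ FS.solve 4 (λ a x b k → a FS.:* x FS.:* F.:0 FS.:+ x FS.:* b FS.:* k FS.:= x FS.:* (b FS.:* k)) refl α (π₀ x) β (π₁ (κ y)) ⟩
      π₀ x F.* (β F.* π₁ (κ y)) ∎)

  -- Division by `x` leaves α + s + β κ x. Under `π₁` only the `β` term differs, where
  -- `slope-injective` decides; `α` is then determined.
  graph-unique : ∀ {s x α β α′ β′} → x ≢ 0# → β ≢ F.0# → β′ ≢ F.0# →
                 (ι α + s) * x + ι β * T x ≡ (ι α′ + s) * x + ι β′ * T x → (α , β) ≡ (α′ , β′)
  graph-unique {s} {x} {α} {β} {α′} {β′} x≢0 β≢0 β′≢0 e = cong₂ _,_ (sym α≡) β≡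
    where
    balanced : ι α * 1# + ι β * κ x ≡ ι α′ * 1# + ι β′ * κ x
    balanced = cancel-*ʳ x≢0 (combine₁ 1#
      (trans (cong (λ u → (ι α + s) * x + ι β * u) (sym (T-κ x≢0))) (trans e (cong (λ u → (ι α′ + s) * x + ι β′ * u) (T-κ x≢0))))
      (solve 7 (λ a b a′ b′ s x k → (a :* :1 :+ b :* k) :* x :+ :- ((a′ :* :1 :+ b′ :* k) :* x)
        := :1 :* ((a :+ s) :* x :+ b :* (k :* x) :+ :- ((a′ :+ s) :* x :+ b′ :* (k :* x)))) refl (ι α) (ι β) (ι α′) (ι β′) s x (κ x)))
    π₁-part : ∀ α β → π₁ (ι α * 1# + ι β * κ x) ≡ β F.* π₁ (κ x)
    π₁-part α β = trans (π₁-linear α β 1# (κ x)) (trans (cong (λ u → α F.* u F.+ β F.* π₁ (κ x)) π₁-1)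
      (FS.solve 2 (λ a b → a FS.:* F.:0 FS.:+ b FS.:= b) refl α (β F.* π₁ (κ x))))
    β≡ : β ≡ β′
    β≡ = slope-injective x x≢0 β≢0 β′≢0 (trans (sym (π₁-part α β)) (trans (cong π₁ balanced) (π₁-part α′ β′)))
    α≡ : α′ ≡ α
    α≡ = ι-injective (combine₁ (- 1#) (trans balanced (cong (λ u → ι α′ * 1# + ι u * κ x) (sym β≡)))
      (solve 4 (λ a a′ b k → a′ :+ :- a := :- :1 :* (a :* :1 :+ b :* k :+ :- (a′ :* :1 :+ b :* k))) refl (ι α) (ι α′) (ι β) (κ x)))

  axis-same : ∀ {l s y y′ x x′} → l ≢ 0# → y ≢ 0# → x ≢ 0# →
              Φ l s (inj₁ y) x ≡ Φ l s (inj₁ y′) x′ → ∃ λ ρ → (ρ ≢ F.0#) × (y ≡ ι ρ * y′)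
  axis-same {l} {s} {y} {y′} {x} {x′} l≢0 y≢0 x≢0 e = go (π₀ x F.≟ F.0#)
    where
    first : ι (π₀ x) * y ≡ ι (π₀ x′) * y′
    first = cancel-*ˡ l≢0 (cong proj₁ e)
    go : Dec (π₀ x ≡ F.0#) → ∃ λ ρ → (ρ ≢ F.0#) × (y ≡ ι ρ * y′)
    go (no π₀x≢0) = ratio {x = π₀ x} {x′ = π₀ x′} y≢0 π₀x≢0 first
    go (yes π₀x≡0) = ratio {x = π₁ x} {x′ = π₁ x′} y≢0 (π-≢0 x≢0 π₀x≡0) second
      where
      e₀ : 0# ≡ ι (π₀ x′) * y′
      e₀ = trans (sym (trans (cong (λ u → ι u * y) π₀x≡0) (trans (cong (_* y) ι-0) (zeroˡ y)))) first
      second : ι (π₁ x) * y ≡ ι (π₁ x′) * y′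
      second = begin
        ι (π₁ x) * y ≡⟨ cong (_* y) (slope-0 {s} {x} {y} π₀x≡0) ⟨
        slope s x y * y ≡⟨ cong proj₂ e ⟩
        slope s x′ y′ * y′ ≡⟨ solve 4 (λ x g x′ y → (x :* g :+ x′) :* y := (x :* y) :* g :+ x′ :* y) refl _ _ _ y′ ⟩
        ι (π₀ x′) * y′ * (ι (c y′) * ω + s) + ι (π₁ x′) * y′ ≡⟨ cong (λ u → u * (ι (c y′) * ω + s) + ι (π₁ x′) * y′) (sym e₀) ⟩
        0# * (ι (c y′) * ω + s) + ι (π₁ x′) * y′ ≡⟨ solve 2 (λ g y → :0 :* g :+ y := y) refl _ _ ⟩
        ι (π₁ x′) * y′ ∎

  graph-same : ∀ {l s α β α′ β′ x x′} → l ≢ 0# → x ≢ 0# → β ≢ F.0# → β′ ≢ F.0# →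
               Φ l s (inj₂ (α , β)) x ≡ Φ l s (inj₂ (α′ , β′)) x′ → (α , β) ≡ (α′ , β′)
  graph-same {l} {s} {α} {β} {α′} {β′} {x} {x′} l≢0 x≢0 v v′ e = graph-unique x≢0 v v′
      (trans (cong proj₂ e) (cong (λ u → (ι α′ + s) * u + ι β′ * T u) (sym first)))
    where
    first : x ≡ x′
    first = cancel-*ˡ l≢0 (cong proj₁ e)

  graph≢axis : ∀ {l s y α β x x′} → l ≢ 0# → y ≢ 0# → β ≢ F.0# → x ≢ 0# →
               Φ l s (inj₂ (α , β)) x ≢ Φ l s (inj₁ y) x′
  graph≢axis {l} {s} {y} {α} {β} {x} {x′} l≢0 y≢0 β≢0 x≢0 e = axis≢graph l≢0 y≢0 β≢0 x′≢0 (sym e)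
    where
    x′≢0 : x′ ≢ 0#
    x′≢0 z = *-≢0 l≢0 x≢0 (begin
      l * x ≡⟨ cong proj₁ e ⟩
      l * (ι (π₀ x′) * y) ≡⟨ cong (λ u → l * (u * y)) (trans (cong ι (trans (cong π₀ z) π₀-0)) ι-0) ⟩
      l * (0# * y) ≡⟨ solve 2 (λ l y → l :* (:0 :* y) := :0) refl l y ⟩
      0# ∎)

  -- This is disjointness of the spread. Indices `inj₁ y` and `inj₁ (ι ρ * y)` name one line, hence
  -- a conclusion about images and not indices.
  same-image : ∀ {l s} i j {x x′} → l ≢ 0# → Valid i → Valid j → x ≢ 0# → Φ l s i x ≡ Φ l s j x′ → SameImage l s i j
  same-image {l} {s} (inj₁ y) (inj₁ y′) {x} {x′} l≢0 v v′ x≢0 e =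
    let ρ , ρ≢0 , eq = axis-same {l} {s} {y} {y′} {x} {x′} l≢0 v x≢0 e in axis-rescale {l} {s} {y} {y′} {ρ} ρ≢0 eq
  same-image {l} {s} (inj₁ y) (inj₂ (α , β)) {x} {x′} l≢0 v v′ x≢0 e =
    ⊥-elim (axis≢graph {l} {s} {y} {α} {β} {x} {x′} l≢0 v v′ x≢0 e)
  same-image {l} {s} (inj₂ (α , β)) (inj₁ y) {x} {x′} l≢0 v v′ x≢0 e =
    ⊥-elim (graph≢axis {l} {s} {y} {α} {β} {x} {x′} l≢0 v′ v x≢0 e)
  same-image {l} {s} (inj₂ g) (inj₂ g′) {x} {x′} l≢0 v v′ x≢0 e z =
    z , cong (λ i → Φ l s (inj₂ i) z) (sym (graph-same {l} {s} {proj₁ g} {proj₂ g} {proj₁ g′} {proj₂ g′} {x} {x′} l≢0 x≢0 v v′ e))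

  detF-≢0ˡ : ∀ {x z} → detF x z ≢ F.0# → x ≢ 0#
  detF-≢0ˡ {z = z} ne refl = ne (trans (cong₂ (λ p q → p F.* π₁ z F.+ F.- (q F.* π₀ z)) π₀-0 π₁-0)
    (FS.solve 2 (λ y z → F.:0 FS.:* y FS.:+ FS.:- (F.:0 FS.:* z) FS.:= F.:0) refl _ _))

  Class-proper : ∀ {l s u w w′} → l ≢ 0# → det u w ≢ 0# → Class l s u w → Class l s u w′ →
                 ∃ λ k → ∃ λ m → w′ ≡ combine k m u w
  Class-proper {l} {s} l≢0 d≢0 (i , v , x , z , refl , refl) (j , v′ , x′ , z′ , e , refl) =
    let D≢0 = detF-Φ {l} {s} i {x} {z} d≢0
        z″ , e′ = same-image {l} {s} i j {x} {x′} l≢0 v v′ (detF-≢0ˡ {x} {z} D≢0) e z′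
        k , m , e″ = cramer x z z″ D≢0
    in k , m , trans e′ (trans (cong (Φ l s i) e″) (Φ-linear l s i k m x z))

  -- With nonzero first coordinate, undo `l` and `s`: the slope `k` over `x` lies modulo `F` in the
  -- class of `c x` or of some β κ x, by `slope-covers`. The coordinate `π₀ k` then fixes the point
  -- on the axis line, respectively the parameter `α` of the graph.
  on-spread : ∀ {l s} u → l ≢ 0# → (u ≢ (0# , 0#)) → ∃ λ i → Valid i × ∃ λ x → (x ≢ 0#) × (u ≡ Φ l s i x)
  on-spread {l} {s} (u₁ , u₂) l≢0 u≢0 with u₁ ≟ 0#
  ... | yes refl = inj₁ u₂ , (λ { refl → u≢0 refl }) , ω , (λ e → F.0≢1 (trans (sym π₁-0) (trans (cong π₁ (sym e)) π₁-ω)))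
    , sym (cong₂ _,_ (trans (cong (λ u → l * (u * u₂)) (trans (cong ι π₀-ω) ι-0)) (solve 2 (λ l y → l :* (:0 :* y) := :0) refl l u₂))
                     (trans (cong (_* u₂) (trans (slope-0 {s} {ω} {u₂} π₀-ω) (trans (cong ι π₁-ω) ι-1))) (*-identityˡ u₂)))
  ... | no u₁≢0 = by-slope (slope-covers x (π₁ k) x≢0)
    where
    x = u₁ * l ⁻¹
    x≢0 : x ≢ 0#
    x≢0 = *-≢0 u₁≢0 (⁻¹-≢0 l≢0)
    k = u₂ * x ⁻¹ + - s
    lx : l * x ≡ u₁
    lx = combine₁ u₁ (*-inverseʳ l≢0) (solve 3 (λ l u j → l :* (u :* j) :+ :- u := u :* (l :* j :+ :- :1)) refl l u₁ (l ⁻¹))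
    Result = ∃ λ i → Valid i × ∃ λ x → (x ≢ 0#) × ((u₁ , u₂) ≡ Φ l s i x)
    u₂-def : (k + s) * x ≡ u₂
    u₂-def = combine₁ u₂ (*-inverseʳ x≢0) (solve 4 (λ u j s x → (u :* j :+ :- s :+ s) :* x :+ :- u := u :* (x :* j :+ :- :1)) refl u₂ (x ⁻¹) s x)
    by-slope : (π₁ k ≡ c x) ⊎ (∃ λ β → (β ≢ F.0#) × (π₁ k ≡ β F.* π₁ (κ x))) → Result
    by-slope (inj₁ e) = inj₁ x , x≢0 , compose F.1# (π₀ k) ,
      (λ z → F.0≢1 (trans (sym π₀-0) (trans (cong π₀ (sym z)) (π₀-compose _ _)))) ,
      sym (cong₂ _,_
        (trans (cong (λ u → l * (u * x)) e₀) (trans (cong (l *_) (*-identityˡ x)) lx))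
        (trans (cong (_* x) (begin
            ι (π₀ y) * (ι (c x) * ω + s) + ι (π₁ y) ≡⟨ cong₂ (λ u v → u * (ι (c x) * ω + s) + v) e₀ (cong ι (π₁-compose _ _)) ⟩
            1# * (ι (c x) * ω + s) + ι (π₀ k) ≡⟨ cong (λ u → 1# * (ι u * ω + s) + ι (π₀ k)) (sym e) ⟩
            1# * (ι (π₁ k) * ω + s) + ι (π₀ k) ≡⟨ solve 4 (λ c w s k → :1 :* (c :* w :+ s) :+ k := k :+ c :* w :+ s) refl _ ω s _ ⟩
            compose (π₀ k) (π₁ k) + s ≡⟨ cong (_+ s) (decompose k) ⟨
            k + s ∎)) u₂-def))
      where
      y = compose F.1# (π₀ k)
      e₀ : ι (π₀ y) ≡ 1#
      e₀ = trans (cong ι (π₀-compose _ _)) ι-1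
    by-slope (inj₂ (β , β≢0 , e)) = inj₂ (α , β) , β≢0 , x , x≢0 , sym (cong₂ _,_ lx (begin
        (ι α + s) * x + ι β * T x ≡⟨ cong (λ u → (ι α + s) * x + ι β * u) (T-κ x≢0) ⟩
        (ι α + s) * x + ι β * (κ x * x) ≡⟨ solve 5 (λ a s x b k → (a :+ s) :* x :+ b :* (k :* x) := (a :+ b :* k :+ s) :* x) refl _ s x _ _ ⟩
        (ι α + ι β * κ x + s) * x ≡⟨ cong (λ u → (u + s) * x) k-def ⟩
        (k + s) * x ≡⟨ u₂-def ⟩
        u₂ ∎))
      where
      α = π₀ k F.+ F.- (β F.* π₀ (κ x))
      k-def : ι α + ι β * κ x ≡ k
      k-def = begin
        ι α + ι β * κ x ≡⟨ cong₂ (λ u v → u + ι β * v) (trans (ι-+ _ _) (cong (ι (π₀ k) +_) (trans (ι-neg _) (cong -_ (ι-* _ _))))) (decompose (κ x)) ⟩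
        ι (π₀ k) + - (ι β * ι (π₀ (κ x))) + ι β * (ι (π₀ (κ x)) + ι (π₁ (κ x)) * ω)
          ≡⟨ solve 5 (λ k b p q w → k :+ :- (b :* p) :+ b :* (p :+ q :* w) := k :+ b :* q :* w) refl _ _ _ _ ω ⟩
        ι (π₀ k) + ι β * ι (π₁ (κ x)) * ω ≡⟨ cong (λ u → ι (π₀ k) + u * ω) (trans (sym (ι-* _ _)) (cong ι (sym e))) ⟩
        ι (π₀ k) + ι (π₁ k) * ω ≡⟨ decompose k ⟨
        k ∎

  Class-covers : ∀ {l s} u → l ≢ 0# → u ≢ (0# , 0#) → ∃ λ w → det u w ≢ 0# × Class l s u w
  Class-covers {l} {s} u l≢0 u≢0 =
    let i , v , x , x≢0 , e = on-spread {l} {s} u l≢0 u≢0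
        z , D≢0 = independent-partner x x≢0
    in Φ l s i z , subst (λ u → det u (Φ l s i z) ≢ 0#) (sym e) (det-Φ-≢0 {l} {s} i {x} {z} l≢0 v D≢0) , i , v , x , z , e , refl

-- Each F-line outside the E-points lies in exactly one class

module Packing {q r} {F : FField q} {E : FField r} {Q : QuadraticExtension F E} (S : SpreadData Q) where
  open QuadraticTheory Q
  open FieldTheory E
  open QuadraticExtension Q
  open SpreadData S
  open Parallelism S
  open Solver using (solve; _:=_; _:*_; _:+_; :-_)
  private
    module FS = F.Solver
    open ≡-Reasoning

  equivalent : ∀ {l s l′ s′} ρ f → ρ ≢ F.0# → l′ ≡ ι ρ * l → s′ ≡ ι ρ * s + ι f → Equivalent l s l′ s′
  equivalent ρ f ρ≢0 refl refl = rescale f ρ≢0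

  -- Agreement at an `F`-basis of parameters extends to all of them, so that uniqueness can be
  -- tested at the convenient parameters `ω` and 1.
  transfer : ∀ {l s l′ s′} i j {x z x′ z′} → detF x z ≢ F.0# →
             Φ l s i x ≡ Φ l′ s′ j x′ → Φ l s i z ≡ Φ l′ s′ j z′ → ∀ p → ∃ λ p′ → Φ l s i p ≡ Φ l′ s′ j p′
  transfer {l} {s} {l′} {s′} i j {x} {z} {x′} {z′} D≢0 e e′ p =
    let k , m , eq = cramer x z p D≢0 in
    ι k * x′ + ι m * z′ , (begin
      Φ l s i p ≡⟨ cong (Φ l s i) eq ⟩
      Φ l s i (ι k * x + ι m * z) ≡⟨ Φ-linear l s i k m x z ⟩
      combine k m (Φ l s i x) (Φ l s i z) ≡⟨ cong₂ (combine k m) e e′ ⟩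
      combine k m (Φ l′ s′ j x′) (Φ l′ s′ j z′) ≡⟨ Φ-linear l′ s′ j k m x′ z′ ⟨
      Φ l′ s′ j (ι k * x′ + ι m * z′) ∎)

  Φ-axis-ω : ∀ l s y → Φ l s (inj₁ y) ω ≡ (0# , y)
  Φ-axis-ω l s y = cong₂ _,_
    (trans (cong (λ u → l * (u * y)) (trans (cong ι π₀-ω) ι-0)) (solve 2 (λ l y → l :* (:0 :* y) := :0) refl l y))
    (trans (cong (_* y) (trans (slope-0 {s} {ω} {y} π₀-ω) (trans (cong ι π₁-ω) ι-1))) (*-identityˡ y))

  Φ-axis-1 : ∀ l s y → Φ l s (inj₁ y) (ι F.1#) ≡ (l * y , (ι (c y) * ω + s) * y)
  Φ-axis-1 l s y = cong₂ _,_
    (trans (cong (λ u → l * (u * y)) e₀) (cong (l *_) (*-identityˡ y)))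
    (cong (_* y) (trans (cong₂ (λ u v → u * (ι (c y) * ω + s) + v) e₀ (trans (cong ι (π₁-ι _)) ι-0))
      (solve 1 (λ g → :1 :* g :+ :0 := g) refl _)))
    where
    e₀ : ι (π₀ (ι F.1#)) ≡ 1#
    e₀ = trans (cong ι (π₀-ι _)) ι-1

  -- At `ω` the line passes through (0 , y), whence y = h y′ with `h` in `F`. At 1 the first
  -- coordinates give l h = l′ d and the second ones the relation between `s` and `s′`.
  unique-axis : ∀ {l s l′ s′ y y′ p p′} → l ≢ 0# → l′ ≢ 0# → y ≢ 0# → y′ ≢ 0# →
                Φ l s (inj₁ y) ω ≡ Φ l′ s′ (inj₁ y′) p → Φ l s (inj₁ y) (ι F.1#) ≡ Φ l′ s′ (inj₁ y′) p′ →
                Equivalent l s l′ s′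
  unique-axis {l} {s} {l′} {s′} {y} {y′} {p} {p′} l≢0 l′≢0 y≢0 y′≢0 e e′ =
    equivalent (h F.* d F.⁻¹) (F.- (k F.* d F.⁻¹)) (F.*-≢0 h≢0 (F.⁻¹-≢0 d≢0)) l′-eq s′-eq
    where
    h = π₁ p
    d = π₀ p′
    k = π₁ p′
    eω : (0# , y) ≡ Φ l′ s′ (inj₁ y′) p
    eω = trans (sym (Φ-axis-ω l s y)) e
    e1 : (l * y , (ι (c y) * ω + s) * y) ≡ Φ l′ s′ (inj₁ y′) p′
    e1 = trans (sym (Φ-axis-1 l s y)) e′
    π₀p≡0 : π₀ p ≡ F.0#
    π₀p≡0 = ι-injective (trans (x*y≡0 y′≢0 (trans (*-comm _ _) (x*y≡0 l′≢0 (sym (cong proj₁ eω))))) (sym ι-0))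
    y-eq : y ≡ ι h * y′
    y-eq = trans (cong proj₂ eω) (cong (_* y′) (slope-0 {s′} {p} {y′} π₀p≡0))
    h≢0 : h ≢ F.0#
    h≢0 = ι-≢0⁻¹ (*-≢0ˡ (≢0-cong y-eq y≢0))
    first : l * ι h ≡ l′ * ι d
    first = cancel-*ʳ y′≢0 (begin
      l * ι h * y′ ≡⟨ *-assoc _ _ _ ⟩
      l * (ι h * y′) ≡⟨ cong (l *_) y-eq ⟨
      l * y ≡⟨ cong proj₁ e1 ⟩
      l′ * (ι d * y′) ≡⟨ *-assoc _ _ _ ⟨
      l′ * ι d * y′ ∎)
    d≢0 : d ≢ F.0#
    d≢0 = ι-≢0⁻¹ (*-≢0ʳ {l′} (≢0-cong first (*-≢0 l≢0 (ι-≢0 h≢0))))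
    g = ι (c y′)
    c-eq : c y ≡ c y′
    c-eq = trans (cong c y-eq) (c-scale y′ h≢0)
    hg : ι h * g ≡ g
    hg = trans (sym (ι-* _ _)) (cong ι (c-fixed y′ h≢0))
    dg : ι d * g ≡ g
    dg = trans (sym (ι-* _ _)) (cong ι (c-fixed y′ d≢0))
    second : (g * ω + s) * ι h ≡ ι d * (g * ω + s′) + ι k
    second = cancel-*ʳ y′≢0 (begin
      (g * ω + s) * ι h * y′ ≡⟨ *-assoc _ _ _ ⟩
      (g * ω + s) * (ι h * y′) ≡⟨ cong₂ (λ u v → (ι u * ω + s) * v) (sym c-eq) (sym y-eq) ⟩
      (ι (c y) * ω + s) * y ≡⟨ cong proj₂ e1 ⟩
      (ι d * (g * ω + s′) + ι k) * y′ ∎)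
    second′ : ι h * s ≡ ι d * s′ + ι k
    second′ = combine₂ 1# ω second (trans dg (sym hg))
      (solve 7 (λ h s d s′ k g w → h :* s :+ :- (d :* s′ :+ k) := :1 :* ((g :* w :+ s) :* h :+ :- (d :* (g :* w :+ s′) :+ k)) :+ w :* (d :* g :+ :- (h :* g)))
        refl (ι h) s (ι d) s′ (ι k) g ω)
    ι-ratio : ι (h F.* d F.⁻¹) ≡ ι h * ι (d F.⁻¹)
    ι-ratio = ι-* _ _
    dd : ι (d F.⁻¹) * ι d ≡ 1#
    dd = ι-inverse d≢0
    l′-eq : l′ ≡ ι (h F.* d F.⁻¹) * l
    l′-eq = trans (combine₂ (- l′) (- ι (d F.⁻¹)) dd first
        (solve 5 (λ l h l′ d j → l′ :+ :- (h :* j :* l) := :- l′ :* (j :* d :+ :- :1) :+ (:- j) :* (l :* h :+ :- (l′ :* d))) refl l (ι h) l′ (ι d) (ι (d F.⁻¹))))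
      (cong (_* l) (sym ι-ratio))
    s′-eq : s′ ≡ ι (h F.* d F.⁻¹) * s + ι (F.- (k F.* d F.⁻¹))
    s′-eq = trans (combine₂ (- s′) (- ι (d F.⁻¹)) dd second′
        (solve 6 (λ h s d s′ k j → s′ :+ :- (h :* j :* s :+ :- (k :* j)) := :- s′ :* (j :* d :+ :- :1) :+ (:- j) :* (h :* s :+ :- (d :* s′ :+ k)))
          refl (ι h) s (ι d) s′ (ι k) (ι (d F.⁻¹))))
      (cong₂ (λ u v → u * s + v) (sym ι-ratio) (sym (trans (ι-neg _) (cong -_ (ι-* _ _)))))

  -- The two descriptions give one `F`-linear map, and P x + R σ x can vanish on an `F`-basis only
  -- if P = R = 0. Then `R` puts the ratio `μ` of `l` to `l′` into `F`, and `P` relates `s` to `s′`.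
  unique-graph : ∀ {l s l′ s′ α β α′ β′ x z x′ z′} → l ≢ 0# → l′ ≢ 0# → β ≢ F.0# → β′ ≢ F.0# → detF x z ≢ F.0# →
                 Φ l s (inj₂ (α , β)) x ≡ Φ l′ s′ (inj₂ (α′ , β′)) x′ →
                 Φ l s (inj₂ (α , β)) z ≡ Φ l′ s′ (inj₂ (α′ , β′)) z′ → Equivalent l s l′ s′
  unique-graph {l} {s} {l′} {s′} {α} {β} {α′} {β′} {x} {z} {x′} {z′} l≢0 l′≢0 β≢0 β′≢0 D≢0 e e′ =
    equivalent ρ (ρ F.* α F.+ F.- α′) (F.*-≢0 β′≢0 (F.⁻¹-≢0 β≢0)) l′-eq s′-eq
    where
    ρ = β′ F.* β F.⁻¹
    μ = l′ ⁻¹ * l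
    P = (ι α + s + ι β * a) + - ((ι α′ + s′ + ι β′ * a) * μ)
    R = b * (ι β + - (ι β′ * σ μ))
    stretch : ∀ {x x′} → l * x ≡ l′ * x′ → x′ ≡ μ * x
    stretch {x} {x′} eq = combine₂ (- x′) (- l′ ⁻¹) (*-inverseˡ l′≢0) eq
      (solve 5 (λ l l′ j x x′ → x′ :+ :- (j :* l :* x) := :- x′ :* (j :* l′ :+ :- :1) :+ (:- j) :* (l :* x :+ :- (l′ :* x′))) refl l l′ (l′ ⁻¹) x x′)
    relation : ∀ {x x′} → Φ l s (inj₂ (α , β)) x ≡ Φ l′ s′ (inj₂ (α′ , β′)) x′ → P * x + R * σ x ≡ 0#
    relation {x} {x′} eq = begin
      P * x + R * σ x
        ≡⟨ solve 10 (λ p h p′ h′ a b m m′ x y → ((p :+ h :* a) :+ :- ((p′ :+ h′ :* a) :* m)) :* x :+ b :* (h :+ :- (h′ :* m′)) :* y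
             := p :* x :+ h :* (a :* x :+ b :* y) :+ :- (p′ :* (m :* x) :+ h′ :* (a :* (m :* x) :+ b :* (m′ :* y)))) refl
             (ι α + s) (ι β) (ι α′ + s′) (ι β′) a b μ (σ μ) x (σ x) ⟩
      (ι α + s) * x + ι β * T x + - ((ι α′ + s′) * (μ * x) + ι β′ * (a * (μ * x) + b * (σ μ * σ x)))
        ≡⟨ cong (λ u → (ι α + s) * x + ι β * T x + - ((ι α′ + s′) * (μ * x) + ι β′ * (a * (μ * x) + b * u))) (σ-* μ x) ⟨
      (ι α + s) * x + ι β * T x + - ((ι α′ + s′) * (μ * x) + ι β′ * T (μ * x))
        ≡⟨ cong (λ u → (ι α + s) * x + ι β * T x + - ((ι α′ + s′) * u + ι β′ * T u)) (stretch (cong proj₁ eq)) ⟨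
      (ι α + s) * x + ι β * T x + - ((ι α′ + s′) * x′ + ι β′ * T x′) ≡⟨ x≡y⇒0 (cong proj₂ eq) ⟩
      0# ∎
    -- The determinant of the linear system for `P` and `R` that `relation` yields at `x` and `z`.
    W = x * σ z + - (z * σ x)
    W≢0 : W ≢ 0#
    W≢0 = ≢0-cong (sym (detF-σ x z)) (*-≢0 (ι-≢0 D≢0) σω-ω≢0)
    R≡0 : R ≡ 0#
    R≡0 = x*y≡0 W≢0 (combine₂ x (- z) (relation e′) (relation e)
      (solve 6 (λ P R x z y t → (x :* t :+ :- (z :* y)) :* R :+ :- :0 := x :* (P :* z :+ R :* t :+ :- :0) :+ (:- z) :* (P :* x :+ R :* y :+ :- :0)) refl P R x z (σ x) (σ z)))
    P≡0 : P ≡ 0#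
    P≡0 = x*y≡0 W≢0 (combine₂ (σ z) (- σ x) (relation e) (relation e′)
      (solve 6 (λ P R x z y t → (x :* t :+ :- (z :* y)) :* P :+ :- :0 := t :* (P :* x :+ R :* y :+ :- :0) :+ (:- y) :* (P :* z :+ R :* t :+ :- :0)) refl P R x z (σ x) (σ z)))
    β-eq : ι β ≡ ι β′ * σ μ
    β-eq = x-y≡0 (x*y≡0 b≢0 R≡0)
    σμ : σ μ ≡ ι (β′ F.⁻¹ F.* β)
    σμ = trans (combine₂ (- σ μ) (- ι (β′ F.⁻¹)) (ι-inverse β′≢0) β-eq
          (solve 4 (λ m j h h′ → m :+ :- (j :* h) := :- m :* (j :* h′ :+ :- :1) :+ (:- j) :* (h :+ :- (h′ :* m))) refl (σ μ) (ι (β′ F.⁻¹)) (ι β) (ι β′)))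
        (sym (ι-* _ _))
    μ-eq : μ ≡ ι (β′ F.⁻¹ F.* β)
    μ-eq = trans (sym (σ-σ μ)) (trans (cong σ σμ) (σ-ι _))
    β-eq′ : ι β ≡ ι β′ * μ
    β-eq′ = trans β-eq (cong (ι β′ *_) (trans σμ (sym μ-eq)))
    ρμ : ι ρ * μ ≡ 1#
    ρμ = trans (cong (ι ρ *_) μ-eq) (trans (sym (ι-* _ _)) (trans (cong ι (F.combine₂ (β F.* β F.⁻¹) F.1# (F.*-inverseʳ β′≢0) (F.*-inverseʳ β≢0)
      (FS.solve 4 (λ h h′ j j′ → h′ FS.:* j FS.:* (j′ FS.:* h) FS.:+ FS.:- F.:1 FS.:= h FS.:* j FS.:* (h′ FS.:* j′ FS.:+ FS.:- F.:1) FS.:+ F.:1 FS.:* (h FS.:* j FS.:+ FS.:- F.:1))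
        refl β β′ (β F.⁻¹) (β′ F.⁻¹)))) ι-1))
    l-eq : l ≡ l′ * μ
    l-eq = combine₁ (- l) (*-inverseˡ l′≢0) (solve 3 (λ l l′ j → l :+ :- (l′ :* (j :* l)) := :- l :* (j :* l′ :+ :- :1)) refl l l′ (l′ ⁻¹))
    l′-eq : l′ ≡ ι ρ * l
    l′-eq = combine₂ (- l′) (- ι ρ) ρμ l-eq
      (solve 4 (λ l l′ r m → l′ :+ :- (r :* l) := :- l′ :* (r :* m :+ :- :1) :+ (:- r) :* (l :+ :- (l′ :* m))) refl l l′ (ι ρ) μ)
    s′-eq₀ : s′ * μ ≡ s + ι α + - (ι α′ * μ)
    s′-eq₀ = combine₂ (- 1#) a P≡0 β-eq′
      (solve 8 (λ p s h a p′ s′ h′ m → s′ :* m :+ :- (s :+ p :+ :- (p′ :* m))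
        := (:- :1) :* (p :+ s :+ h :* a :+ :- ((p′ :+ s′ :+ h′ :* a) :* m) :+ :- :0) :+ a :* (h :+ :- (h′ :* m)))
        refl (ι α) s (ι β) a (ι α′) s′ (ι β′) μ)
    s′-eq : s′ ≡ ι ρ * s + ι (ρ F.* α F.+ F.- α′)
    s′-eq = trans (combine₂ (- s′ + - ι α′) (ι ρ) ρμ s′-eq₀
        (solve 6 (λ p s p′ s′ r m → s′ :+ :- (r :* s :+ (r :* p :+ :- p′))
          := (:- s′ :+ :- p′) :* (r :* m :+ :- :1) :+ r :* (s′ :* m :+ :- (s :+ p :+ :- (p′ :* m)))) refl (ι α) s (ι α′) s′ (ι ρ) μ))
      (cong (ι ρ * s +_) (sym (trans (ι-+ _ _) (cong₂ _+_ (ι-* _ _) (ι-neg _)))))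

  -- The left-hand side is (0 , y).
  axis-graph-disjoint : ∀ {l s l′ s′ y α β p} → l′ ≢ 0# → y ≢ 0# →
                        Φ l s (inj₁ y) ω ≢ Φ l′ s′ (inj₂ (α , β)) p
  axis-graph-disjoint {l} {s} {l′} {s′} {y} {α} {β} {p} l′≢0 y≢0 e = y≢0 (begin
      y ≡⟨ cong proj₂ eω ⟩
      (ι α + s′) * p + ι β * T p ≡⟨ cong₂ (λ u v → (ι α + s′) * u + ι β * (a * u + b * v)) p≡0 (trans (cong σ p≡0) σ-0) ⟩
      (ι α + s′) * 0# + ι β * (a * 0# + b * 0#) ≡⟨ solve 4 (λ g h a b → g :* :0 :+ h :* (a :* :0 :+ b :* :0) := :0) refl _ _ a b ⟩
      0# ∎)
    where
    eω : (0# , y) ≡ Φ l′ s′ (inj₂ (α , β)) p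
    eω = trans (sym (Φ-axis-ω l s y)) e
    p≡0 : p ≡ 0#
    p≡0 = x*y≡0 l′≢0 (sym (cong proj₁ eω))

  Class-unique : ∀ {l s l′ s′ u w} → l ≢ 0# → l′ ≢ 0# → det u w ≢ 0# →
                 Class l s u w → Class l′ s′ u w → Equivalent l s l′ s′
  Class-unique {l} {s} {l′} {s′} l≢0 l′≢0 d≢0 (inj₁ y , v , x , z , refl , refl) (inj₁ y′ , v′ , x′ , z′ , e , e′) =
    let D≢0 = detF-Φ {l} {s} (inj₁ y) {x} {z} d≢0
        tr = transfer {l} {s} {l′} {s′} (inj₁ y) (inj₁ y′) {x} {z} {x′} {z′} D≢0 e e′
        p , eω = tr ω
        p′ , e1 = tr (ι F.1#)
    in unique-axis {l} {s} {l′} {s′} {y} {y′} {p} {p′} l≢0 l′≢0 v v′ eω e1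
  Class-unique {l} {s} {l′} {s′} l≢0 l′≢0 d≢0 (inj₁ y , v , x , z , refl , refl) (inj₂ (α , β) , v′ , x′ , z′ , e , e′) =
    let D≢0 = detF-Φ {l} {s} (inj₁ y) {x} {z} d≢0
        p , eω = transfer {l} {s} {l′} {s′} (inj₁ y) (inj₂ (α , β)) {x} {z} {x′} {z′} D≢0 e e′ ω
    in ⊥-elim (axis-graph-disjoint {l} {s} {l′} {s′} {y} {α} {β} {p} l′≢0 v eω)
  Class-unique {l} {s} {l′} {s′} l≢0 l′≢0 d≢0 (inj₂ (α , β) , v , x , z , e , e′) (inj₁ y , v′ , x′ , z′ , refl , refl) =
    let D≢0 = detF-Φ {l′} {s′} (inj₁ y) {x′} {z′} d≢0
        p , eω = transfer {l′} {s′} {l} {s} (inj₁ y) (inj₂ (α , β)) {x′} {z′} {x} {z} D≢0 e e′ ω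
    in ⊥-elim (axis-graph-disjoint {l′} {s′} {l} {s} {y} {α} {β} {p} l≢0 v′ eω)
  Class-unique {l} {s} {l′} {s′} l≢0 l′≢0 d≢0 (inj₂ (α , β) , v , x , z , refl , refl) (inj₂ (α′ , β′) , v′ , x′ , z′ , e , e′) =
    unique-graph {l} {s} {l′} {s′} {α} {β} {α′} {β′} {x} {z} {x′} {z′} l≢0 l′≢0 v v′ (detF-Φ {l} {s} (inj₂ (α , β)) {x} {z} d≢0) e e′

  ClassOf : E² → E² → Set
  ClassOf u w = ∃ λ l → ∃ λ s → l ≢ 0# × Class l s u w

  ClassOf-axis : ∀ u₁ u₂ y → u₁ ≢ 0# → y ≢ 0# → ClassOf (u₁ , u₂) (0# , y)
  ClassOf-axis u₁ u₂ y u₁≢0 y≢0 = l , s , *-≢0 u₁≢0 (⁻¹-≢0 y≢0) , inj₁ y , y≢0 , ι F.1# , ω ,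
      trans (cong₂ _,_ e₁ e₂) (sym (Φ-axis-1 l s y)) , sym (Φ-axis-ω l s y)
    where
    -- `l` and `s` are read off by equating (u₁ , u₂) with the value in `Φ-axis-1`.
    l = u₁ * y ⁻¹
    s = u₂ * y ⁻¹ + - (ι (c y) * ω)
    e₁ : u₁ ≡ l * y
    e₁ = combine₁ (- u₁) (*-inverseʳ y≢0) (solve 3 (λ u y j → u :+ :- (u :* j :* y) := :- u :* (y :* j :+ :- :1)) refl u₁ y (y ⁻¹))
    e₂ : u₂ ≡ (ι (c y) * ω + s) * y
    e₂ = combine₁ (- u₂) (*-inverseʳ y≢0) (solve 4 (λ u y j g → u :+ :- ((g :+ (u :* j :+ :- g)) :* y) := :- u :* (y :* j :+ :- :1)) refl u₂ y (y ⁻¹) (ι (c y) * ω))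

  Class-swap : ∀ {l s u w} → Class l s u w → Class l s w u
  Class-swap (i , v , x , z , e , e′) = i , v , z , x , e′ , e

  ClassOf-swap : ∀ {u w} → ClassOf u w → ClassOf w u
  ClassOf-swap (l , s , l≢0 , k) = l , s , l≢0 , Class-swap {l} {s} k

  -- Subtracting `j` times the first vector stays on the `F`-line and reaches a vector (0 , y).
  ClassOf-dependent : ∀ u₁ u₂ w₂ j → u₁ ≢ 0# → det (u₁ , u₂) (ι j * u₁ , w₂) ≢ 0# → ClassOf (u₁ , u₂) (ι j * u₁ , w₂)
  ClassOf-dependent u₁ u₂ w₂ j u₁≢0 d≢0 =
    let l , s , l≢0 , k = ClassOf-axis u₁ u₂ y u₁≢0 y≢0
    in l , s , l≢0 , subst₂ (Class l s) (cong₂ _,_ (first _ _) (first _ _)) (cong₂ _,_ second third)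
         (Class-combine {l} {s} {u₁ , u₂} {0# , y} F.1# F.0# j F.1# k)
    where
    y = w₂ + - (ι j * u₂)
    y≢0 : y ≢ 0#
    y≢0 = *-≢0ʳ {u₁} (≢0-cong (solve 4 (λ u v w j → u :* w :+ :- (v :* (j :* u)) := u :* (w :+ :- (j :* v))) refl u₁ u₂ w₂ (ι j)) d≢0)
    first : ∀ p q → ι F.1# * p + ι F.0# * q ≡ p
    first p q = trans (cong₂ (λ x y → x * p + y * q) ι-1 ι-0) (solve 2 (λ p q → :1 :* p :+ :0 :* q := p) refl p q)
    second : ι j * u₁ + ι F.1# * 0# ≡ ι j * u₁
    second = solve 2 (λ p q → p :+ q :* :0 := p) refl _ _
    third : ι j * u₂ + ι F.1# * y ≡ w₂
    third = trans (cong (λ x → ι j * u₂ + x * y) ι-1) (solve 3 (λ j u w → j :* u :+ :1 :* (w :+ :- (j :* u)) := w) refl (ι j) u₂ w₂)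

  -- The line is the graph of an `F`-linear map of `E`, and each such map is p x + g σ x. Cramer's
  -- rule gives `g` as a quotient of determinants, nonzero since the vectors are independent over
  -- `E`. A suitable `l` and `s` turn T itself, the graph with index (0 , 1), into this map.
  ClassOf-graph : ∀ u₁ u₂ w₁ w₂ → u₁ ≢ 0# → u₁ * σ w₁ + - (w₁ * σ u₁) ≢ 0# → det (u₁ , u₂) (w₁ , w₂) ≢ 0# →
                  ClassOf (u₁ , u₂) (w₁ , w₂)
  ClassOf-graph u₁ u₂ w₁ w₂ u₁≢0 δ≢0 d≢0 = l , s , l≢0 , inj₂ (F.0# , F.1#) , (λ e → F.0≢1 (sym e)) ,
      w u₁ , w w₁ , cong₂ _,_ (on-first u₁) (on-second u₁ u₂ u-eq) , cong₂ _,_ (on-first w₁) (on-second w₁ w₂ w-eq)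
    where
    D = det (u₁ , u₂) (w₁ , w₂)
    δ = u₁ * σ w₁ + - (w₁ * σ u₁)
    g = D * δ ⁻¹
    p = (u₂ + - (g * σ u₁)) * u₁ ⁻¹
    -- Chosen for `b * σ m` to be `g`: at parameter m x the map T contributes b σ m σ x.
    m = σ (g * b ⁻¹)
    m≢0 : m ≢ 0#
    m≢0 = σ-≢0 (*-≢0 (*-≢0 d≢0 (⁻¹-≢0 δ≢0)) (⁻¹-≢0 b≢0))
    l = m ⁻¹
    l≢0 : l ≢ 0#
    l≢0 = ⁻¹-≢0 m≢0
    s = p * l + - a
    w : Carrier → Carrier
    w x = m * x
    on-first : ∀ x → x ≡ l * (m * x)
    on-first x = combine₁ (- x) (*-inverseˡ m≢0) (solve 3 (λ l m x → x :+ :- (l :* (m :* x)) := :- x :* (l :* m :+ :- :1)) refl l m x)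
    bσm : b * σ m ≡ g
    bσm = trans (cong (b *_) (σ-σ (g * b ⁻¹))) (combine₁ g (*-inverseʳ b≢0) (solve 3 (λ b g j → b :* (g :* j) :+ :- g := g :* (b :* j :+ :- :1)) refl b g (b ⁻¹)))
    on-second : ∀ x y → y ≡ p * x + g * σ x → y ≡ (ι F.0# + s) * (m * x) + ι F.1# * T (m * x)
    on-second x y e = begin
      y ≡⟨ e ⟩
      p * x + g * σ x ≡⟨ cong (λ u → p * x + u * σ x) bσm ⟨
      p * x + b * σ m * σ x
        ≡⟨ combine₁ (- (p * x)) (*-inverseˡ m≢0)
            (solve 8 (λ p x b m′ x′ l m a → p :* x :+ b :* m′ :* x′ :+ :- ((:0 :+ (p :* l :+ :- a)) :* (m :* x) :+ :1 :* (a :* (m :* x) :+ b :* (m′ :* x′)))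
               := :- (p :* x) :* (l :* m :+ :- :1)) refl p x b (σ m) (σ x) l m a) ⟩
      (0# + s) * (m * x) + 1# * (a * (m * x) + b * (σ m * σ x)) ≡⟨ cong (λ u → (0# + s) * (m * x) + 1# * (a * (m * x) + b * u)) (σ-* m x) ⟨
      (0# + s) * (m * x) + 1# * T (m * x) ≡⟨ cong₂ (λ u v → (u + s) * (m * x) + v * T (m * x)) ι-0 ι-1 ⟨
      (ι F.0# + s) * (m * x) + ι F.1# * T (m * x) ∎
    u-eq : u₂ ≡ p * u₁ + g * σ u₁
    u-eq = combine₁ (- (u₂ + - (g * σ u₁))) (*-inverseʳ u₁≢0)
      (solve 5 (λ u v j g u′ → v :+ :- ((v :+ :- (g :* u′)) :* j :* u :+ g :* u′) := :- (v :+ :- (g :* u′)) :* (u :* j :+ :- :1)) refl u₁ u₂ (u₁ ⁻¹) g (σ u₁))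
    gδ : g * δ ≡ D
    gδ = combine₁ D (*-inverseʳ δ≢0) (solve 3 (λ d e j → d :* j :* e :+ :- d := d :* (e :* j :+ :- :1)) refl D δ (δ ⁻¹))
    w-eq : w₂ ≡ p * w₁ + g * σ w₁
    w-eq = cancel-*ˡ u₁≢0 (combine₂ (- (w₁ * (u₂ + - (g * σ u₁)))) (- 1#) (*-inverseʳ u₁≢0) gδ
      (solve 8 (λ u v w y j g u′ w′ → u :* y :+ :- (u :* ((v :+ :- (g :* u′)) :* j :* w :+ g :* w′))
         := :- (w :* (v :+ :- (g :* u′))) :* (u :* j :+ :- :1) :+ (:- :1) :* (g :* (u :* w′ :+ :- (w :* u′)) :+ :- (u :* y :+ :- (v :* w))))
        refl u₁ u₂ w₁ w₂ (u₁ ⁻¹) g (σ u₁) (σ w₁)))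

  -- The first coordinates decide. If they are dependent over `F`, the line contains some (0 , y);
  -- if not, it is a graph.
  classOf : ∀ u w → det u w ≢ 0# → ClassOf u w
  classOf (u₁ , u₂) (w₁ , w₂) d≢0 = go (u₁ ≟ 0#) (detF u₁ w₁ F.≟ F.0#)
    where
    go : Dec (u₁ ≡ 0#) → Dec (detF u₁ w₁ ≡ F.0#) → ClassOf (u₁ , u₂) (w₁ , w₂)
    go (yes u₁≡0) _ = subst (λ u → ClassOf (u , u₂) (w₁ , w₂)) (sym u₁≡0)
        (ClassOf-swap {w₁ , w₂} {0# , u₂} (ClassOf-axis w₁ w₂ u₂ (*-≢0ʳ {u₂} d′) (*-≢0ˡ d′)))
      where
      d′ : u₂ * w₁ ≢ 0#
      d′ e = d≢0 (trans (cong₂ (λ u v → u * w₂ + - v) u₁≡0 e) (solve 1 (λ w → :0 :* w :+ :- :0 := :0) refl w₂))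
    go (no u₁≢0) (no ne) = ClassOf-graph u₁ u₂ w₁ w₂ u₁≢0 (≢0-cong (sym (detF-σ u₁ w₁)) (*-≢0 (ι-≢0 ne) σω-ω≢0)) d≢0
    go (no u₁≢0) (yes D≡0) = subst (λ u → ClassOf (u₁ , u₂) (u , w₂)) (sym w₁-eq)
        (ClassOf-dependent u₁ u₂ w₂ _ u₁≢0 (subst (λ u → det (u₁ , u₂) (u , w₂) ≢ 0#) w₁-eq d≢0))
      where
      z = proj₁ (independent-partner u₁ u₁≢0)
      D≢0 = proj₂ (independent-partner u₁ u₁≢0)
      k = detF w₁ z F.* (detF u₁ z) F.⁻¹
      coordinate : ∀ {p q} → q F.* detF u₁ z ≡ p → p F.* (detF u₁ z) F.⁻¹ ≡ q
      coordinate {p} {q} e = F.combine₂ (F.- (detF u₁ z) F.⁻¹) q e (F.*-inverseʳ D≢0)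
        (FS.solve 4 (λ p q d j → p FS.:* j FS.:+ FS.:- q FS.:= FS.:- j FS.:* (q FS.:* d FS.:+ FS.:- p) FS.:+ q FS.:* (d FS.:* j FS.:+ FS.:- F.:1)) refl p q (detF u₁ z) _)
      w₁-eq : w₁ ≡ ι k * u₁
      w₁-eq = π-unique
        (trans (sym (coordinate (F.combine₁ (π₀ z) D≡0 (FS.solve 6 (λ u v x y z t → y FS.:* (u FS.:* t FS.:+ FS.:- (v FS.:* z)) FS.:+ FS.:- ((y FS.:* t FS.:+ FS.:- (x FS.:* z)) FS.:* u) FS.:= z FS.:* (u FS.:* x FS.:+ FS.:- (v FS.:* y) FS.:+ FS.:- F.:0)) refl (π₀ u₁) (π₁ u₁) (π₁ w₁) (π₀ w₁) (π₀ z) (π₁ z)))))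
          (trans (FS.solve 3 (λ d u j → d FS.:* u FS.:* j FS.:= d FS.:* j FS.:* u) refl (detF w₁ z) (π₀ u₁) _) (sym (π₀-scale k u₁))))
        (trans (sym (coordinate (F.combine₁ (π₁ z) D≡0 (FS.solve 6 (λ u v x y z t → x FS.:* (u FS.:* t FS.:+ FS.:- (v FS.:* z)) FS.:+ FS.:- ((y FS.:* t FS.:+ FS.:- (x FS.:* z)) FS.:* v) FS.:= t FS.:* (u FS.:* x FS.:+ FS.:- (v FS.:* y) FS.:+ FS.:- F.:0)) refl (π₀ u₁) (π₁ u₁) (π₁ w₁) (π₀ w₁) (π₀ z) (π₁ z)))))
          (trans (FS.solve 3 (λ d u j → d FS.:* u FS.:* j FS.:= d FS.:* j FS.:* u) refl (detF w₁ z) (π₁ u₁) _) (sym (π₁-scale k u₁))))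

-- Normal forms of the classes

module PackingColours {q r} {F : FField q} {E : FField r} {Q : QuadraticExtension F E} (S : SpreadData Q) where
  open QuadraticTheory Q
  open FieldTheory E
  open QuadraticExtension Q
  open Parallelism S
  open Packing S
  open Solver using (solve; _:=_; _:*_; _:+_; :-_)
  private
    module FS = F.Solver
    open ≡-Reasoning

  -- The classes of (λ , s) up to (λ , s) ~ (ρ λ , ρ s + f): a point of the
  -- projective line over F, and a class modulo F.
  Colour : Set
  Colour = (F.Carrier ⊎ ⊤) × F.Carrier

  representative : F.Carrier ⊎ ⊤ → Carrier
  representative (inj₁ m) = compose F.1# m
  representative (inj₂ _) = ω

  representative≢0 : ∀ p → representative p ≢ 0#
  representative≢0 (inj₁ m) e = F.0≢1 (trans (sym π₀-0) (trans (cong π₀ (sym e)) (π₀-compose _ _)))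
  representative≢0 (inj₂ _) e = F.0≢1 (trans (sym π₁-0) (trans (cong π₁ (sym e)) π₁-ω))

  InClass : Colour → E² → E² → Set
  InClass (p , k) = Class (representative p) (ι k * ω)

  normalise-shift : ∀ ρ s → ι (ρ F.* π₁ s) * ω ≡ ι ρ * s + ι (F.- (ρ F.* π₀ s))
  normalise-shift ρ s = begin
    ι (ρ F.* π₁ s) * ω ≡⟨ cong (_* ω) (ι-* _ _) ⟩
    ι ρ * ι (π₁ s) * ω ≡⟨ solve 4 (λ r x y w → r :* y :* w := r :* (x :+ y :* w) :+ :- (r :* x)) refl (ι ρ) (ι (π₀ s)) (ι (π₁ s)) ω ⟩
    ι ρ * compose (π₀ s) (π₁ s) + - (ι ρ * ι (π₀ s)) ≡⟨ cong₂ (λ u v → ι ρ * u + v) (sym (decompose s)) (sym (trans (ι-neg _) (cong -_ (ι-* _ _)))) ⟩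
    ι ρ * s + ι (F.- (ρ F.* π₀ s)) ∎

  -- ρ is the inverse of the first nonzero coordinate of `l`; after that, f removes the part of ρ s
  -- that lies in `F`.
  normalise : ∀ l s → l ≢ 0# → ∃ λ p → ∃ λ k → Equivalent l s (representative p) (ι k * ω)
  normalise l s l≢0 = go (π₀ l F.≟ F.0#)
    where
    go : Dec (π₀ l ≡ F.0#) → ∃ λ p → ∃ λ k → Equivalent l s (representative p) (ι k * ω)
    go (no ne) = inj₁ (ρ F.* π₁ l) , ρ F.* π₁ s , equivalent ρ _ (F.⁻¹-≢0 ne)
        (π-unique (trans (π₀-compose _ _) (sym (trans (π₀-scale ρ l) (F.*-inverseˡ ne))))
                  (trans (π₁-compose _ _) (sym (π₁-scale ρ l))))
        (normalise-shift ρ s)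
      where ρ = π₀ l F.⁻¹
    go (yes e) = inj₂ tt , ρ F.* π₁ s , equivalent ρ _ (F.⁻¹-≢0 ne)
        (π-unique (trans π₀-ω (sym (trans (π₀-scale ρ l) (trans (cong (ρ F.*_) e) (F.zeroʳ ρ)))))
                  (trans π₁-ω (sym (trans (π₁-scale ρ l) (F.*-inverseˡ ne)))))
        (normalise-shift ρ s)
      where
      ne : π₁ l ≢ F.0#
      ne = π-≢0 l≢0 e
      ρ = π₁ l F.⁻¹

  equivalent⁻¹ : ∀ {l s l′ s′} → Equivalent l s l′ s′ → ∃ λ ρ → ∃ λ f → ρ ≢ F.0# × l′ ≡ ι ρ * l × s′ ≡ ι ρ * s + ι f
  equivalent⁻¹ (rescale {ρ} f ρ≢0) = ρ , f , ρ≢0 , refl , refl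

  representative-unique : ∀ p p′ {ρ} → ρ ≢ F.0# → representative p′ ≡ ι ρ * representative p → (p ≡ p′) × (ρ ≡ F.1#)
  representative-unique p p′ {ρ} ρ≢0 e = go p p′ e₀ e₁
    where
    e₀ : π₀ (representative p′) ≡ ρ F.* π₀ (representative p)
    e₀ = trans (cong π₀ e) (π₀-scale _ _)
    e₁ : π₁ (representative p′) ≡ ρ F.* π₁ (representative p)
    e₁ = trans (cong π₁ e) (π₁-scale _ _)
    go : ∀ p p′ → π₀ (representative p′) ≡ ρ F.* π₀ (representative p) →
         π₁ (representative p′) ≡ ρ F.* π₁ (representative p) → (p ≡ p′) × (ρ ≡ F.1#)
    go (inj₁ m) (inj₁ m′) e₀ e₁ = cong inj₁ (sym (trans (trans (sym (π₁-compose _ _)) e₁)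
        (trans (cong₂ F._*_ ρ≡1 (π₁-compose _ _)) (F.*-identityˡ m)))) , ρ≡1
      where
      ρ≡1 : ρ ≡ F.1#
      ρ≡1 = sym (trans (sym (π₀-compose _ _)) (trans e₀ (trans (cong (ρ F.*_) (π₀-compose _ _)) (F.*-identityʳ ρ))))
    go (inj₁ m) (inj₂ _) e₀ e₁ = ⊥-elim (ρ≢0 (trans (sym (trans (cong (ρ F.*_) (π₀-compose _ _)) (F.*-identityʳ ρ))) (trans (sym e₀) π₀-ω)))
    go (inj₂ _) (inj₁ m) e₀ e₁ = ⊥-elim (F.0≢1 (trans (sym (trans e₀ (trans (cong (ρ F.*_) π₀-ω) (F.zeroʳ ρ)))) (π₀-compose _ _)))
    go (inj₂ tt) (inj₂ tt) e₀ e₁ = refl , trans (sym (F.*-identityʳ ρ)) (trans (cong (ρ F.*_) (sym π₁-ω)) (trans (sym e₁) π₁-ω))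

  colour-unique : ∀ d d′ → Equivalent (representative (proj₁ d)) (ι (proj₂ d) * ω) (representative (proj₁ d′)) (ι (proj₂ d′) * ω) → d ≡ d′
  colour-unique (p , k) (p′ , k′) equiv with equivalent⁻¹ equiv
  ... | ρ , f , ρ≢0 , e , e′ with representative-unique p p′ ρ≢0 e
  ... | p≡p′ , ρ≡1 = cong₂ _,_ p≡p′ (sym (begin
      k′ ≡⟨ FS.solve 1 (λ k → k FS.:= k FS.:* F.:1) refl k′ ⟩
      k′ F.* F.1# ≡⟨ trans (cong (k′ F.*_) (sym π₁-ω)) (sym (π₁-scale k′ ω)) ⟩
      π₁ (ι k′ * ω) ≡⟨ cong π₁ e′ ⟩
      π₁ (ι ρ * (ι k * ω) + ι f) ≡⟨ cong₂ (λ u v → π₁ (u * (ι k * ω) + v)) (cong ι ρ≡1) (sym (trans (cong (ι f *_) ι-1) (*-identityʳ _))) ⟩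
      π₁ (ι F.1# * (ι k * ω) + ι f * ι F.1#) ≡⟨ π₁-linear _ _ _ _ ⟩
      F.1# F.* π₁ (ι k * ω) F.+ f F.* π₁ (ι F.1#) ≡⟨ cong₂ (λ u v → F.1# F.* u F.+ f F.* v) (trans (π₁-scale k ω) (cong (k F.*_) π₁-ω)) (π₁-ι _) ⟩
      F.1# F.* (k F.* F.1#) F.+ f F.* F.0# ≡⟨ FS.solve 2 (λ k f → F.:1 FS.:* (k FS.:* F.:1) FS.:+ f FS.:* F.:0 FS.:= k) refl k f ⟩
      k ∎))

  InClass-exists : ∀ u w → det u w ≢ 0# → ∃ λ d → InClass d u w
  InClass-exists u w d≢0 =
    let l , s , l≢0 , cl = classOf u w d≢0
        p , k , equiv = normalise l s l≢0
    in (p , k) , Class-equivalent {l} {s} equiv cl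

  InClass-unique : ∀ d d′ {u w} → det u w ≢ 0# → InClass d u w → InClass d′ u w → d ≡ d′
  InClass-unique d@(p , k) d′@(p′ , k′) {u} {w} d≢0 cl cl′ =
    colour-unique d d′ (Class-unique {u = u} {w} (representative≢0 p) (representative≢0 p′) d≢0 cl cl′)

  InClass-combine : ∀ d {u w} k₁ m₁ k₂ m₂ → InClass d u w → InClass d (combine k₁ m₁ u w) (combine k₂ m₂ u w)
  InClass-combine (p , k) {u} {w} k₁ m₁ k₂ m₂ = Class-combine {representative p} {ι k * ω} {u} {w} k₁ m₁ k₂ m₂

  InClass-proper : ∀ d {u w w′} → det u w ≢ 0# → InClass d u w → InClass d u w′ → ∃ λ k → ∃ λ m → w′ ≡ combine k m u w
  InClass-proper (p , k) {u} {w} {w′} = Class-proper {representative p} {ι k * ω} {u} {w} {w′} (representative≢0 p)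

  InClass-covers : ∀ d u → u ≢ (0# , 0#) → ∃ λ w → det u w ≢ 0# × InClass d u w
  InClass-covers (p , k) u = Class-covers {representative p} {ι k * ω} u (representative≢0 p)

-- Existence of the base spread

module _ {q r} {F : FField q} {E : FField r} (Q : QuadraticExtension F E) where
  open QuadraticTheory Q
  open FieldTheory E
  open QuadraticExtension Q
  open Solver using (solve; _:=_; _:*_; _:+_; :-_)
  private
    module FS = F.Solver
    open ≡-Reasoning

  -- For q = 2, take T = σ; each slope set then misses exactly one class modulo F.
  spreadData-2 : (∀ x → x ≢ F.0# → x ≡ F.1#) → SpreadData Q
  spreadData-2 two = record
    { a = 0#
    ; b = 1#
    ; b≢0 = 1≢0
    ; c = c
    ; c-fixed = λ x ρ≢0 → trans (cong (F._* c x) (two _ ρ≢0)) (F.*-identityˡ _)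
    ; c-scale = λ x ρ≢0 → cong c (trans (cong (λ u → ι u * x) (two _ ρ≢0)) (trans (cong (_* x) ι-1) (*-identityˡ x)))
    ; slope-avoids = λ x _ β≢0 e → F.1≢0 (F.combine₁ F.1# (trans e (trans (cong (F._* τ x) (two _ β≢0)) (F.*-identityˡ _)))
        (FS.solve 1 (λ t → F.:1 FS.:+ FS.:- F.:0 FS.:= F.:1 FS.:* (F.:1 FS.:+ t FS.:+ FS.:- t)) refl (τ x)))
    ; slope-injective = λ x _ β≢0 γ≢0 _ → trans (two _ β≢0) (sym (two _ γ≢0))
    ; slope-covers = λ x k _ → covers x k (k F.≟ τ x)
    }
    where
    τ : Carrier → F.Carrier
    τ x = π₁ (0# + 1# * (σ x * x ⁻¹))
    c : Carrier → F.Carrier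
    c x = F.1# F.+ τ x
    covers : ∀ x k → Dec (k ≡ τ x) → (k ≡ c x) ⊎ (∃ λ β → (β ≢ F.0#) × (k ≡ β F.* τ x))
    covers x k (yes e) = inj₂ (F.1# , F.1≢0 , trans e (sym (F.*-identityˡ _)))
    covers x k (no ne) = inj₁ (F.combine₁ F.1# (two (k F.+ F.- τ x) (λ e → ne (F.x-y≡0 e)))
      (FS.solve 2 (λ k t → k FS.:+ FS.:- (F.:1 FS.:+ t) FS.:= F.:1 FS.:* (k FS.:+ FS.:- t FS.:+ FS.:- F.:1)) refl k (τ x)))

  -- T is multiplication by ω conjugated by the F-linear map (x₀ , x₁) ↦ (x₀ , ρ x₁):
  -- it has no eigenvalue in F, and since ρ ≠ 1 it is not E-linear.
  spreadData-conjugate : ∀ ρ → ρ ≢ F.0# → ρ ≢ F.1# → SpreadData Q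
  spreadData-conjugate ρ ρ≢0 ρ≢1 = record
    { a = a
    ; b = b
    ; b≢0 = b≢0
    ; c = λ _ → F.0#
    ; c-fixed = λ _ _ → F.zeroʳ _
    ; c-scale = λ _ _ → refl
    ; slope-avoids = λ x x≢0 β≢0 e → τ≢0 x x≢0 (F.x*y≡0 β≢0 (sym e))
    ; slope-injective = λ x x≢0 _ _ e → F.cancel-*ʳ (τ≢0 x x≢0) e
    ; slope-covers = λ x k x≢0 → covers x k x≢0 (k F.≟ F.0#)
    }
    where
    j = ρ F.⁻¹
    -- `T1` and `Tω` are the images of 1 and `ω` under the conjugated multiplication; `a` and `b`
    -- solve a + b = T1 and a ω + b σ ω = Tω.
    T1 Tω θ a b : Carrier
    T1 = ι ρ * ω
    Tω = ι (j F.* t) + ω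
    θ = (σ ω + - ω) ⁻¹
    b = (Tω + - (T1 * ω)) * θ
    a = T1 + - b
    -- The numerator of `b` has coefficient 1 - ρ at `ω`, whence the condition ρ ≠ 1.
    b≢0 : b ≢ 0#
    b≢0 = *-≢0 (λ e → ρ≢1 (sym (F.x-y≡0 (trans (sym (π₁-compose _ _)) (trans (cong π₁ (trans (sym rewritten) e)) π₁-0))))) (⁻¹-≢0 σω-ω≢0)
      where
      rewritten : Tω + - (T1 * ω) ≡ compose (j F.* t F.+ F.- (ρ F.* t)) (F.1# F.+ F.- ρ)
      rewritten = begin
        ι (j F.* t) + ω + - (ι ρ * ω * ω) ≡⟨ combine₁ (- ι ρ) ω² (solve 4 (λ k w r t → k :+ w :+ :- (r :* w :* w) :+ :- ((k :+ :- (r :* t)) :+ (:1 :+ :- r) :* w)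
               := :- r :* (w :* w :+ :- (w :+ t))) refl (ι (j F.* t)) ω (ι ρ) (ι t)) ⟩
        (ι (j F.* t) + - (ι ρ * ι t)) + (1# + - ι ρ) * ω
          ≡⟨ cong₂ (λ u v → u + v * ω) (sym (trans (ι-+ _ _) (cong (ι (j F.* t) +_) (trans (ι-neg _) (cong -_ (ι-* _ _))))))
               (sym (trans (ι-+ _ _) (cong₂ _+_ ι-1 (ι-neg _)))) ⟩
        compose (j F.* t F.+ F.- (ρ F.* t)) (F.1# F.+ F.- ρ) ∎
    τ : Carrier → F.Carrier
    τ x = π₁ (a + b * (σ x * x ⁻¹))
    T-coordinates : ∀ x → a * x + b * σ x ≡ compose (j F.* t F.* π₁ x) (ρ F.* π₀ x F.+ π₁ x)
    T-coordinates x = begin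
      a * x + b * σ x ≡⟨ cong₂ (λ u v → a * u + b * v) (decompose x) (σ-decompose x) ⟩
      a * (x₀ + x₁ * ω) + b * (x₀ + x₁ * σ ω)
        ≡⟨ combine₁ (x₁ * (Tω + - (T1 * ω))) (*-inverseʳ σω-ω≢0)
            (solve 7 (λ t₁ t₂ h x₀ x₁ w s → (t₁ :+ :- ((t₂ :+ :- (t₁ :* w)) :* h)) :* (x₀ :+ x₁ :* w) :+ (t₂ :+ :- (t₁ :* w)) :* h :* (x₀ :+ x₁ :* s) :+ :- (x₀ :* t₁ :+ x₁ :* t₂)
              := x₁ :* (t₂ :+ :- (t₁ :* w)) :* ((s :+ :- w) :* h :+ :- :1)) refl T1 Tω θ x₀ x₁ ω (σ ω)) ⟩
      x₀ * (ι ρ * ω) + x₁ * (ι (j F.* t) + ω)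
        ≡⟨ solve 5 (λ x₀ x₁ r k w → x₀ :* (r :* w) :+ x₁ :* (k :+ w) := k :* x₁ :+ (r :* x₀ :+ x₁) :* w) refl x₀ x₁ (ι ρ) _ ω ⟩
      ι (j F.* t) * x₁ + (ι ρ * x₀ + x₁) * ω
        ≡⟨ cong₂ (λ u v → u + v * ω) (ι-* _ _) (trans (ι-+ _ _) (cong (_+ x₁) (ι-* _ _))) ⟨
      compose (j F.* t F.* π₁ x) (ρ F.* π₀ x F.+ π₁ x) ∎
      where
      x₀ = ι (π₀ x)
      x₁ = ι (π₁ x)
    -- Conjugation keeps the characteristic polynomial X² - X - t of `ω`, so an eigenvalue `e` would
    -- solve e² - e = t.
    no-eigenvalue : ∀ x e → x ≢ 0# → a * x + b * σ x ≢ ι e * x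
    no-eigenvalue x e x≢0 eq = t-missed e (sym (F.cancel-*ʳ x₁≢0 (F.combine₂ F.1# e e₀′ e₁
        (FS.solve 5 (λ t e r x₀ x₁ → t FS.:* x₁ FS.:+ FS.:- ((e FS.:* e FS.:+ FS.:- e) FS.:* x₁)
           FS.:= F.:1 FS.:* (t FS.:* x₁ FS.:+ FS.:- (r FS.:* (e FS.:* x₀))) FS.:+ e FS.:* (r FS.:* x₀ FS.:+ x₁ FS.:+ FS.:- (e FS.:* x₁))) refl t e ρ x₀ x₁))))
      where
      x₀ = π₀ x
      x₁ = π₁ x
      e₀ : j F.* t F.* x₁ ≡ e F.* x₀
      e₀ = trans (sym (π₀-compose _ _)) (trans (cong π₀ (trans (sym (T-coordinates x)) eq)) (π₀-scale e x))
      e₁ : ρ F.* x₀ F.+ x₁ ≡ e F.* x₁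
      e₁ = trans (sym (π₁-compose _ _)) (trans (cong π₁ (trans (sym (T-coordinates x)) eq)) (π₁-scale e x))
      e₀′ : t F.* x₁ ≡ ρ F.* (e F.* x₀)
      e₀′ = F.combine₂ (F.- (t F.* x₁)) ρ (F.*-inverseʳ ρ≢0) e₀
        (FS.solve 6 (λ t e r x₀ x₁ j → t FS.:* x₁ FS.:+ FS.:- (r FS.:* (e FS.:* x₀))
           FS.:= FS.:- (t FS.:* x₁) FS.:* (r FS.:* j FS.:+ FS.:- F.:1) FS.:+ r FS.:* (j FS.:* t FS.:* x₁ FS.:+ FS.:- (e FS.:* x₀))) refl t e ρ x₀ x₁ j)
      x₁≢0 : x₁ ≢ F.0#
      x₁≢0 z = x≢0 (π-unique (trans (F.x*y≡0 ρ≢0 (F.combine₂ F.1# (e F.+ F.- F.1#) e₁ z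
        (FS.solve 4 (λ r x₀ x₁ e → r FS.:* x₀ FS.:+ FS.:- F.:0 FS.:= F.:1 FS.:* (r FS.:* x₀ FS.:+ x₁ FS.:+ FS.:- (e FS.:* x₁)) FS.:+ (e FS.:+ FS.:- F.:1) FS.:* (x₁ FS.:+ FS.:- F.:0)) refl ρ x₀ x₁ e))) (sym π₀-0)) (trans z (sym π₁-0)))
    -- If `π₁` killed `κx`, then `κx` would lie in `F` and be an eigenvalue at `x`.
    τ≢0 : ∀ x → x ≢ 0# → τ x ≢ F.0#
    τ≢0 x x≢0 e = no-eigenvalue x (π₀ κx) x≢0 (begin
      a * x + b * σ x ≡⟨ combine₁ (- (b * σ x)) (*-inverseʳ x≢0) (solve 5 (λ a b x x′ y → a :* x :+ b :* x′ :+ :- ((a :+ b :* (x′ :* y)) :* x) := :- (b :* x′) :* (x :* y :+ :- :1))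
            refl a b x (σ x) (x ⁻¹)) ⟩
      κx * x ≡⟨ cong (_* x) (π₁≡0⇒ι e) ⟩
      ι (π₀ κx) * x ∎)
      where κx = a + b * (σ x * x ⁻¹)
    covers : ∀ x k → x ≢ 0# → Dec (k ≡ F.0#) → (k ≡ F.0#) ⊎ (∃ λ β → (β ≢ F.0#) × (k ≡ β F.* τ x))
    covers x k x≢0 (yes e) = inj₁ e
    covers x k x≢0 (no ne) = inj₂ (k F.* τ x F.⁻¹ , F.*-≢0 ne (F.⁻¹-≢0 (τ≢0 x x≢0)) ,
      F.combine₁ (F.- k) (F.*-inverseˡ (τ≢0 x x≢0)) (FS.solve 3 (λ k t j → k FS.:+ FS.:- (k FS.:* j FS.:* t) FS.:= FS.:- k FS.:* (j FS.:* t FS.:+ FS.:- F.:1)) refl k (τ x) _))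

  spreadData : SpreadData Q
  spreadData = go (F.any? (λ ρ → ¬? (ρ F.≟ F.0#) ×-dec ¬? (ρ F.≟ F.1#)))
    where
    go : Dec (∃ λ ρ → ρ ≢ F.0# × ρ ≢ F.1#) → SpreadData Q
    go (yes (ρ , ρ≢0 , ρ≢1)) = spreadData-conjugate ρ ρ≢0 ρ≢1
    go (no none) = spreadData-2 (λ x x≢0 → decide x x≢0 (x F.≟ F.1#))
      where
      decide : ∀ x → x ≢ F.0# → Dec (x ≡ F.1#) → x ≡ F.1#
      decide x x≢0 (yes e) = e
      decide x x≢0 (no ne) = ⊥-elim (none (x , x≢0 , ne))

-- Vectors, lines and canonical bases

firstOr : ∀ {A : Set} → A → List A → A
firstOr x [] = x
firstOr x (y ∷ _) = y

firstOr-∈ : ∀ {A : Set} x {y : A} {ys} → y ∈ ys → firstOr x ys ∈ ys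
firstOr-∈ x {ys = _ ∷ _} _ = here refl

-- `canonical` takes its own argument as default, and that differs between two bases of one line.
firstOr-default : ∀ {A : Set} x x′ {y : A} {ys} → y ∈ ys → firstOr x ys ≡ firstOr x′ ys
firstOr-default x x′ {ys = _ ∷ _} _ = refl

module Vectors {q : ℕ} (K : FField q) where
  open FieldTheory K
  open Solver using (solve; _:=_; _:*_; _:+_; :-_)

  V : ℕ → Set
  V = Vec Carrier

  zeroV : ∀ {d} → V d
  zeroV = replicate _ 0#

  scale : ∀ {d} → Carrier → V d → V d
  scale a = map (a *_)

  comb : ∀ {d} → Carrier → Carrier → V d → V d → V d
  comb a b u w = zipWith _+_ (scale a u) (scale b w)

  infix 4 _≟ᵥ_
  _≟ᵥ_ : ∀ {d} (u w : V d) → Dec (u ≡ w)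
  _≟ᵥ_ = Vecₚ.≡-dec _≟_

  comb-comb : ∀ {d} a b p r p′ r′ (u w : V d) →
    comb a b (comb p r u w) (comb p′ r′ u w) ≡ comb (a * p + b * p′) (a * r + b * r′) u w
  comb-comb a b p r p′ r′ [] [] = refl
  comb-comb a b p r p′ r′ (x ∷ u) (y ∷ w) = cong₂ _∷_
    (solve 8 (λ a b p r p′ r′ x y → a :* (p :* x :+ r :* y) :+ b :* (p′ :* x :+ r′ :* y)
      := (a :* p :+ b :* p′) :* x :+ (a :* r :+ b :* r′) :* y) refl a b p r p′ r′ x y)
    (comb-comb a b p r p′ r′ u w)

  comb-1-0 : ∀ {d} (u w : V d) → comb 1# 0# u w ≡ u
  comb-1-0 [] [] = refl
  comb-1-0 (x ∷ u) (y ∷ w) = cong₂ _∷_ (solve 2 (λ x y → :1 :* x :+ :0 :* y := x) refl x y) (comb-1-0 u w)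

  comb-0-1 : ∀ {d} (u w : V d) → comb 0# 1# u w ≡ w
  comb-0-1 [] [] = refl
  comb-0-1 (x ∷ u) (y ∷ w) = cong₂ _∷_ (solve 2 (λ x y → :0 :* x :+ :1 :* y := y) refl x y) (comb-0-1 u w)

  comb-0-0 : ∀ {d} (u w : V d) → comb 0# 0# u w ≡ zeroV
  comb-0-0 [] [] = refl
  comb-0-0 (x ∷ u) (y ∷ w) = cong₂ _∷_ (solve 2 (λ x y → :0 :* x :+ :0 :* y := :0) refl x y) (comb-0-0 u w)

  comb-zero : ∀ {d} a b → comb {d} a b zeroV zeroV ≡ zeroV
  comb-zero {zero} a b = refl
  comb-zero {suc d} a b = cong₂ _∷_ (solve 2 (λ a b → a :* :0 :+ b :* :0 := :0) refl a b) (comb-zero a b)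

  comb-scale : ∀ {d} a b e (u : V d) → comb a b u (scale e u) ≡ scale (a + b * e) u
  comb-scale a b e [] = refl
  comb-scale a b e (x ∷ u) = cong₂ _∷_ (solve 4 (λ a b e x → a :* x :+ b :* (e :* x) := (a :+ b :* e) :* x) refl a b e x) (comb-scale a b e u)

  comb-swap : ∀ {d} a b (u w : V d) → comb a b u w ≡ comb b a w u
  comb-swap a b [] [] = refl
  comb-swap a b (x ∷ u) (y ∷ w) = cong₂ _∷_ (+-comm _ _) (comb-swap a b u w)

  scale-as-comb : ∀ {d} a (u w : V d) → scale a u ≡ comb a 0# u w
  scale-as-comb a [] [] = refl
  scale-as-comb a (x ∷ u) (y ∷ w) = cong₂ _∷_ (solve 3 (λ a x y → a :* x := a :* x :+ :0 :* y) refl a x y) (scale-as-comb a u w)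

  scale-1 : ∀ {d} (u : V d) → scale 1# u ≡ u
  scale-1 [] = refl
  scale-1 (x ∷ u) = cong₂ _∷_ (*-identityˡ x) (scale-1 u)

  scale-0 : ∀ {d} (u : V d) → scale 0# u ≡ zeroV
  scale-0 [] = refl
  scale-0 (x ∷ u) = cong₂ _∷_ (zeroˡ x) (scale-0 u)

  scale-zero : ∀ {d} a → scale {d} a zeroV ≡ zeroV
  scale-zero {zero} a = refl
  scale-zero {suc d} a = cong₂ _∷_ (zeroʳ a) (scale-zero a)

  scale-scale : ∀ {d} a b (u : V d) → scale a (scale b u) ≡ scale (a * b) u
  scale-scale a b [] = refl
  scale-scale a b (x ∷ u) = cong₂ _∷_ (sym (*-assoc a b x)) (scale-scale a b u)

  scale≡zero : ∀ {d a} {u : V d} → u ≢ zeroV → scale a u ≡ zeroV → a ≡ 0#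
  scale≡zero {d} {a} {u} u≢0 e with a ≟ 0#
  ... | yes p = p
  ... | no ne = ⊥-elim (u≢0 (begin
    u ≡⟨ scale-1 u ⟨
    scale 1# u ≡⟨ cong (λ x → scale x u) (*-inverseˡ ne) ⟨
    scale (a ⁻¹ * a) u ≡⟨ scale-scale _ _ u ⟨
    scale (a ⁻¹) (scale a u) ≡⟨ cong (scale (a ⁻¹)) e ⟩
    scale (a ⁻¹) zeroV ≡⟨ scale-zero _ ⟩
    zeroV ∎))
    where open ≡-Reasoning

  Indep : ∀ {d} → V d → V d → Set
  Indep u w = ∀ a b → comb a b u w ≡ zeroV → (a ≡ 0#) × (b ≡ 0#)

  InSpan : ∀ {d} → V d → V d → V d → Set
  InSpan x u w = ∃ λ a → ∃ λ b → x ≡ comb a b u w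

  span-left : ∀ {d} (u w : V d) → InSpan u u w
  span-left u w = 1# , 0# , sym (comb-1-0 u w)

  span-right : ∀ {d} (u w : V d) → InSpan w u w
  span-right u w = 0# , 1# , sym (comb-0-1 u w)

  span-trans : ∀ {d} {x u w u′ w′ : V d} → InSpan x u w → InSpan u u′ w′ → InSpan w u′ w′ → InSpan x u′ w′
  span-trans (a , b , refl) (p , r , refl) (p′ , r′ , refl) = _ , _ , comb-comb a b p r p′ r′ _ _

  Indep-left : ∀ {d} {u w : V d} → Indep u w → u ≢ zeroV
  Indep-left {u = u} {w} ind refl = 1≢0 (proj₁ (ind 1# 0# (comb-1-0 u w)))

  comb-difference : ∀ {d} a b a′ b′ (u w : V d) → comb a b u w ≡ comb a′ b′ u w → comb (a + - a′) (b + - b′) u w ≡ zeroV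
  comb-difference a b a′ b′ u w e = begin
    comb (a + - a′) (b + - b′) u w
      ≡⟨ cong₂ (λ x y → comb x y u w) (split a a′) (split b b′) ⟩
    comb (1# * a + - 1# * a′) (1# * b + - 1# * b′) u w ≡⟨ comb-comb 1# (- 1#) a b a′ b′ u w ⟨
    comb 1# (- 1#) (comb a b u w) (comb a′ b′ u w) ≡⟨ cong (λ x → comb 1# (- 1#) x (comb a′ b′ u w)) e ⟩
    comb 1# (- 1#) (comb a′ b′ u w) (comb a′ b′ u w) ≡⟨ comb-comb 1# (- 1#) a′ b′ a′ b′ u w ⟩
    comb (1# * a′ + - 1# * a′) (1# * b′ + - 1# * b′) u w ≡⟨ cong₂ (λ x y → comb x y u w) (vanish a′) (vanish b′) ⟩
    comb 0# 0# u w ≡⟨ comb-0-0 u w ⟩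
    zeroV ∎
    where
    open ≡-Reasoning
    split : ∀ x y → x + - y ≡ 1# * x + - 1# * y
    split = solve 2 (λ x y → x :+ :- y := :1 :* x :+ (:- :1) :* y) refl
    vanish : ∀ x → 1# * x + - 1# * x ≡ 0#
    vanish = solve 1 (λ x → :1 :* x :+ (:- :1) :* x := :0) refl

  coordinates-unique : ∀ {d} {u w : V d} → Indep u w → ∀ {a b a′ b′} → comb a b u w ≡ comb a′ b′ u w → (a ≡ a′) × (b ≡ b′)
  coordinates-unique {u = u} {w} ind {a} {b} {a′} {b′} e =
    let x , y = ind _ _ (comb-difference a b a′ b′ u w e) in x-y≡0 x , x-y≡0 y

  -- With vanishing determinant, the coefficients (p′ , - p) and (r′ , - r) both give vanishing
  -- combinations of the two vectors; so p = r = 0, and the first vector would be zero.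
  coordinate-det : ∀ {d} {u w : V d} p r p′ r′ → Indep (comb p r u w) (comb p′ r′ u w) → p * r′ + - (r * p′) ≢ 0#
  coordinate-det {d} {u} {w} p r p′ r′ ind D≡0 = Indep-left ind (begin
      comb p r u w ≡⟨ cong₂ (λ x y → comb x y u w) p≡0 r≡0 ⟩
      comb 0# 0# u w ≡⟨ comb-0-0 u w ⟩
      zeroV ∎)
    where
    open ≡-Reasoning
    x = comb p r u w
    y = comb p′ r′ u w
    p≡0 : p ≡ 0#
    p≡0 = trans (solve 1 (λ p → p := :- (:- p)) refl p) (trans (cong -_ (proj₂ (ind p′ (- p) (trans (comb-comb p′ (- p) p r p′ r′ u w)
      (trans (cong₂ (λ x y → comb x y u w) (solve 2 (λ p p′ → p′ :* p :+ (:- p) :* p′ := :0) refl p p′)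
        (trans (solve 4 (λ p r p′ r′ → p′ :* r :+ (:- p) :* r′ := :- (p :* r′ :+ :- (r :* p′))) refl p r p′ r′) (trans (cong -_ D≡0) (solve 0 (:- :0 := :0) refl))))
        (comb-0-0 u w)))))) (solve 0 (:- :0 := :0) refl))
    r≡0 : r ≡ 0#
    r≡0 = trans (solve 1 (λ p → p := :- (:- p)) refl r) (trans (cong -_ (proj₂ (ind r′ (- r) (trans (comb-comb r′ (- r) p r p′ r′ u w)
      (trans (cong₂ (λ x y → comb x y u w) (trans (solve 4 (λ p r p′ r′ → r′ :* p :+ (:- r) :* p′ := p :* r′ :+ :- (r :* p′)) refl p r p′ r′) D≡0)
         (solve 2 (λ r r′ → r′ :* r :+ (:- r) :* r′ := :0) refl r r′))
        (comb-0-0 u w)))))) (solve 0 (:- :0 := :0) refl))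

  invert-coordinates : ∀ {d} (u w : V d) p r p′ r′ → p * r′ + - (r * p′) ≢ 0# →
    let D⁻¹ = (p * r′ + - (r * p′)) ⁻¹ in
    (u ≡ comb (D⁻¹ * r′) (- (D⁻¹ * r)) (comb p r u w) (comb p′ r′ u w)) ×
    (w ≡ comb (- (D⁻¹ * p′)) (D⁻¹ * p) (comb p r u w) (comb p′ r′ u w))
  invert-coordinates u w p r p′ r′ D≢0 =
    trans (sym (comb-1-0 u w)) (trans (cong₂ (λ x y → comb x y u w)
      (combine₁ (- 1#) inv (solve 5 (λ p r p′ r′ j → :1 :+ :- ((j :* r′) :* p :+ :- (j :* r) :* p′) := :- :1 :* (j :* (p :* r′ :+ :- (r :* p′)) :+ :- :1)) refl p r p′ r′ j))
      (solve 3 (λ r r′ j → :0 := (j :* r′) :* r :+ :- (j :* r) :* r′) refl r r′ j)) (sym (comb-comb _ _ p r p′ r′ u w))) ,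
    trans (sym (comb-0-1 u w)) (trans (cong₂ (λ x y → comb x y u w)
      (solve 3 (λ p p′ j → :0 := :- (j :* p′) :* p :+ (j :* p) :* p′) refl p p′ j)
      (combine₁ (- 1#) inv (solve 5 (λ p r p′ r′ j → :1 :+ :- (:- (j :* p′) :* r :+ (j :* p) :* r′) := :- :1 :* (j :* (p :* r′ :+ :- (r :* p′)) :+ :- :1)) refl p r p′ r′ j)))
      (sym (comb-comb _ _ p r p′ r′ u w)))
    where
    j = (p * r′ + - (r * p′)) ⁻¹
    inv = *-inverseˡ D≢0

  exchange : ∀ {d} {u w u′ w′ : V d} → Indep u w → InSpan u u′ w′ → InSpan w u′ w′ → InSpan u′ u w × InSpan w′ u w
  exchange {u′ = u′} {w′} ind (p , r , refl) (p′ , r′ , refl) =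
    let e , e′ = invert-coordinates u′ w′ p r p′ r′ (coordinate-det p r p′ r′ ind)
    in (_ , _ , e) , (_ , _ , e′)

  -- A vanishing combination of `u′` and `w′` is rewritten in `u` and `w` by the inverse matrix. Its
  -- coefficients there are zero, and the matrix carries them back to `a` and `b`.
  Indep-span : ∀ {d} {u w u′ w′ : V d} → Indep u w → InSpan u u′ w′ → InSpan w u′ w′ → Indep u′ w′
  Indep-span {u = u} {w} {u′} {w′} ind (p , r , refl) (p′ , r′ , refl) a b e = a≡0 , b≡0
    where
    D = p * r′ + - (r * p′)
    D≢0 : D ≢ 0#
    D≢0 = coordinate-det p r p′ r′ ind
    j = D ⁻¹
    in-new : comb (a * (j * r′) + b * - (j * p′)) (a * - (j * r) + b * (j * p)) u w ≡ zeroV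
    in-new = let e₁ , e₂ = invert-coordinates u′ w′ p r p′ r′ D≢0 in
      trans (sym (comb-comb a b _ _ _ _ u w)) (trans (sym (cong₂ (comb a b) e₁ e₂)) e)
    z₁ = proj₁ (ind _ _ in-new)
    z₂ = proj₂ (ind _ _ in-new)
    a≡0 : a ≡ 0#
    a≡0 = cancel-*ˡ D≢0 (combine₂ (D * p) (D * p′) z₁ z₂ id₁)
      where
      id₁ : D * a + - (D * 0#) ≡ D * p * (a * (j * r′) + b * - (j * p′) + - 0#) + D * p′ * (a * - (j * r) + b * (j * p) + - 0#)
      id₁ = combine₁ (- (D * a)) (*-inverseˡ D≢0) (solve 7 (λ a b p r p′ r′ j →
        let D = p :* r′ :+ :- (r :* p′) in
        D :* a :+ :- (D :* :0) :+ :- (D :* p :* (a :* (j :* r′) :+ b :* :- (j :* p′) :+ :- :0) :+ D :* p′ :* (a :* :- (j :* r) :+ b :* (j :* p) :+ :- :0))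
          := :- (D :* a) :* (j :* D :+ :- :1)) refl a b p r p′ r′ j)
    b≡0 : b ≡ 0#
    b≡0 = cancel-*ˡ D≢0 (combine₂ (D * r) (D * r′) z₁ z₂ id₂)
      where
      id₂ : D * b + - (D * 0#) ≡ D * r * (a * (j * r′) + b * - (j * p′) + - 0#) + D * r′ * (a * - (j * r) + b * (j * p) + - 0#)
      id₂ = combine₁ (- (D * b)) (*-inverseˡ D≢0) (solve 7 (λ a b p r p′ r′ j →
        let D = p :* r′ :+ :- (r :* p′) in
        D :* b :+ :- (D :* :0) :+ :- (D :* r :* (a :* (j :* r′) :+ b :* :- (j :* p′) :+ :- :0) :+ D :* r′ :* (a :* :- (j :* r) :+ b :* (j :* p) :+ :- :0))
          := :- (D :* b) :* (j :* D :+ :- :1)) refl a b p r p′ r′ j)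

  Dependent : ∀ {d} → V d → V d → Set
  Dependent u w = ∃ λ e → w ≡ scale e u

  Dependent? : ∀ {d} (u w : V d) → Dec (Dependent u w)
  Dependent? u w = any? (λ e → w ≟ᵥ scale e u)

  ¬Dependent⇒Indep : ∀ {d} {u w : V d} → u ≢ zeroV → ¬ Dependent u w → Indep u w
  ¬Dependent⇒Indep {d} {u} {w} u≢0 nd a b e with b ≟ 0#
  ... | yes refl = scale≡zero u≢0 (trans (scale-as-comb a u w) e) , refl
  ... | no b≢0 = ⊥-elim (nd (- (b ⁻¹ * a) , (begin
      w ≡⟨ comb-0-1 u w ⟨
      comb 0# 1# u w ≡⟨ cong₂ (λ x y → comb x y u w)
         (solve 2 (λ a j → :0 := :- (j :* a) :* :1 :+ j :* a) refl a (b ⁻¹))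
         (trans (sym (*-inverseˡ b≢0)) (solve 3 (λ a j b → j :* b := :- (j :* a) :* :0 :+ j :* b) refl a (b ⁻¹) b)) ⟩
      comb (- (b ⁻¹ * a) * 1# + b ⁻¹ * a) (- (b ⁻¹ * a) * 0# + b ⁻¹ * b) u w ≡⟨ comb-comb (- (b ⁻¹ * a)) (b ⁻¹) 1# 0# a b u w ⟨
      comb (- (b ⁻¹ * a)) (b ⁻¹) (comb 1# 0# u w) (comb a b u w) ≡⟨ cong₂ (comb (- (b ⁻¹ * a)) (b ⁻¹)) (comb-1-0 u w) (trans e (sym (scale-0 u))) ⟩
      comb (- (b ⁻¹ * a)) (b ⁻¹) u (scale 0# u) ≡⟨ comb-scale _ _ 0# u ⟩
      scale (- (b ⁻¹ * a) + b ⁻¹ * 0#) u ≡⟨ cong (λ x → scale x u) (solve 2 (λ a j → :- (j :* a) :+ j :* :0 := :- (j :* a)) refl a (b ⁻¹)) ⟩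
      scale (- (b ⁻¹ * a)) u ∎)))
    where open ≡-Reasoning

  Indep⇒¬Dependent : ∀ {d} {u w : V d} → Indep u w → ¬ Dependent u w
  Indep⇒¬Dependent {d} {u} ind (e , refl) = 1≢0 (trans (solve 0 (:1 := :- (:- :1)) refl) (trans (cong -_ (proj₂ (ind e (- 1#)
      (trans (comb-scale e (- 1#) e u) (trans (cong (λ x → scale x u) (solve 1 (λ e → e :+ (:- :1) :* e := :0) refl e)) (scale-0 u))))))
      (solve 0 (:- :0 := :0) refl)))

  InSpan? : ∀ {d} (x u w : V d) → Dec (InSpan x u w)
  InSpan? x u w = any? (λ a → any? (λ b → x ≟ᵥ comb a b u w))

  SameSpan : ∀ {d} → V d × V d → V d × V d → Set
  SameSpan (u , w) (u′ , w′) = (InSpan u′ u w × InSpan w′ u w) × (InSpan u u′ w′ × InSpan w u′ w′)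

  SameSpan? : ∀ {d} (l m : V d × V d) → Dec (SameSpan l m)
  SameSpan? (u , w) (u′ , w′) = (InSpan? u′ u w ×-dec InSpan? w′ u w) ×-dec (InSpan? u u′ w′ ×-dec InSpan? w u′ w′)

  SameSpan-refl : ∀ {d} (l : V d × V d) → SameSpan l l
  SameSpan-refl (u , w) = (span-left u w , span-right u w) , (span-left u w , span-right u w)

  SameSpan-sym : ∀ {d} {l m : V d × V d} → SameSpan l m → SameSpan m l
  SameSpan-sym (p , q) = q , p

  SameSpan-trans : ∀ {d} {l m n : V d × V d} → SameSpan l m → SameSpan m n → SameSpan l n
  SameSpan-trans ((a , b) , (c , d)) ((a′ , b′) , (c′ , d′)) =
    (span-trans a′ a b , span-trans b′ a b) , (span-trans c c′ d′ , span-trans d c′ d′)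

  sameSpan : ∀ {d} {u w u′ w′ : V d} → Indep u′ w′ → InSpan u′ u w → InSpan w′ u w → SameSpan (u , w) (u′ , w′)
  sameSpan ind p p′ = (p , p′) , exchange ind p p′

  scalars : List Carrier
  scalars = List.map (Inverse.from finite) (List.allFin q)

  ∈-scalars : ∀ x → x ∈ scalars
  ∈-scalars x = subst (_∈ scalars) (from∘to x) (∈-map⁺ (Inverse.from finite) (∈-allFin (Inverse.to finite x)))

  vectors : ∀ d → List (V d)
  vectors zero = [] ∷ []
  vectors (suc d) = List.cartesianProductWith _∷_ scalars (vectors d)

  ∈-vectors : ∀ {d} (u : V d) → u ∈ vectors d
  ∈-vectors [] = here refl
  ∈-vectors (x ∷ u) = ∈-cartesianProductWith⁺ _∷_ (∈-scalars x) (∈-vectors u)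

  spanningPairs : ∀ {d} → V d × V d → List (V d × V d)
  spanningPairs {d} l = List.filter (SameSpan? l) (List.cartesianProduct (vectors d) (vectors d))

  ∈-spanningPairs : ∀ {d} (l : V d × V d) → l ∈ spanningPairs l
  ∈-spanningPairs (u , w) = ∈-filter⁺ (SameSpan? (u , w)) (∈-cartesianProduct⁺ (∈-vectors u) (∈-vectors w)) (SameSpan-refl (u , w))

  -- One basis for each line, the first in a fixed enumeration of all pairs of vectors. Coordinates
  -- on an `E`-line then do not depend on the vectors that name it.
  canonical : ∀ {d} → V d × V d → V d × V d
  canonical l = firstOr l (spanningPairs l)

  canonical-SameSpan : ∀ {d} (l : V d × V d) → SameSpan l (canonical l)
  canonical-SameSpan {d} l = proj₂ (∈-filter⁻ (SameSpan? l) {xs = List.cartesianProduct (vectors d) (vectors d)} (firstOr-∈ l (∈-spanningPairs l)))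

  canonical-cong : ∀ {d} {l m : V d × V d} → SameSpan l m → canonical l ≡ canonical m
  canonical-cong {d} {l} {m} e = trans (firstOr-default l m (∈-spanningPairs l))
    (cong (firstOr m) (Listₚ.filter-≐ (SameSpan? l) (SameSpan? m)
      ((λ {n} s → SameSpan-trans {l = m} {l} {n} (SameSpan-sym {l = l} {m} e) s) , (λ {n} s → SameSpan-trans {l = l} {m} {n} e s)) (List.cartesianProduct (vectors d) (vectors d))))

-- Intersecting lines appear as two pairs with the same first vector, so `proper` needs no notion of
-- intersection. Since `complete` admits equal colours, it also says that every colour occurs.
record LineColouring {q} (K : FField q) (d : ℕ) (C : Set) : Set where
  open Vectors K
  field
    col : V d → V d → C
    col-span : ∀ {u w u′ w′} → Indep u w → Indep u′ w′ → InSpan u′ u w → InSpan w′ u w → col u′ w′ ≡ col u w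
    proper : ∀ {u w w′} → Indep u w → Indep u w′ → col u w ≡ col u w′ → InSpan w′ u w
    complete : ∀ c c′ → ∃ λ u → ∃ λ w → ∃ λ w′ → Indep u w × Indep u w′ × col u w ≡ c × col u w′ ≡ c′

-- Passing from E to F

module Restriction {q r} {F : FField q} {E : FField r} (Q : QuadraticExtension F E) where
  open QuadraticTheory Q
  open FieldTheory E
  open QuadraticExtension Q
  module VF = Vectors F
  open Vectors E

  flatten : ∀ {d} → V d → VF.V (d ℕ.+ d)
  flatten u = map π₀ u ++ map π₁ u

  unflatten : ∀ d → VF.V (d ℕ.+ d) → V d
  unflatten d x = zipWith compose (take d x) (drop d x)

  map-π₀ : ∀ {d} (x y : VF.V d) → map π₀ (zipWith compose x y) ≡ x
  map-π₀ [] [] = refl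
  map-π₀ (a ∷ x) (b ∷ y) = cong₂ _∷_ (π₀-compose a b) (map-π₀ x y)

  map-π₁ : ∀ {d} (x y : VF.V d) → map π₁ (zipWith compose x y) ≡ y
  map-π₁ [] [] = refl
  map-π₁ (a ∷ x) (b ∷ y) = cong₂ _∷_ (π₁-compose a b) (map-π₁ x y)

  zip-π : ∀ {d} (u : V d) → zipWith compose (map π₀ u) (map π₁ u) ≡ u
  zip-π [] = refl
  zip-π (x ∷ u) = cong₂ _∷_ (sym (decompose x)) (zip-π u)

  flatten-unflatten : ∀ d (x : VF.V (d ℕ.+ d)) → flatten (unflatten d x) ≡ x
  flatten-unflatten d x = trans (cong₂ _++_ (map-π₀ (take d x) (drop d x)) (map-π₁ (take d x) (drop d x))) (Vecₚ.take++drop≡id d x)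

  unflatten-flatten : ∀ {d} (u : V d) → unflatten d (flatten u) ≡ u
  unflatten-flatten {d} u = trans (cong₂ (zipWith compose)
      (Vecₚ.++-injectiveˡ _ _ halves) (Vecₚ.++-injectiveʳ (take d (flatten u)) _ halves)) (zip-π u)
    where
    halves : take d (flatten u) ++ drop d (flatten u) ≡ map π₀ u ++ map π₁ u
    halves = Vecₚ.take++drop≡id d (flatten u)

  unflatten-injective : ∀ d {x y : VF.V (d ℕ.+ d)} → unflatten d x ≡ unflatten d y → x ≡ y
  unflatten-injective d {x} {y} e = trans (sym (flatten-unflatten d x)) (trans (cong flatten e) (flatten-unflatten d y))

  comb-++ : ∀ {m n} a b (x y : VF.V m) (x′ y′ : VF.V n) → VF.comb a b (x ++ x′) (y ++ y′) ≡ VF.comb a b x y ++ VF.comb a b x′ y′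
  comb-++ a b [] [] x′ y′ = refl
  comb-++ a b (_ ∷ x) (_ ∷ y) x′ y′ = cong (_ ∷_) (comb-++ a b x y x′ y′)

  flatten-comb : ∀ {d} a b (u w : V d) → flatten (comb (ι a) (ι b) u w) ≡ VF.comb a b (flatten u) (flatten w)
  flatten-comb a b u w = trans (cong₂ _++_ (halves₀ u w) (halves₁ u w)) (sym (comb-++ a b (map π₀ u) (map π₀ w) (map π₁ u) (map π₁ w)))
    where
    halves₀ : ∀ {d} (u w : V d) → map π₀ (comb (ι a) (ι b) u w) ≡ VF.comb a b (map π₀ u) (map π₀ w)
    halves₀ [] [] = refl
    halves₀ (x ∷ u) (y ∷ w) = cong₂ _∷_ (π₀-linear a b x y) (halves₀ u w)
    halves₁ : ∀ {d} (u w : V d) → map π₁ (comb (ι a) (ι b) u w) ≡ VF.comb a b (map π₁ u) (map π₁ w)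
    halves₁ [] [] = refl
    halves₁ (x ∷ u) (y ∷ w) = cong₂ _∷_ (π₁-linear a b x y) (halves₁ u w)

  unflatten-comb : ∀ d a b (x y : VF.V (d ℕ.+ d)) → unflatten d (VF.comb a b x y) ≡ comb (ι a) (ι b) (unflatten d x) (unflatten d y)
  unflatten-comb d a b x y = trans (cong (unflatten d) (trans (cong₂ (VF.comb a b) (sym (flatten-unflatten d x)) (sym (flatten-unflatten d y)))
    (sym (flatten-comb a b (unflatten d x) (unflatten d y))))) (unflatten-flatten _)

  unflatten-zero : ∀ d → unflatten d VF.zeroV ≡ zeroV
  unflatten-zero d = begin
    unflatten d VF.zeroV ≡⟨ cong (unflatten d) (VF.comb-0-0 z z) ⟨
    unflatten d (VF.comb F.0# F.0# z z) ≡⟨ unflatten-comb d F.0# F.0# z z ⟩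
    comb (ι F.0#) (ι F.0#) (unflatten d z) (unflatten d z) ≡⟨ cong₂ (λ a b → comb a b (unflatten d z) (unflatten d z)) ι-0 ι-0 ⟩
    comb 0# 0# (unflatten d z) (unflatten d z) ≡⟨ comb-0-0 _ _ ⟩
    zeroV ∎
    where
    open ≡-Reasoning
    z : VF.V (d ℕ.+ d)
    z = VF.zeroV

  -- With this span, `F`-lines can be treated as pairs of vectors over `E`; flattening is needed
  -- only at the end.
  InSpanF : ∀ {d} → V d → V d → V d → Set
  InSpanF x u w = ∃ λ a → ∃ λ b → x ≡ comb (ι a) (ι b) u w

  InSpanF⇒InSpan : ∀ {d} {x u w : V d} → InSpanF x u w → InSpan x u w
  InSpanF⇒InSpan (a , b , e) = ι a , ι b , e

  unflatten-InSpan : ∀ d {x y z : VF.V (d ℕ.+ d)} → VF.InSpan x y z → InSpanF (unflatten d x) (unflatten d y) (unflatten d z)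
  unflatten-InSpan d {x} {y} {z} (a , b , e) = a , b , trans (cong (unflatten d) e) (unflatten-comb d a b y z)

  unflatten-InSpan⁻¹ : ∀ d {x y z : VF.V (d ℕ.+ d)} → InSpanF (unflatten d x) (unflatten d y) (unflatten d z) → VF.InSpan x y z
  unflatten-InSpan⁻¹ d {x} {y} {z} (a , b , e) = a , b , unflatten-injective d (trans e (sym (unflatten-comb d a b y z)))

  unflatten-≢0 : ∀ d {x : VF.V (d ℕ.+ d)} → x ≢ VF.zeroV → unflatten d x ≢ zeroV
  unflatten-≢0 d ne e = ne (unflatten-injective d (trans e (sym (unflatten-zero d))))

  flatten-Indep : ∀ {d} {u w : V d} → (∀ a b → comb (ι a) (ι b) u w ≡ zeroV → (a ≡ F.0#) × (b ≡ F.0#)) → VF.Indep (flatten u) (flatten w)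
  flatten-Indep {d} {u} {w} ind a b e = ind a b (begin
    comb (ι a) (ι b) u w ≡⟨ unflatten-flatten _ ⟨
    unflatten d (flatten (comb (ι a) (ι b) u w)) ≡⟨ cong (unflatten d) (trans (flatten-comb a b u w) e) ⟩
    unflatten d VF.zeroV ≡⟨ unflatten-zero d ⟩
    zeroV ∎)
    where open ≡-Reasoning

-- Doubling: a colouring over E refined by the parallelism

module Doubling {q r} {F : FField q} {E : FField r} {Q : QuadraticExtension F E} (S : SpreadData Q)
                {d : ℕ} {C : Set} (c₀ : C) (L : LineColouring E d C) where
  open QuadraticTheory Q
  open FieldTheory E
  open QuadraticExtension Q
  open Parallelism S using (E²; combine; det)
  open PackingColours S
  open Restriction Q
  open Vectors E
  module L = LineColouring L
  open Solver using (solve; _:=_; _:*_; _:+_; :-_)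

  at : V d × V d → E² → V d
  at (e , f) (p , r) = comb p r e f

  at-combine : ∀ B a b p r → comb (ι a) (ι b) (at B p) (at B r) ≡ at B (combine a b p r)
  at-combine (e , f) a b (p₁ , p₂) (r₁ , r₂) = comb-comb (ι a) (ι b) p₁ p₂ r₁ r₂ e f

  at-injective : ∀ B → Indep (proj₁ B) (proj₂ B) → ∀ {p r} → at B p ≡ at B r → p ≡ r
  at-injective (e , f) ind eq = let x , y = coordinates-unique ind eq in cong₂ _,_ x y

  at-det : ∀ B {p r} → Indep (at B p) (at B r) → det p r ≢ 0#
  at-det (e , f) {p₁ , p₂} {r₁ , r₂} = coordinate-det p₁ p₂ r₁ r₂

  at-Indep : ∀ B → Indep (proj₁ B) (proj₂ B) → ∀ p r → det p r ≢ 0# → Indep (at B p) (at B r)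
  at-Indep (e , f) ind (p₁ , p₂) (r₁ , r₂) D≢0 =
    let x , y = invert-coordinates e f p₁ p₂ r₁ r₂ D≢0 in Indep-span ind (_ , _ , x) (_ , _ , y)

  -- The parallelism of `E²` is carried to an `E`-line by the coordinates of a basis `B`. Another
  -- basis may carry it to another parallelism, which is why colours refer to the canonical one.
  Located : Colour → V d × V d → V d → V d → Set
  Located δ B u w = ∃ λ p → ∃ λ r → u ≡ at B p × w ≡ at B r × InClass δ p r

  Basis : V d × V d → Set
  Basis (u , w) = Indep u w

  canonical-Basis : ∀ l → Basis l → Basis (canonical l)
  canonical-Basis l ind = let _ , (x , y) = canonical-SameSpan l in Indep-span ind x y

  located : ∀ {u w} B → Indep u w → SameSpan (u , w) B → ∃ λ δ → Located δ B u w
  located B ind (_ , (p₁ , p₂ , refl) , (r₁ , r₂ , refl)) =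
    let δ , cl = InClass-exists (p₁ , p₂) (r₁ , r₂) (at-det B {p₁ , p₂} {r₁ , r₂} ind)
    in δ , (p₁ , p₂) , (r₁ , r₂) , refl , refl , cl

  located-unique : ∀ {δ δ′ u w} B → Basis B → Indep u w → Located δ B u w → Located δ′ B u w → δ ≡ δ′
  located-unique {δ} {δ′} B basis ind (p , r , refl , refl , cl) (p′ , r′ , e , e′ , cl′) =
    InClass-unique δ δ′ {p} {r} (at-det B {p} {r} ind) cl
      (subst₂ (InClass δ′) (sym (at-injective B basis {p} {p′} e)) (sym (at-injective B basis {r} {r′} e′)) cl′)

  located-span : ∀ {δ u w u′ w′} B → Located δ B u w → InSpanF u′ u w → InSpanF w′ u w → Located δ B u′ w′
  located-span {δ} B (p , r , refl , refl , cl) (a , b , refl) (a′ , b′ , refl) =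
    combine a b p r , combine a′ b′ p r , at-combine B a b p r , at-combine B a′ b′ p r , InClass-combine δ {p} {r} a b a′ b′ cl

  located-proper : ∀ {δ u w w′} B → Basis B → Indep u w → Located δ B u w → Located δ B u w′ → InSpanF w′ u w
  located-proper {δ} B basis ind (p , r , refl , refl , cl) (p′ , r′ , e , refl , cl′) =
    let k , m , eq = InClass-proper δ {p} {r} {r′} (at-det B {p} {r} ind) cl
                       (subst (λ x → InClass δ x r′) (sym (at-injective B basis {p} {p′} e)) cl′)
    in k , m , trans (cong (at B) eq) (sym (at-combine B k m p r))

  located-covers : ∀ δ {u} B → Basis B → u ≢ zeroV → InSpan u (proj₁ B) (proj₂ B) →
                   ∃ λ w → Indep u w × InSpan w (proj₁ B) (proj₂ B) × Located δ B u w
  located-covers δ B@(e , f) basis u≢0 (p₁ , p₂ , refl) =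
    let r , D≢0 , cl = InClass-covers δ (p₁ , p₂) (λ z → u≢0 (trans (cong (at B) z) (comb-0-0 e f)))
    in at B r , at-Indep B basis (p₁ , p₂) r D≢0 , (proj₁ r , proj₂ r , refl) , (p₁ , p₂) , r , refl , refl , cl

  Colours : Set
  Colours = (C × Colour) ⊎ ⊤

  -- The decisions are arguments so that proofs can split on them. A zero `u` gets the extra colour
  -- as a default value that no line ever meets.
  colourWith : ∀ u w → Dec (u ≡ zeroV) → Dec (Dependent u w) → Colours
  colourWith u w (no u≢0) (no nd) = inj₁ (L.col u w , proj₁ (located (canonical (u , w)) (¬Dependent⇒Indep u≢0 nd) (canonical-SameSpan (u , w))))
  colourWith u w (no _) (yes _) = inj₂ tt
  colourWith u w (yes _) _ = inj₂ tt

  colour : V d → V d → Colours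
  colour u w = colourWith u w (u ≟ᵥ zeroV) (Dependent? u w)

  colour-dependent : ∀ u w → Dependent u w → colour u w ≡ inj₂ tt
  colour-dependent u w dep = go (u ≟ᵥ zeroV) (Dependent? u w)
    where
    go : ∀ d₁ d₂ → colourWith u w d₁ d₂ ≡ inj₂ tt
    go (yes _) _ = refl
    go (no _) (yes _) = refl
    go (no _) (no nd) = ⊥-elim (nd dep)

  colour-independent : ∀ u w → Indep u w → ∃ λ δ → colour u w ≡ inj₁ (L.col u w , δ) × Located δ (canonical (u , w)) u w
  colour-independent u w ind = go (u ≟ᵥ zeroV) (Dependent? u w)
    where
    go : ∀ d₁ d₂ → ∃ λ δ → colourWith u w d₁ d₂ ≡ inj₁ (L.col u w , δ) × Located δ (canonical (u , w)) u w
    go (yes u≡0) _ = ⊥-elim (Indep-left ind u≡0)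
    go (no _) (yes dep) = ⊥-elim (Indep⇒¬Dependent ind dep)
    go (no u≢0) (no nd) = _ , refl , proj₂ (located (canonical (u , w)) (¬Dependent⇒Indep u≢0 nd) (canonical-SameSpan (u , w)))

  colour-located : ∀ {u w} B δ → canonical (u , w) ≡ B → Indep u w → Located δ B u w → colour u w ≡ inj₁ (L.col u w , δ)
  colour-located {u} {w} B δ refl ind loc =
    let δ′ , e , loc′ = colour-independent u w ind
    in trans e (cong (λ x → inj₁ (L.col u w , x)) (located-unique {δ′} {δ} B (canonical-Basis (u , w) ind) ind loc′ loc))

  -- Each class is a spread of the `E`-line, so it has a line through `u`. Through this,
  -- completeness passes from `E` to `F` at the same vector.
  pick : ∀ {u e} δ → Indep u e → ∃ λ w → Indep u w × colour u w ≡ inj₁ (L.col u e , δ)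
  pick {u} {e} δ ind =
    let B = canonical (u , e)
        to-B , u∈B , e∈B = canonical-SameSpan (u , e)
        w , ind′ , w∈B , loc = located-covers δ B (canonical-Basis (u , e) ind) (Indep-left ind) u∈B
        w∈ = span-trans w∈B (proj₁ to-B) (proj₂ to-B)
        same = sameSpan {u = u} {e} {u} {w} ind′ (span-left u e) w∈
    in w , ind′ , trans (colour-located B δ (sym (canonical-cong same)) ind′ loc)
                        (cong (λ c → inj₁ (c , δ)) (L.col-span ind ind′ (span-left u e) w∈))

  IndepF : V d → V d → Set
  IndepF u w = ∀ a b → comb (ι a) (ι b) u w ≡ zeroV → (a ≡ F.0#) × (b ≡ F.0#)

  Indep⇒IndepF : ∀ {u w} → Indep u w → IndepF u w
  Indep⇒IndepF ind a b e = let x , y = ind (ι a) (ι b) e in ι-injective (trans x (sym ι-0)) , ι-injective (trans y (sym ι-0))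

  -- The two vectors span the `E`-point of `u`, the line of the extra colour through `u`.
  ω-IndepF : ∀ {u} → u ≢ zeroV → IndepF u (scale ω u)
  ω-IndepF {u} u≢0 a b e =
    let z = scale≡zero u≢0 (trans (sym (comb-scale (ι a) (ι b) ω u)) e)
    in trans (sym (π₀-compose a b)) (trans (cong π₀ z) π₀-0) , trans (sym (π₁-compose a b)) (trans (cong π₁ z) π₁-0)

  colour-span : ∀ {u w u′ w′} → u ≢ zeroV → u′ ≢ zeroV → InSpanF u′ u w → InSpanF w′ u w → InSpanF u u′ w′ → InSpanF w u′ w′ →
                colour u′ w′ ≡ colour u w
  colour-span {u} {w} {u′} {w′} u≢0 u′≢0 u′∈ w′∈ u∈ w∈ = go (Dependent? u w) (Dependent? u′ w′)
    where
    go : Dec (Dependent u w) → Dec (Dependent u′ w′) → colour u′ w′ ≡ colour u w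
    go (yes dep) (yes dep′) = trans (colour-dependent u′ w′ dep′) (sym (colour-dependent u w dep))
    go (yes dep) (no nd′) = ⊥-elim (Indep⇒¬Dependent (Indep-span (¬Dependent⇒Indep u′≢0 nd′) (InSpanF⇒InSpan u′∈) (InSpanF⇒InSpan w′∈)) dep)
    go (no nd) (yes dep′) = ⊥-elim (Indep⇒¬Dependent (Indep-span (¬Dependent⇒Indep u≢0 nd) (InSpanF⇒InSpan u∈) (InSpanF⇒InSpan w∈)) dep′)
    go (no nd) (no nd′) =
      let ind = ¬Dependent⇒Indep u≢0 nd
          ind′ = ¬Dependent⇒Indep u′≢0 nd′
          δ , e , loc = colour-independent u w ind
          same = canonical-cong {l = u′ , w′} {m = u , w} ((InSpanF⇒InSpan u∈ , InSpanF⇒InSpan w∈) , (InSpanF⇒InSpan u′∈ , InSpanF⇒InSpan w′∈))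
      in trans (colour-located (canonical (u , w)) δ same ind′ (located-span {δ} (canonical (u , w)) loc u′∈ w′∈))
               (trans (cong (λ c → inj₁ (c , δ)) (L.col-span ind ind′ (InSpanF⇒InSpan u′∈) (InSpanF⇒InSpan w′∈))) (sym e))

  colour-proper : ∀ {u w w′} → u ≢ zeroV → ¬ (∃ λ k → w ≡ scale (ι k) u) → colour u w ≡ colour u w′ → InSpanF w′ u w
  colour-proper {u} {w} {w′} u≢0 ¬F e = go (Dependent? u w) (Dependent? u w′)
    where
    go : Dec (Dependent u w) → Dec (Dependent u w′) → InSpanF w′ u w
    -- Both lines fill the `E`-point of `u`, which is one `F`-line: 1 and `x` form a basis of `E`
    -- over `F`, and `x′` is expressed in it.
    go (yes (x , eq)) (yes (x′ , eq′)) =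
      let a , b , z = cramer (ι F.1#) x x′ D≢0
      in a , b , (begin
        w′ ≡⟨ eq′ ⟩
        scale x′ u ≡⟨ cong (λ y → scale y u) (trans z (cong (_+ ι b * x) (trans (cong (ι a *_) ι-1) (*-identityʳ _)))) ⟩
        scale (ι a + ι b * x) u ≡⟨ comb-scale _ _ x u ⟨
        comb (ι a) (ι b) u (scale x u) ≡⟨ cong (comb (ι a) (ι b) u) eq ⟨
        comb (ι a) (ι b) u w ∎)
      where
      open ≡-Reasoning
      D≢0 : detF (ι F.1#) x ≢ F.0#
      D≢0 z = ¬F (π₀ x , trans eq (cong (λ y → scale y u) (π₁≡0⇒ι (trans
        (F.Solver.solve 2 (λ a b → a F.Solver.:= F.:1 F.Solver.:* a F.Solver.:+ F.Solver.:- (F.:0 F.Solver.:* b)) refl (π₁ x) (π₀ x))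
        (trans (cong₂ (λ p r → p F.* π₁ x F.+ F.- (r F.* π₀ x)) (sym (π₀-ι F.1#)) (sym (π₁-ι F.1#))) z)))))
    go (yes dep) (no nd′) with () ← trans (sym (colour-dependent u w dep)) (trans e (proj₁ (proj₂ (colour-independent u w′ (¬Dependent⇒Indep u≢0 nd′)))))
    go (no nd) (yes dep′) with () ← trans (sym (colour-dependent u w′ dep′)) (trans (sym e) (proj₁ (proj₂ (colour-independent u w (¬Dependent⇒Indep u≢0 nd)))))
    -- The old colours put both lines into one `E`-line, hence into the same canonical coordinates;
    -- the equal classes then leave a single spread line through `u`.
    go (no nd) (no nd′) =
      let ind = ¬Dependent⇒Indep u≢0 nd
          ind′ = ¬Dependent⇒Indep u≢0 nd′
          δ , eq , loc = colour-independent u w ind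
          δ′ , eq′ , loc′ = colour-independent u w′ ind′
          same-colour = inj₁-injective (trans (sym eq) (trans e eq′))
          w′∈ = L.proper ind ind′ (,-injectiveˡ same-colour)
          B≡ = canonical-cong {l = u , w′} {m = u , w} (SameSpan-sym {l = u , w} {u , w′} (sameSpan ind′ (span-left u w) w′∈))
      in located-proper {δ} (canonical (u , w)) (canonical-Basis (u , w) ind) ind loc
           (subst₂ (λ x B → Located x B u w′) (sym (,-injectiveʳ same-colour)) B≡ loc′)

  doubled : LineColouring F (d ℕ.+ d) Colours
  doubled = record
    { col = λ x y → colour (unflatten d x) (unflatten d y)
    ; col-span = λ ind ind′ x′∈ y′∈ → let x∈ , y∈ = VF.exchange ind′ x′∈ y′∈ in
        colour-span (unflatten-≢0 d (VF.Indep-left ind)) (unflatten-≢0 d (VF.Indep-left ind′))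
          (unflatten-InSpan d x′∈) (unflatten-InSpan d y′∈) (unflatten-InSpan d x∈) (unflatten-InSpan d y∈)
    ; proper = λ {x} {y} {z} ind ind′ e → unflatten-InSpan⁻¹ d (colour-proper (unflatten-≢0 d (VF.Indep-left ind))
        (λ { (k , eq) → VF.Indep⇒¬Dependent ind (k , unflatten-injective d (trans eq (sym (begin
             unflatten d (VF.scale k x) ≡⟨ cong (unflatten d) (VF.scale-as-comb k x x) ⟩
             unflatten d (VF.comb k F.0# x x) ≡⟨ unflatten-comb d k F.0# x x ⟩
             comb (ι k) (ι F.0#) (unflatten d x) (unflatten d x) ≡⟨ cong (λ a → comb (ι k) a (unflatten d x) (unflatten d x)) ι-0 ⟩
             comb (ι k) 0# (unflatten d x) (unflatten d x) ≡⟨ scale-as-comb (ι k) _ _ ⟨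
             scale (ι k) (unflatten d x) ∎)))) })
        e)
    ; complete = complete
    }
    where
    open ≡-Reasoning
    Meet : Colours → Colours → Set
    Meet c c′ = ∃ λ x → ∃ λ y → ∃ λ z → VF.Indep x y × VF.Indep x z ×
      colour (unflatten d x) (unflatten d y) ≡ c × colour (unflatten d x) (unflatten d z) ≡ c′
    meet : ∀ {c c′} u w w′ → IndepF u w → IndepF u w′ → colour u w ≡ c → colour u w′ ≡ c′ → Meet c c′
    meet u w w′ ind ind′ e e′ = flatten u , flatten w , flatten w′ , flatten-Indep ind , flatten-Indep ind′ ,
      trans (cong₂ colour (unflatten-flatten u) (unflatten-flatten w)) e ,
      trans (cong₂ colour (unflatten-flatten u) (unflatten-flatten w′)) e′
    complete : ∀ c c′ → Meet c c′
    complete (inj₁ (c , δ)) (inj₁ (c′ , δ′)) =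
      let u , e , e′ , ind , ind′ , eq , eq′ = L.complete c c′
          w , i , z = pick δ ind
          w′ , i′ , z′ = pick δ′ ind′
      in meet u w w′ (Indep⇒IndepF i) (Indep⇒IndepF i′) (trans z (cong (λ x → inj₁ (x , δ)) eq)) (trans z′ (cong (λ x → inj₁ (x , δ′)) eq′))
    complete (inj₁ (c , δ)) (inj₂ tt) =
      -- Called with equal colours, this just supplies a line of colour `c`.
      let u , e , e′ , ind , ind′ , eq , eq′ = L.complete c c
          w , i , z = pick δ ind
      in meet u w (scale ω u) (Indep⇒IndepF i) (ω-IndepF (Indep-left ind)) (trans z (cong (λ x → inj₁ (x , δ)) eq)) (colour-dependent _ _ (ω , refl))
    complete (inj₂ tt) (inj₁ (c , δ)) =
      let u , e , e′ , ind , ind′ , eq , eq′ = L.complete c c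
          w , i , z = pick δ ind
      in meet u (scale ω u) w (ω-IndepF (Indep-left ind)) (Indep⇒IndepF i) (colour-dependent _ _ (ω , refl)) (trans z (cong (λ x → inj₁ (x , δ)) eq))
    complete (inj₂ tt) (inj₂ tt) =
      -- `c₀` is there to supply some nonzero vector `u`.
      let u , e , e′ , ind , ind′ , eq , eq′ = L.complete c₀ c₀
      in meet u (scale ω u) (scale ω u) (ω-IndepF (Indep-left ind)) (ω-IndepF (Indep-left ind)) (colour-dependent _ _ (ω , refl)) (colour-dependent _ _ (ω , refl))

-- Projective points and the projective plane

numPoints-suc : ∀ q n → numPoints q (suc n) ≡ q ℕ.^ suc n ℕ.+ numPoints q n
numPoints-suc q n = begin
  sum (List.map (q ℕ.^_) (upTo (suc (suc n)))) ≡⟨ cong (λ l → sum (List.map (q ℕ.^_) l)) (Listₚ.upTo-∷ʳ (suc n)) ⟨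
  sum (List.map (q ℕ.^_) (upTo (suc n) List.++ List.[ suc n ])) ≡⟨ cong sum (Listₚ.map-++ (q ℕ.^_) (upTo (suc n)) List.[ suc n ]) ⟩
  sum (List.map (q ℕ.^_) (upTo (suc n)) List.++ List.[ q ℕ.^ suc n ]) ≡⟨ sum-++ (List.map (q ℕ.^_) (upTo (suc n))) _ ⟩
  numPoints q n ℕ.+ (q ℕ.^ suc n ℕ.+ 0) ≡⟨ cong (numPoints q n ℕ.+_) (ℕₚ.+-identityʳ _) ⟩
  numPoints q n ℕ.+ q ℕ.^ suc n ≡⟨ ℕₚ.+-comm _ (q ℕ.^ suc n) ⟩
  q ℕ.^ suc n ℕ.+ numPoints q n ∎
  where open ≡-Reasoning

-- The lines through a point are the points of a space of one dimension less, so this is v = 1 + q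
-- r.
numPoints-horner : ∀ q n → numPoints q (suc n) ≡ suc (q ℕ.* numPoints q n)
numPoints-horner q zero = cong suc (ℕₚ.+-identityʳ (q ℕ.* 1))
numPoints-horner q (suc n) = begin
  numPoints q (suc (suc n)) ≡⟨ numPoints-suc q (suc n) ⟩
  q ℕ.* q ℕ.^ suc n ℕ.+ numPoints q (suc n) ≡⟨ cong (q ℕ.* q ℕ.^ suc n ℕ.+_) (numPoints-horner q n) ⟩
  q ℕ.* q ℕ.^ suc n ℕ.+ suc (q ℕ.* numPoints q n) ≡⟨ ℕₚ.+-suc _ _ ⟩
  suc (q ℕ.* q ℕ.^ suc n ℕ.+ q ℕ.* numPoints q n) ≡⟨ cong suc (ℕₚ.*-distribˡ-+ q _ _) ⟨
  suc (q ℕ.* (q ℕ.^ suc n ℕ.+ numPoints q n)) ≡⟨ cong (λ x → suc (q ℕ.* x)) (numPoints-suc q n) ⟨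
  suc (q ℕ.* numPoints q (suc n)) ∎
  where open ≡-Reasoning

module Points {q : ℕ} (K : FField q) where
  open FieldTheory K
  open Vectors K
  open Solver using (solve; _:=_; _:*_; _:+_; :-_)

  -- Projective points, as nonzero vectors whose first nonzero coordinate is 1.
  Point : ℕ → Set
  Point zero = ⊤
  Point (suc n) = V (suc n) ⊎ Point n

  vec : ∀ {n} → Point n → V (suc n)
  vec {zero} _ = 1# ∷ []
  vec {suc n} (inj₁ u) = 1# ∷ u
  vec {suc n} (inj₂ p) = 0# ∷ vec p

  vec≢0 : ∀ {n} (p : Point n) → vec p ≢ zeroV
  vec≢0 {zero} _ e = 1≢0 (Vecₚ.∷-injectiveˡ e)
  vec≢0 {suc n} (inj₁ u) e = 1≢0 (Vecₚ.∷-injectiveˡ e)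
  vec≢0 {suc n} (inj₂ p) e = vec≢0 p (Vecₚ.∷-injectiveʳ e)

  point : ∀ {n} → V (suc n) → Point n
  pointWith : ∀ {n} x → V (suc n) → Dec (x ≡ 0#) → Point (suc n)
  point {zero} _ = tt
  point {suc n} (x ∷ u) = pointWith x u (x ≟ 0#)
  pointWith x u (yes _) = inj₂ (point u)
  pointWith x u (no _) = inj₁ (scale (x ⁻¹) u)

  point-vec : ∀ {n} (u : V (suc n)) → u ≢ zeroV → ∃ λ ρ → ρ ≢ 0# × u ≡ scale ρ (vec (point u))
  point-vec {zero} (x ∷ []) ne = x , (λ { refl → ne refl }) , cong (_∷ []) (sym (*-identityʳ x))
  point-vec {suc n} (x ∷ u) ne = go (x ≟ 0#)
    where
    go : (d : Dec (x ≡ 0#)) → ∃ λ ρ → ρ ≢ 0# × x ∷ u ≡ scale ρ (vec (pointWith x u d))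
    go (yes refl) = let ρ , ρ≢0 , e = point-vec u (λ z → ne (cong (0# ∷_) z)) in ρ , ρ≢0 , cong₂ _∷_ (sym (zeroʳ ρ)) e
    go (no x≢0) = x , x≢0 , cong₂ _∷_ (sym (*-identityʳ x))
      (sym (trans (scale-scale x (x ⁻¹) u) (trans (cong (λ y → scale y u) (*-inverseʳ x≢0)) (scale-1 u))))

  vec-unique : ∀ {n} (p p′ : Point n) ρ → vec p ≡ scale ρ (vec p′) → p ≡ p′
  vec-unique {zero} tt tt ρ e = refl
  vec-unique {suc n} (inj₁ u) (inj₁ u′) ρ e = cong inj₁ (trans (Vecₚ.∷-injectiveʳ e)
    (trans (cong (λ r → scale r u′) (sym (trans (Vecₚ.∷-injectiveˡ e) (*-identityʳ ρ)))) (scale-1 u′)))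
  vec-unique {suc n} (inj₁ u) (inj₂ p′) ρ e = ⊥-elim (1≢0 (trans (Vecₚ.∷-injectiveˡ e) (zeroʳ ρ)))
  vec-unique {suc n} (inj₂ p) (inj₁ u′) ρ e = ⊥-elim (vec≢0 p (trans (Vecₚ.∷-injectiveʳ e)
    (trans (cong (λ r → scale r u′) (sym (trans (Vecₚ.∷-injectiveˡ e) (*-identityʳ ρ)))) (scale-0 u′))))
  vec-unique {suc n} (inj₂ p) (inj₂ p′) ρ e = cong inj₂ (vec-unique p p′ ρ (Vecₚ.∷-injectiveʳ e))

  scale-inverse : ∀ {d ρ} {u w : V d} → ρ ≢ 0# → u ≡ scale ρ w → w ≡ scale (ρ ⁻¹) u
  scale-inverse {ρ = ρ} {w = w} ρ≢0 refl = sym (trans (scale-scale (ρ ⁻¹) ρ w) (trans (cong (λ y → scale y w) (*-inverseˡ ρ≢0)) (scale-1 w)))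

  point-unique : ∀ {n} {u : V (suc n)} {p ρ} → u ≢ zeroV → u ≡ scale ρ (vec p) → point u ≡ p
  point-unique {u = u} {p} {ρ} ne e =
    let σ , σ≢0 , e′ = point-vec u ne
    in vec-unique (point u) p (σ ⁻¹ * ρ) (trans (scale-inverse σ≢0 e′) (trans (cong (scale (σ ⁻¹)) e) (scale-scale _ _ (vec p))))

  point-≡ : ∀ {n} {u w : V (suc n)} → u ≢ zeroV → w ≢ zeroV → point u ≡ point w → ∃ λ ρ → w ≡ scale ρ u
  point-≡ {u = u} {w} u≢0 w≢0 e =
    let σ , σ≢0 , eu = point-vec u u≢0
        τ , τ≢0 , ew = point-vec w w≢0
    in τ * σ ⁻¹ , trans ew (trans (cong (scale τ) (trans (cong vec (sym e)) (scale-inverse σ≢0 eu))) (scale-scale _ _ u))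

  vectors↔ : ∀ n → V n ↔ Fin (q ℕ.^ n)
  vectors↔ zero = Symm.↔-sym Finₚ.1↔⊤ ↔-∘ mk↔ₛ′ (λ _ → tt) (λ _ → []) (λ _ → refl) (λ { [] → refl })
  vectors↔ (suc n) = Symm.↔-sym Finₚ.*↔× ↔-∘ ((finite ×-↔ vectors↔ n) ↔-∘
    mk↔ₛ′ (λ { (x ∷ u) → x , u }) (λ { (x , u) → x ∷ u }) (λ { (_ , _) → refl }) (λ { (_ ∷ _) → refl }))

  points↔ : ∀ n → Point n ↔ Fin (numPoints q n)
  points↔ zero = Symm.↔-sym Finₚ.1↔⊤
  points↔ (suc n) = subst (λ k → Point (suc n) ↔ Fin k) (sym (numPoints-suc q n))
    (Symm.↔-sym Finₚ.+↔⊎ ↔-∘ (vectors↔ (suc n) ⊎-↔ points↔ n))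

  -- Reduction modulo p: the pivot coordinate of p is eliminated.
  quotient : ∀ {n} → Point n → V (suc n) → V n
  quotient {zero} _ _ = []
  quotient {suc n} (inj₁ u) (x ∷ w) = comb 1# (- x) w u
  quotient {suc n} (inj₂ p) (x ∷ w) = x ∷ quotient p w

  quotient-comb : ∀ {n} (p : Point n) a b u w → quotient p (comb a b u w) ≡ comb a b (quotient p u) (quotient p w)
  quotient-comb {zero} _ a b u w = refl
  quotient-comb {suc n} (inj₁ v) a b (x ∷ u) (y ∷ w) = go u w v
    where
    go : ∀ {d} (u w v : V d) → comb 1# (- (a * x + b * y)) (comb a b u w) v ≡ comb a b (comb 1# (- x) u v) (comb 1# (- y) w v)
    go [] [] [] = refl
    go (p ∷ u) (r ∷ w) (s ∷ v) = cong₂ _∷_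
      (solve 7 (λ a b x y p r s → :1 :* (a :* p :+ b :* r) :+ :- (a :* x :+ b :* y) :* s
        := a :* (:1 :* p :+ :- x :* s) :+ b :* (:1 :* r :+ :- y :* s)) refl a b x y p r s) (go u w v)
  quotient-comb {suc n} (inj₂ p) a b (x ∷ u) (y ∷ w) = cong (_ ∷_) (quotient-comb p a b u w)

  quotient-kernel : ∀ {n} (p : Point n) w → quotient p w ≡ zeroV → ∃ λ τ → w ≡ scale τ (vec p)
  quotient-kernel {zero} _ (x ∷ []) e = x , cong (_∷ []) (sym (*-identityʳ x))
  quotient-kernel {suc n} (inj₁ v) (x ∷ w) e = x , cong₂ _∷_ (sym (*-identityʳ x)) (go w v e)
    where
    go : ∀ {d} (w v : V d) → comb 1# (- x) w v ≡ zeroV → w ≡ scale x v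
    go [] [] _ = refl
    go (y ∷ w) (s ∷ v) e = cong₂ _∷_
      (combine₁ 1# (Vecₚ.∷-injectiveˡ e) (solve 3 (λ x y s → y :+ :- (x :* s) := :1 :* (:1 :* y :+ :- x :* s :+ :- :0)) refl x y s))
      (go w v (Vecₚ.∷-injectiveʳ e))
  quotient-kernel {suc n} (inj₂ p) (x ∷ w) e =
    let τ , e′ = quotient-kernel p w (Vecₚ.∷-injectiveʳ e)
    in τ , cong₂ _∷_ (trans (Vecₚ.∷-injectiveˡ e) (sym (zeroʳ τ))) e′

  -- The line spanned by x and w, as a point of the quotient by x.
  direction : ∀ {n} → V (suc (suc n)) → V (suc (suc n)) → Point n
  direction x w = point (quotient (point x) w)

  quotient≢0 : ∀ {n} {x w : V (suc (suc n))} → Indep x w → quotient (point x) w ≢ zeroV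
  quotient≢0 {n} {x} {w} ind e =
    let τ , w≡ = quotient-kernel (point x) w e
        ρ , ρ≢0 , x≡ = point-vec x (Indep-left ind)
    in Indep⇒¬Dependent ind (τ * ρ ⁻¹ , trans w≡ (trans (cong (scale τ) (scale-inverse ρ≢0 x≡)) (scale-scale _ _ x)))

  -- In the quotient by the common point, `v` becomes a multiple ρ of `w`; so v - ρ w lies in the
  -- kernel, which is that point.
  direction-≡ : ∀ {n} {x w y v : V (suc (suc n))} → Indep x w → Indep y v →
                point x ≡ point y → direction x w ≡ direction y v → SameSpan (x , w) (y , v)
  direction-≡ {n} {x} {w} {y} {v} ind ind′ e e′ = sameSpan ind′ y∈ v∈
    where
    open ≡-Reasoning
    p = point x
    quotients : ∃ λ ρ → quotient p v ≡ scale ρ (quotient p w)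
    quotients = point-≡ (quotient≢0 ind) (subst (λ r → quotient r v ≢ zeroV) (sym e) (quotient≢0 ind′))
                  (trans e′ (cong (λ r → point (quotient r v)) (sym e)))
    ρ = proj₁ quotients
    kernel : ∃ λ τ → comb 1# (- ρ) v w ≡ scale τ (vec p)
    kernel = quotient-kernel p (comb 1# (- ρ) v w) (begin
      quotient p (comb 1# (- ρ) v w) ≡⟨ quotient-comb p 1# (- ρ) v w ⟩
      comb 1# (- ρ) (quotient p v) (quotient p w) ≡⟨ comb-swap 1# (- ρ) (quotient p v) (quotient p w) ⟩
      comb (- ρ) 1# (quotient p w) (quotient p v) ≡⟨ cong (comb (- ρ) 1# (quotient p w)) (proj₂ quotients) ⟩
      comb (- ρ) 1# (quotient p w) (scale ρ (quotient p w)) ≡⟨ comb-scale (- ρ) 1# ρ (quotient p w) ⟩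
      scale (- ρ + 1# * ρ) (quotient p w) ≡⟨ cong (λ a → scale a (quotient p w)) (solve 1 (λ r → :- r :+ :1 :* r := :0) refl ρ) ⟩
      scale 0# (quotient p w) ≡⟨ scale-0 _ ⟩
      zeroV ∎)
    y∈ : InSpan y x w
    y∈ = let σ , e″ = point-≡ (Indep-left ind) (Indep-left ind′) e in σ , 0# , trans e″ (scale-as-comb σ x w)
    vecp∈ : InSpan (vec p) x w
    vecp∈ = let σ , σ≢0 , e″ = point-vec x (Indep-left ind) in σ ⁻¹ , 0# , trans (scale-inverse σ≢0 e″) (scale-as-comb (σ ⁻¹) x w)
    v∈ : InSpan v x w
    v∈ = span-trans {x = v} {u = comb 1# (- ρ) v w} {w = w}
           (1# , ρ , sym (begin
              comb 1# ρ (comb 1# (- ρ) v w) w ≡⟨ cong (comb 1# ρ (comb 1# (- ρ) v w)) (comb-0-1 v w) ⟨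
              comb 1# ρ (comb 1# (- ρ) v w) (comb 0# 1# v w) ≡⟨ comb-comb 1# ρ 1# (- ρ) 0# 1# v w ⟩
              comb (1# * 1# + ρ * 0#) (1# * - ρ + ρ * 1#) v w ≡⟨ cong₂ (λ a b → comb a b v w) (solve 1 (λ r → :1 :* :1 :+ r :* :0 := :1) refl ρ) (solve 1 (λ r → :1 :* :- r :+ r :* :1 := :0) refl ρ) ⟩
              comb 1# 0# v w ≡⟨ comb-1-0 v w ⟩
              v ∎))
           (span-trans {u = vec p} {w = vec p} (proj₁ kernel , 0# , trans (proj₂ kernel) (scale-as-comb _ _ _)) vecp∈ vecp∈)
           (span-right x w)

  -- The dual coordinates of the line spanned by two vectors of the plane.
  cross : V 3 → V 3 → V 3
  cross (x₁ ∷ x₂ ∷ x₃ ∷ []) (y₁ ∷ y₂ ∷ y₃ ∷ []) =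
    (x₂ * y₃ + - (x₃ * y₂)) ∷ (x₃ * y₁ + - (x₁ * y₃)) ∷ (x₁ * y₂ + - (x₂ * y₁)) ∷ []

  dot : V 3 → V 3 → Carrier
  dot (x₁ ∷ x₂ ∷ x₃ ∷ []) (y₁ ∷ y₂ ∷ y₃ ∷ []) = x₁ * y₁ + x₂ * y₂ + x₃ * y₃

  ∷-cong : ∀ {x₁ x₂ x₃ y₁ y₂ y₃ : Carrier} → x₁ ≡ y₁ → x₂ ≡ y₂ → x₃ ≡ y₃ → _≡_ {A = V 3} (x₁ ∷ x₂ ∷ x₃ ∷ []) (y₁ ∷ y₂ ∷ y₃ ∷ [])
  ∷-cong refl refl refl = refl

  cross-comb : ∀ p r p′ r′ (u w : V 3) → cross (comb p r u w) (comb p′ r′ u w) ≡ scale (p * r′ + - (r * p′)) (cross u w)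
  cross-comb p r p′ r′ (x₁ ∷ x₂ ∷ x₃ ∷ []) (y₁ ∷ y₂ ∷ y₃ ∷ []) = ∷-cong (minor x₂ x₃ y₂ y₃) (minor x₃ x₁ y₃ y₁) (minor x₁ x₂ y₁ y₂)
    where
    minor : ∀ x x′ y y′ → (p * x + r * y) * (p′ * x′ + r′ * y′) + - ((p * x′ + r * y′) * (p′ * x + r′ * y))
            ≡ (p * r′ + - (r * p′)) * (x * y′ + - (x′ * y))
    minor = solve 8 (λ p r p′ r′ x x′ y y′ → (p :* x :+ r :* y) :* (p′ :* x′ :+ r′ :* y′) :+ :- ((p :* x′ :+ r :* y′) :* (p′ :* x :+ r′ :* y))
            := (p :* r′ :+ :- (r :* p′)) :* (x :* y′ :+ :- (x′ :* y))) refl p r p′ r′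

  ∷-injective₃ : ∀ {x₁ x₂ x₃ y₁ y₂ y₃ : Carrier} → _≡_ {A = V 3} (x₁ ∷ x₂ ∷ x₃ ∷ []) (y₁ ∷ y₂ ∷ y₃ ∷ []) → x₁ ≡ y₁ × x₂ ≡ y₂ × x₃ ≡ y₃
  ∷-injective₃ refl = refl , refl , refl

  nonzero-coordinate : ∀ {x₁ x₂ x₃} → _≢_ {A = V 3} (x₁ ∷ x₂ ∷ x₃ ∷ []) zeroV → x₁ ≢ 0# ⊎ x₂ ≢ 0# ⊎ x₃ ≢ 0#
  nonzero-coordinate {x₁} {x₂} {x₃} ne with x₁ ≟ 0# | x₂ ≟ 0# | x₃ ≟ 0#
  ... | no p | _ | _ = inj₁ p
  ... | yes _ | no p | _ = inj₂ (inj₁ p)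
  ... | yes _ | yes _ | no p = inj₂ (inj₂ p)
  ... | yes refl | yes refl | yes refl = ⊥-elim (ne refl)

  -- From u × (m × e) = (u · e) m - (u · m) e, a unit vector `e` at a nonzero coordinate of `u`
  -- gives the solution m × e divided by that coordinate. The Euclidean choice e = u would fail when
  -- u · u = 0.
  cross-solve : ∀ u m → u ≢ zeroV → dot u m ≡ 0# → ∃ λ w → cross u w ≡ m
  cross-solve (x₁ ∷ x₂ ∷ x₃ ∷ []) (m₁ ∷ m₂ ∷ m₃ ∷ []) u≢0 e with nonzero-coordinate u≢0
  ... | inj₁ ne = (0# ∷ m₃ * j ∷ - (m₂ * j) ∷ []) , ∷-cong
      (combine₂ (- j) m₁ e (*-inverseʳ ne) (solve 7 (λ x y z a b c j → y :* :- (b :* j) :+ :- (z :* (c :* j)) :+ :- a := :- j :* (x :* a :+ y :* b :+ z :* c :+ :- :0) :+ a :* (x :* j :+ :- :1)) refl x₁ x₂ x₃ m₁ m₂ m₃ j))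
      (combine₁ m₂ (*-inverseʳ ne) (solve 4 (λ x z b j → z :* :0 :+ :- (x :* :- (b :* j)) :+ :- b := b :* (x :* j :+ :- :1)) refl x₁ x₃ m₂ j))
      (combine₁ m₃ (*-inverseʳ ne) (solve 4 (λ x y c j → x :* (c :* j) :+ :- (y :* :0) :+ :- c := c :* (x :* j :+ :- :1)) refl x₁ x₂ m₃ j))
    where j = x₁ ⁻¹
  ... | inj₂ (inj₁ ne) = (- (m₃ * j) ∷ 0# ∷ m₁ * j ∷ []) , ∷-cong
      (combine₁ m₁ (*-inverseʳ ne) (solve 4 (λ y z a j → y :* (a :* j) :+ :- (z :* :0) :+ :- a := a :* (y :* j :+ :- :1)) refl x₂ x₃ m₁ j))
      (combine₂ (- j) m₂ e (*-inverseʳ ne) (solve 7 (λ x y z a b c j → z :* :- (c :* j) :+ :- (x :* (a :* j)) :+ :- b := :- j :* (x :* a :+ y :* b :+ z :* c :+ :- :0) :+ b :* (y :* j :+ :- :1)) refl x₁ x₂ x₃ m₁ m₂ m₃ j))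
      (combine₁ m₃ (*-inverseʳ ne) (solve 4 (λ x y c j → x :* :0 :+ :- (y :* :- (c :* j)) :+ :- c := c :* (y :* j :+ :- :1)) refl x₁ x₂ m₃ j))
    where j = x₂ ⁻¹
  ... | inj₂ (inj₂ ne) = (m₂ * j ∷ - (m₁ * j) ∷ 0# ∷ []) , ∷-cong
      (combine₁ m₁ (*-inverseʳ ne) (solve 4 (λ y z a j → y :* :0 :+ :- (z :* :- (a :* j)) :+ :- a := a :* (z :* j :+ :- :1)) refl x₂ x₃ m₁ j))
      (combine₁ m₂ (*-inverseʳ ne) (solve 4 (λ x z b j → z :* (b :* j) :+ :- (x :* :0) :+ :- b := b :* (z :* j :+ :- :1)) refl x₁ x₃ m₂ j))
      (combine₂ (- j) m₃ e (*-inverseʳ ne) (solve 7 (λ x y z a b c j → x :* :- (a :* j) :+ :- (y :* (b :* j)) :+ :- c := :- j :* (x :* a :+ y :* b :+ z :* c :+ :- :0) :+ c :* (z :* j :+ :- :1)) refl x₁ x₂ x₃ m₁ m₂ m₃ j))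
    where j = x₃ ⁻¹

  cross-dependent : ∀ u w → u ≢ zeroV → cross u w ≡ zeroV → Dependent u w
  cross-dependent (x₁ ∷ x₂ ∷ x₃ ∷ []) (y₁ ∷ y₂ ∷ y₃ ∷ []) u≢0 e with ∷-injective₃ e | nonzero-coordinate u≢0
  ... | e₁ , e₂ , e₃ | inj₁ ne = y₁ * x₁ ⁻¹ , ∷-cong (pivot y₁ ne)
      (combine₂ (- y₂) (x₁ ⁻¹) (*-inverseʳ ne) e₃ (solve 5 (λ x y a b j → b :+ :- (a :* j :* y) := :- b :* (x :* j :+ :- :1) :+ j :* (x :* b :+ :- (y :* a) :+ :- :0)) refl x₁ x₂ y₁ y₂ (x₁ ⁻¹)))
      (combine₂ (- y₃) (- x₁ ⁻¹) (*-inverseʳ ne) e₂ (solve 5 (λ x z a c j → c :+ :- (a :* j :* z) := :- c :* (x :* j :+ :- :1) :+ :- j :* (z :* a :+ :- (x :* c) :+ :- :0)) refl x₁ x₃ y₁ y₃ (x₁ ⁻¹)))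
    where
    pivot : ∀ {x} y → x ≢ 0# → y ≡ y * x ⁻¹ * x
    pivot {x} y ne = combine₁ (- y) (*-inverseʳ ne) (solve 3 (λ x y j → y :+ :- (y :* j :* x) := :- y :* (x :* j :+ :- :1)) refl x y (x ⁻¹))
  ... | e₁ , e₂ , e₃ | inj₂ (inj₁ ne) = y₂ * x₂ ⁻¹ , ∷-cong
      (combine₂ (- y₁) (- x₂ ⁻¹) (*-inverseʳ ne) e₃ (solve 5 (λ x y a b j → a :+ :- (b :* j :* x) := :- a :* (y :* j :+ :- :1) :+ :- j :* (x :* b :+ :- (y :* a) :+ :- :0)) refl x₁ x₂ y₁ y₂ (x₂ ⁻¹)))
      (combine₁ (- y₂) (*-inverseʳ ne) (solve 3 (λ x y j → y :+ :- (y :* j :* x) := :- y :* (x :* j :+ :- :1)) refl x₂ y₂ (x₂ ⁻¹)))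
      (combine₂ (- y₃) (x₂ ⁻¹) (*-inverseʳ ne) e₁ (solve 5 (λ y z b c j → c :+ :- (b :* j :* z) := :- c :* (y :* j :+ :- :1) :+ j :* (y :* c :+ :- (z :* b) :+ :- :0)) refl x₂ x₃ y₂ y₃ (x₂ ⁻¹)))
  ... | e₁ , e₂ , e₃ | inj₂ (inj₂ ne) = y₃ * x₃ ⁻¹ , ∷-cong
      (combine₂ (- y₁) (x₃ ⁻¹) (*-inverseʳ ne) e₂ (solve 5 (λ x z a c j → a :+ :- (c :* j :* x) := :- a :* (z :* j :+ :- :1) :+ j :* (z :* a :+ :- (x :* c) :+ :- :0)) refl x₁ x₃ y₁ y₃ (x₃ ⁻¹)))
      (combine₂ (- y₂) (- x₃ ⁻¹) (*-inverseʳ ne) e₁ (solve 5 (λ y z b c j → b :+ :- (c :* j :* y) := :- b :* (z :* j :+ :- :1) :+ :- j :* (y :* c :+ :- (z :* b) :+ :- :0)) refl x₂ x₃ y₂ y₃ (x₃ ⁻¹)))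
      (combine₁ (- y₃) (*-inverseʳ ne) (solve 3 (λ x y j → y :+ :- (y :* j :* x) := :- y :* (x :* j :+ :- :1)) refl x₃ y₃ (x₃ ⁻¹)))

  cross-scale : ∀ e u → cross u (scale e u) ≡ zeroV
  cross-scale e (x₁ ∷ x₂ ∷ x₃ ∷ []) = ∷-cong (vanish x₂ x₃) (vanish x₃ x₁) (vanish x₁ x₂)
    where
    vanish : ∀ x y → x * (e * y) + - (y * (e * x)) ≡ 0#
    vanish = solve 3 (λ e x y → x :* (e :* y) :+ :- (y :* (e :* x)) := :0) refl e

  cross≢0 : ∀ {u w} → Indep u w → cross u w ≢ zeroV
  cross≢0 ind e = Indep⇒¬Dependent ind (cross-dependent _ _ (Indep-left ind) e)

  -- The meeting point of two lines is the cross product of their dual coordinates. If that is zero,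
  -- `m′` is a multiple of `m` and any point of the first line will do.
  common-orthogonal : ∀ m m′ → m ≢ zeroV → ∃ λ u → u ≢ zeroV × dot u m ≡ 0# × dot u m′ ≡ 0#
  common-orthogonal m@(x₁ ∷ x₂ ∷ x₃ ∷ []) m′@(y₁ ∷ y₂ ∷ y₃ ∷ []) m≢0 with cross m m′ ≟ᵥ zeroV
  ... | no ne = cross m m′ , ne ,
      solve 6 (λ x y z a b c → (y :* c :+ :- (z :* b)) :* x :+ (z :* a :+ :- (x :* c)) :* y :+ (x :* b :+ :- (y :* a)) :* z := :0) refl x₁ x₂ x₃ y₁ y₂ y₃ ,
      solve 6 (λ x y z a b c → (y :* c :+ :- (z :* b)) :* a :+ (z :* a :+ :- (x :* c)) :* b :+ (x :* b :+ :- (y :* a)) :* c := :0) refl x₁ x₂ x₃ y₁ y₂ y₃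
  ... | yes e with cross-dependent m m′ m≢0 e | orthogonal
    where
    orthogonal : ∃ λ u → u ≢ zeroV × dot u m ≡ 0#
    orthogonal with nonzero-coordinate m≢0
    ... | inj₁ ne = (- x₂ ∷ x₁ ∷ 0# ∷ []) , (λ z → ne (proj₁ (proj₂ (∷-injective₃ z)))) ,
          solve 3 (λ x y z → :- y :* x :+ x :* y :+ :0 :* z := :0) refl x₁ x₂ x₃
    ... | inj₂ (inj₁ ne) = (x₂ ∷ - x₁ ∷ 0# ∷ []) , (λ z → ne (proj₁ (∷-injective₃ z))) ,
          solve 3 (λ x y z → y :* x :+ :- x :* y :+ :0 :* z := :0) refl x₁ x₂ x₃
    ... | inj₂ (inj₂ ne) = (x₃ ∷ 0# ∷ - x₁ ∷ []) , (λ z → ne (proj₁ (∷-injective₃ z))) ,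
          solve 3 (λ x y z → z :* x :+ :0 :* y :+ :- x :* z := :0) refl x₁ x₂ x₃
  ...   | r , refl | u@(a ∷ b ∷ c ∷ []) , u≢0 , ortho = u , u≢0 , ortho ,
      combine₁ r ortho (solve 7 (λ r x y z a b c → a :* (r :* x) :+ b :* (r :* y) :+ c :* (r :* z) :+ :- :0
        := r :* (a :* x :+ b :* y :+ c :* z :+ :- :0)) refl r x₁ x₂ x₃ a b c)

  cross-Indep : ∀ {u w} → u ≢ zeroV → cross u w ≢ zeroV → Indep u w
  cross-Indep u≢0 ne = ¬Dependent⇒Indep u≢0 (λ { (e , refl) → ne (cross-scale e _) })

  -- In the projective plane any two lines meet, so each line may have its own colour.
  plane : LineColouring K 3 (Point 2)
  plane = record
    { col = λ u w → point (cross u w)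
    ; col-span = col-span
    ; proper = proper
    ; complete = complete
    }
    where
    open ≡-Reasoning
    col-span : ∀ {u w u′ w′} → Indep u w → Indep u′ w′ → InSpan u′ u w → InSpan w′ u w → point (cross u′ w′) ≡ point (cross u w)
    col-span {u} {w} ind ind′ (p , r , refl) (p′ , r′ , refl) =
      let ρ , _ , e = point-vec (cross u w) (cross≢0 ind)
      in point-unique {ρ = (p * r′ + - (r * p′)) * ρ} (cross≢0 ind′) (trans (cross-comb p r p′ r′ u w) (trans (cong (scale _) e) (scale-scale _ ρ _)))
    proper : ∀ {u w w′} → Indep u w → Indep u w′ → point (cross u w) ≡ point (cross u w′) → InSpan w′ u w
    -- w′ - ρ w has zero cross product with `u`, so it is τ u.
    proper {u} {w} {w′} ind ind′ e = τ , ρ , sym (begin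
        comb τ ρ u w ≡⟨ comb-triple u w w′ ⟩
        comb 1# ρ (scale τ u) w ≡⟨ cong (λ y → comb 1# ρ y w) (proj₂ dependent) ⟨
        comb 1# ρ (comb 1# (- ρ) w′ w) w ≡⟨ restore w′ w ⟩
        w′ ∎)
      where
      multiple : ∃ λ ρ → cross u w′ ≡ scale ρ (cross u w)
      multiple = point-≡ (cross≢0 ind) (cross≢0 ind′) e
      ρ = proj₁ multiple
      cross-difference : ∀ u w w′ → cross u w′ ≡ scale ρ (cross u w) → cross u (comb 1# (- ρ) w′ w) ≡ zeroV
      cross-difference (x₁ ∷ x₂ ∷ x₃ ∷ []) (y₁ ∷ y₂ ∷ y₃ ∷ []) (z₁ ∷ z₂ ∷ z₃ ∷ []) eq with ∷-injective₃ eq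
      ... | e₁ , e₂ , e₃ = ∷-cong (go x₂ x₃ y₂ y₃ z₂ z₃ e₁) (go x₃ x₁ y₃ y₁ z₃ z₁ e₂) (go x₁ x₂ y₁ y₂ z₁ z₂ e₃)
        where
        go : ∀ x x′ y y′ z z′ → x * z′ + - (x′ * z) ≡ ρ * (x * y′ + - (x′ * y)) →
             x * (1# * z′ + - ρ * y′) + - (x′ * (1# * z + - ρ * y)) ≡ 0#
        go x x′ y y′ z z′ e = combine₁ 1# e (solve 7 (λ r x x′ y y′ z z′ → x :* (:1 :* z′ :+ :- r :* y′) :+ :- (x′ :* (:1 :* z :+ :- r :* y)) :+ :- :0
          := :1 :* (x :* z′ :+ :- (x′ :* z) :+ :- (r :* (x :* y′ :+ :- (x′ :* y))))) refl ρ x x′ y y′ z z′)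
      dependent : Dependent u (comb 1# (- ρ) w′ w)
      dependent = cross-dependent u _ (Indep-left ind) (cross-difference u w w′ (proj₂ multiple))
      τ = proj₁ dependent
      comb-triple : ∀ {d} (u w w′ : V d) → comb τ ρ u w ≡ comb 1# ρ (scale τ u) w
      comb-triple [] [] [] = refl
      comb-triple (x ∷ u) (y ∷ w) (z ∷ w′) = cong₂ _∷_ (cong (_+ ρ * y) (sym (*-identityˡ _))) (comb-triple u w w′)
      restore : ∀ {d} (w′ w : V d) → comb 1# ρ (comb 1# (- ρ) w′ w) w ≡ w′
      restore [] [] = refl
      restore (z ∷ w′) (y ∷ w) = cong₂ _∷_ (solve 3 (λ r y z → :1 :* (:1 :* z :+ :- r :* y) :+ r :* y := z) refl ρ y z) (restore w′ w)
    complete : ∀ p p′ → ∃ λ u → ∃ λ w → ∃ λ w′ → Indep u w × Indep u w′ × point (cross u w) ≡ p × point (cross u w′) ≡ p′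
    complete p p′ =
      let u , u≢0 , o , o′ = common-orthogonal (vec p) (vec p′) (vec≢0 p)
          w , e = cross-solve u (vec p) u≢0 o
          w′ , e′ = cross-solve u (vec p′) u≢0 o′
          ne = subst (_≢ zeroV) (sym e) (vec≢0 p)
          ne′ = subst (_≢ zeroV) (sym e′) (vec≢0 p′)
      in u , w , w′ , cross-Indep u≢0 ne , cross-Indep u≢0 ne′ ,
         point-unique {ρ = 1#} ne (trans e (sym (scale-1 _))) , point-unique {ρ = 1#} ne′ (trans e′ (sym (scale-1 _)))

-- The two bounds

↔-injective : ∀ {A : Set} {k} (i : A ↔ Fin k) {x y : A} → Inverse.to i x ≡ Inverse.to i y → x ≡ y
↔-injective i e = trans (sym (Inverse.strictlyInverseʳ i _)) (trans (cong (Inverse.from i) e) (Inverse.strictlyInverseʳ i _))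

injection⇒≤ : ∀ {A B : Set} {m n} → A ↔ Fin m → B ↔ Fin n → (f : A → B) → (∀ {x y} → f x ≡ f y → x ≡ y) → m ≤ n
injection⇒≤ i j f f-injective = Finₚ.injective⇒≤ {f = λ x → Inverse.to j (f (Inverse.from i x))}
  (λ {x} {y} e → trans (sym (Inverse.strictlyInverseˡ i x))
    (trans (cong (Inverse.to i) (f-injective (↔-injective j e))) (Inverse.strictlyInverseˡ i y)))

module Pencils {q : ℕ} (F : FiniteField q) (n : ℕ) where
  open PG F n
  private
    K : FField q
    K = fromFiniteField F
  open FieldTheory K using (_≟_; 1#; 0#; -_)
  module FT = FieldTheory K
  open Vectors K hiding (V; zeroV)

  Indep-comb : ∀ {u w : V} p r p′ r′ → Indep u w → p FT.* r′ FT.+ - (r FT.* p′) ≢ 0# → Indep (comb p r u w) (comb p′ r′ u w)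
  Indep-comb {u} {w} p r p′ r′ ind D≢0 =
    let x , y = invert-coordinates u w p r p′ r′ D≢0 in Indep-span ind (_ , _ , x) (_ , _ , y)

  -- A basis of the line that begins with the given point, as `direction` and `LineColouring`
  -- expect.
  record Through (x : V) (L : Line) : Set where
    field
      partner : V
      indep : Indep x partner
      same : SameSpan (x , partner) (proj₁ L)

  through : ∀ {x} L → OnLine x L → Through x L
  through {x} ((u , w) , ind) (x≢0 , (a , b , refl)) = go (a ≟ 0#)
    where
    go : Dec (a ≡ 0#) → Through x ((u , w) , ind)
    go (no a≢0) = record { partner = w ; indep = ind′ ; same = SameSpan-sym {l = u , w} {x , w} (sameSpan ind′ (a , b , refl) (span-right u w)) }
      where
      ind′ : Indep x w
      ind′ = subst (Indep x) (comb-0-1 u w) (Indep-comb a b 0# 1# ind (λ e → a≢0 (trans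
        (FT.Solver.solve 2 (λ a b → a FT.Solver.:= a FT.Solver.:* FT.:1 FT.Solver.:+ FT.Solver.:- (b FT.Solver.:* FT.:0)) refl a b) e)))
    go (yes a≡0) = record { partner = u ; indep = ind′ ; same = SameSpan-sym {l = u , w} {x , u} (sameSpan ind′ (a , b , refl) (span-left u w)) }
      where
      b≢0 : b ≢ 0#
      b≢0 b≡0 = x≢0 (trans (cong₂ (λ a b → comb a b u w) a≡0 b≡0) (comb-0-0 u w))
      ind′ : Indep x u
      ind′ = subst (Indep x) (comb-1-0 u w) (Indep-comb a b 1# 0# ind (λ e → b≢0 (trans
        (FT.Solver.solve 2 (λ a b → b FT.Solver.:= FT.Solver.:- (a FT.Solver.:* FT.:0 FT.Solver.:+ FT.Solver.:- (b FT.Solver.:* FT.:1))) refl a b)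
        (trans (cong -_ e) (FT.Solver.solve 0 (FT.Solver.:- FT.:0 FT.Solver.:= FT.:0) refl)))))

  SameSpan⇒SameLine : ∀ L M → SameSpan (proj₁ L) (proj₁ M) → SameLine L M
  SameSpan⇒SameLine L M ((u′∈ , w′∈) , (u∈ , w∈)) = (λ x x∈ → span-trans x∈ u∈ w∈) , (λ x x∈ → span-trans x∈ u′∈ w′∈)

module Flags {q : ℕ} (F : FiniteField q) (n : ℕ) where
  open PG F (suc n)
  open Pencils F (suc n)
  open Vectors (fromFiniteField F) using (Indep)
  open Points (fromFiniteField F)

  module _ {k : ℕ} (C : Coloring k) (complete : Complete C) where
    open Coloring C

    record Flag (c c′ : Fin k) : Set where
      field
        x w w′ : V
        indep : Indep x w
        indep′ : Indep x w′
        colour : col ((x , w) , indep) ≡ c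
        colour′ : col ((x , w′) , indep′) ≡ c′

    flag : ∀ c c′ → Flag c c′
    flag c c′ with c Finₚ.≟ c′
    ... | yes refl = let ((u , w) , ind) , e = surjective c in
        record { x = u ; w = w ; w′ = w ; indep = ind ; indep′ = ind ; colour = e ; colour′ = e }
    ... | no ne =
      let x , L , M , onL , onM , e , e′ = complete c c′ ne
          module L = Through (through L onL)
          module M = Through (through M onM)
      in record { x = x ; w = L.partner ; w′ = M.partner ; indep = L.indep ; indep′ = M.indep
                ; colour = trans (wellDefined _ L (SameSpan⇒SameLine ((x , L.partner) , L.indep) L L.same)) e
                ; colour′ = trans (wellDefined _ M (SameSpan⇒SameLine ((x , M.partner) , M.indep) M M.same)) e′ }

    code : Fin k × Fin k → Point (suc n) × (Point n × Point n)
    code (c , c′) = point x , (direction x w , direction x w′)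
      where open Flag (flag c c′)

    code-injective : ∀ {p r} → code p ≡ code r → p ≡ r
    code-injective {c , c′} {d , d′} e = cong₂ _,_
      (trans (sym f.colour) (trans (wellDefined _ _ (SameSpan⇒SameLine ((f.x , f.w) , f.indep) ((g.x , g.w) , g.indep)
        (direction-≡ f.indep g.indep (cong proj₁ e) (cong (λ z → proj₁ (proj₂ z)) e)))) g.colour))
      (trans (sym f.colour′) (trans (wellDefined _ _ (SameSpan⇒SameLine ((f.x , f.w′) , f.indep′) ((g.x , g.w′) , g.indep′)
        (direction-≡ f.indep′ g.indep′ (cong proj₁ e) (cong (λ z → proj₂ (proj₂ z)) e)))) g.colour′))
      where
      module f = Flag (flag c c′)
      module g = Flag (flag d d′)

    colours-bound : k ℕ.* k ≤ numPoints q (suc n) ℕ.* (numPoints q n ℕ.* numPoints q n)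
    colours-bound = injection⇒≤ (Symm.↔-sym Finₚ.*↔×)
      (Symm.↔-sym Finₚ.*↔× ↔-∘ (points↔ (suc n) ×-↔ (Symm.↔-sym Finₚ.*↔× ↔-∘ (points↔ n ×-↔ points↔ n))))
      code code-injective

-- The factor q² turns p² ≤ v r² into (p q)² ≤ v (q r)², and q r = v - 1.
pseudoachromatic-bound : ∀ {q} (F : FiniteField q) n p → PG.IsPseudoachromaticIndex F (suc n) p →
                         (p ℕ.* q) ℕ.^ 2 ≤ numPoints q (suc n) ℕ.^ 3
pseudoachromatic-bound {q} F n p ((C , complete) , _) = begin
  (p ℕ.* q) ℕ.^ 2 ≡⟨ square p q ⟩
  (p ℕ.* p) ℕ.* (q ℕ.* q) ≤⟨ ℕₚ.*-monoˡ-≤ (q ℕ.* q) (Flags.colours-bound F n C complete) ⟩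
  v ℕ.* (r ℕ.* r) ℕ.* (q ℕ.* q) ≡⟨ regroup v r q ⟩
  v ℕ.* ((q ℕ.* r) ℕ.* (q ℕ.* r)) ≤⟨ ℕₚ.*-monoʳ-≤ v (ℕₚ.*-mono-≤ qr≤v qr≤v) ⟩
  v ℕ.* (v ℕ.* v) ≡⟨ cong (λ x → v ℕ.* (v ℕ.* x)) (ℕₚ.*-identityʳ v) ⟨
  v ℕ.^ 3 ∎
  where
  open ℕₚ.≤-Reasoning
  v = numPoints q (suc n)
  r = numPoints q n
  qr≤v : q ℕ.* r ≤ v
  qr≤v = ℕₚ.≤-trans (ℕₚ.n≤1+n _) (ℕₚ.≤-reflexive (sym (numPoints-horner q n)))
  square : ∀ p q → (p ℕ.* q) ℕ.* ((p ℕ.* q) ℕ.* 1) ≡ (p ℕ.* p) ℕ.* (q ℕ.* q)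
  square = solve-∀
  regroup : ∀ v r q → v ℕ.* (r ℕ.* r) ℕ.* (q ℕ.* q) ≡ v ℕ.* ((q ℕ.* r) ℕ.* (q ℕ.* r))
  regroup = solve-∀

-- The tower of quadratic extensions

-- Defined by doubling to match the type of `doubled` by computation.
dimension : ℕ → ℕ
dimension zero = 3
dimension (suc i) = dimension i ℕ.+ dimension i

dimension-≡ : ∀ i → dimension i ≡ 3 ℕ.* 2 ℕ.^ i
dimension-≡ zero = refl
dimension-≡ (suc i) = trans (cong₂ ℕ._+_ (dimension-≡ i) (dimension-≡ i)) (double (2 ℕ.^ i))
  where
  double : ∀ m → 3 ℕ.* m ℕ.+ 3 ℕ.* m ≡ 3 ℕ.* (2 ℕ.* m)
  double = solve-∀

-- The recursion squares the field order while `i` falls. The factor (q + 1) q is the size of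
-- `Colour`, and the last 1 is the extra colour.
colours : ℕ → ℕ → ℕ
colours zero q = numPoints q 2
colours (suc i) q = colours i (q ℕ.* q) ℕ.* ((q ℕ.+ 1) ℕ.* q) ℕ.+ 1

record Tower (i : ℕ) {q : ℕ} (F : FField q) : Set₁ where
  field
    Colours : Set
    some-colour : Colours
    colouring : LineColouring F (dimension i) Colours
    count : Colours ↔ Fin (colours i q)

tower : ∀ i {q} (F : FField q) → Tower i F
tower zero F = record { some-colour = inj₂ (inj₂ tt) ; colouring = plane ; count = points↔ 2 }
  where open Points F
tower (suc i) F = record
  { some-colour = inj₂ tt
  ; colouring = doubled
  ; count = Symm.↔-sym Finₚ.+↔⊎ ↔-∘ ((Symm.↔-sym Finₚ.*↔× ↔-∘ (T.count ×-↔
      (Symm.↔-sym Finₚ.*↔× ↔-∘ ((Symm.↔-sym Finₚ.+↔⊎ ↔-∘ (FField.finite F ⊎-↔ Symm.↔-sym Finₚ.1↔⊤)) ×-↔ FField.finite F))))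
      ⊎-↔ Symm.↔-sym Finₚ.1↔⊤)
  }
  where
  open Quadratic F
  module T = Tower (tower i extension)
  open Doubling (spreadData isQuadratic) T.some-colour T.colouring

-- From coloured pairs of vectors to coloured lines

module Achromatic {q : ℕ} (F : FiniteField q) (n : ℕ) {Colours : Set} {k : ℕ}
                  (L : LineColouring (fromFiniteField F) (suc n) Colours) (count : Colours ↔ Fin k) where
  open PG F n
  open LineColouring L
  open Vectors (fromFiniteField F) using (span-left; span-right; span-trans; Indep; InSpan; SameSpan-trans; SameSpan-sym; sameSpan)
  open Pencils F n
  encode = Inverse.to count

  coloring : Coloring k
  coloring = record
    { col = λ { ((u , w) , _) → encode (col u w) }
    ; wellDefined = λ { ((u , w) , ind) ((u′ , w′) , ind′) (_ , ⊇) →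
        cong encode (sym (col-span ind ind′ (⊇ u′ (span-left u′ w′)) (⊇ w′ (span-right u′ w′)))) }
    ; surjective = λ c → let u , w , _ , ind , _ , e , _ = complete (Inverse.from count c) (Inverse.from count c)
                         in ((u , w) , ind) , trans (cong encode e) (Inverse.strictlyInverseˡ count c)
    }

  coloring-complete : Complete coloring
  coloring-complete c c′ _ =
    let u , w , w′ , ind , ind′ , e , e′ = complete (Inverse.from count c) (Inverse.from count c′)
        u≢0 = Vectors.Indep-left (fromFiniteField F) ind
    in u , ((u , w) , ind) , ((u , w′) , ind′) , (u≢0 , span-left u w) , (u≢0 , span-left u w′) ,
       trans (cong encode e) (Inverse.strictlyInverseˡ count c) , trans (cong encode e′) (Inverse.strictlyInverseˡ count c′)

  coloring-proper : Proper coloring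
  coloring-proper L M ¬same (x , onL , onM) e = ¬same (SameSpan⇒SameLine L M
      (SameSpan-trans {l = proj₁ L} {x , L′.partner} {proj₁ M} (SameSpan-sym {l = x , L′.partner} {proj₁ L} L′.same)
        (SameSpan-trans {l = x , L′.partner} {x , M′.partner} {proj₁ M} (sameSpan M′.indep (span-left x L′.partner) meets) M′.same)))
    where
    module L′ = Through (through L onL)
    module M′ = Through (through M onM)
    colour-of : ∀ N (t : Through x N) → Coloring.col coloring N ≡ encode (col x (Through.partner t))
    colour-of N t = Coloring.wellDefined coloring N ((x , Through.partner t) , Through.indep t)
      (SameSpan⇒SameLine N ((x , Through.partner t) , Through.indep t) (SameSpan-sym {l = x , Through.partner t} {proj₁ N} (Through.same t)))
    meets : InSpan M′.partner x L′.partner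
    meets = proper L′.indep M′.indep (↔-injective count
      (trans (sym (colour-of L (through L onL))) (trans e (colour-of M (through M onM)))))

-- Estimates for the lower bound

field-size : ∀ {q} → FiniteField q → 2 ≤ q
field-size {zero} F with () ← FiniteField.0F F
field-size {suc zero} F = ⊥-elim (FiniteField.0≢1 F (unique _ _))
  where
  unique : ∀ (x y : Fin 1) → x ≡ y
  unique Fin.zero Fin.zero = refl
field-size {suc (suc q)} F = s≤s (s≤s z≤n)

numPoints-≤ : ∀ {q} n → 2 ≤ q → numPoints q n ≤ 2 ℕ.* q ℕ.^ n
numPoints-≤ zero _ = s≤s z≤n
numPoints-≤ {q} (suc n) 2≤q = begin
  numPoints q (suc n) ≡⟨ numPoints-suc q n ⟩
  q ℕ.^ suc n ℕ.+ numPoints q n ≤⟨ ℕₚ.+-monoʳ-≤ (q ℕ.^ suc n) (numPoints-≤ n 2≤q) ⟩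
  q ℕ.^ suc n ℕ.+ 2 ℕ.* q ℕ.^ n ≤⟨ ℕₚ.+-monoʳ-≤ (q ℕ.^ suc n) (ℕₚ.*-monoˡ-≤ (q ℕ.^ n) 2≤q) ⟩
  q ℕ.^ suc n ℕ.+ q ℕ.^ suc n ≡⟨ cong (q ℕ.^ suc n ℕ.+_) (ℕₚ.+-identityʳ _) ⟨
  2 ℕ.* q ℕ.^ suc n ∎
  where open ℕₚ.≤-Reasoning

-- The factor q² avoids the subtraction in the exponent 4m - 2. Only leading terms are kept: q²
-- points of the plane, and q² out of the (q + 1) q classes at each doubling.
colours-≥ : ∀ i q → q ℕ.^ (4 ℕ.* 2 ℕ.^ i) ≤ colours i q ℕ.* (q ℕ.* q)
colours-≥ zero q = begin
  q ℕ.^ 4 ≡⟨ square q ⟩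
  q ℕ.^ 2 ℕ.* (q ℕ.* q) ≤⟨ ℕₚ.*-monoˡ-≤ (q ℕ.* q) (ℕₚ.m≤m+n (q ℕ.^ 2) (numPoints q 1)) ⟩
  (q ℕ.^ 2 ℕ.+ numPoints q 1) ℕ.* (q ℕ.* q) ≡⟨ cong (ℕ._* (q ℕ.* q)) (numPoints-suc q 1) ⟨
  numPoints q 2 ℕ.* (q ℕ.* q) ∎
  where
  open ℕₚ.≤-Reasoning
  square : ∀ q → q ℕ.* (q ℕ.* (q ℕ.* (q ℕ.* 1))) ≡ q ℕ.* (q ℕ.* 1) ℕ.* (q ℕ.* q)
  square = solve-∀
colours-≥ (suc i) q = begin
  q ℕ.^ (4 ℕ.* (2 ℕ.* m)) ≡⟨ cong (q ℕ.^_) (double m) ⟩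
  q ℕ.^ (2 ℕ.* (4 ℕ.* m)) ≡⟨ ℕₚ.^-*-assoc q 2 (4 ℕ.* m) ⟨
  (q ℕ.^ 2) ℕ.^ (4 ℕ.* m) ≡⟨ cong (λ x → (q ℕ.* x) ℕ.^ (4 ℕ.* m)) (ℕₚ.*-identityʳ q) ⟩
  (q ℕ.* q) ℕ.^ (4 ℕ.* m) ≤⟨ colours-≥ i (q ℕ.* q) ⟩
  c ℕ.* ((q ℕ.* q) ℕ.* (q ℕ.* q)) ≤⟨ ℕₚ.m≤m+n _ (c ℕ.* q ℕ.* (q ℕ.* q) ℕ.+ q ℕ.* q) ⟩
  c ℕ.* ((q ℕ.* q) ℕ.* (q ℕ.* q)) ℕ.+ (c ℕ.* q ℕ.* (q ℕ.* q) ℕ.+ q ℕ.* q) ≡⟨ collect c q ⟩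
  (c ℕ.* ((q ℕ.+ 1) ℕ.* q) ℕ.+ 1) ℕ.* (q ℕ.* q) ∎
  where
  open ℕₚ.≤-Reasoning
  m = 2 ℕ.^ i
  c = colours i (q ℕ.* q)
  double : ∀ m → 4 ℕ.* (2 ℕ.* m) ≡ 2 ℕ.* (4 ℕ.* m)
  double = solve-∀
  collect : ∀ c q → c ℕ.* ((q ℕ.* q) ℕ.* (q ℕ.* q)) ℕ.+ (c ℕ.* q ℕ.* (q ℕ.* q) ℕ.+ q ℕ.* q) ≡ (c ℕ.* ((q ℕ.+ 1) ℕ.* q) ℕ.+ 1) ℕ.* (q ℕ.* q)
  collect = solve-∀

achromatic-≥ : ∀ {q} (F : FiniteField q) n i → suc n ≡ dimension i → ∀ a → PG.IsAchromaticIndex F n a → colours i q ≤ a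
achromatic-≥ {q} F n i e a (_ , maximal) = maximal _ coloring coloring-proper coloring-complete
  where
  module T = Tower (tower i (fromFiniteField F))
  open Achromatic F n (subst (λ d → LineColouring (fromFiniteField F) d T.Colours) (sym e) T.colouring) T.count

^-distribʳ-* : ∀ n a b → (a ℕ.* b) ℕ.^ n ≡ a ℕ.^ n ℕ.* b ℕ.^ n
^-distribʳ-* zero a b = refl
^-distribʳ-* (suc n) a b = trans (cong ((a ℕ.* b) ℕ.*_) (^-distribʳ-* n a b)) (interchange a b (a ℕ.^ n) (b ℕ.^ n))
  where
  interchange : ∀ a b x y → a ℕ.* b ℕ.* (x ℕ.* y) ≡ a ℕ.* x ℕ.* (b ℕ.* y)
  interchange = solve-∀

-- The bound with real exponents is raised to the power 15 n: (4n+1)/(3n) becomes 5 (4n+1), and 7/5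
-- becomes 21 n. As `suc e` stands for 4m, the relation between `n` and `e` is 4n + 1 = 3e.
exponents-bound : ∀ {q v a n e} → 2 ≤ q → 5 ≤ n → suc n ℕ.* 4 ≡ 3 ℕ.* suc e → v ≤ 2 ℕ.* q ℕ.^ n → q ℕ.^ suc e ≤ a ℕ.* (q ℕ.* q) →
                  v ℕ.^ (5 ℕ.* (4 ℕ.* n ℕ.+ 1)) ≤ 2 ℕ.^ (21 ℕ.* n) ℕ.* (a ℕ.* q) ℕ.^ (15 ℕ.* n)
-- The pattern makes `q` visibly nonzero for the cancellation in `q^e≤`.
exponents-bound {q@(suc _)} {v} {a} {n} {e} 2≤q 5≤n n≡e v≤ a≥ = begin
  v ℕ.^ N ≤⟨ ℕₚ.^-monoˡ-≤ N v≤ ⟩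
  (2 ℕ.* q ℕ.^ n) ℕ.^ N ≡⟨ ^-distribʳ-* N 2 (q ℕ.^ n) ⟩
  2 ℕ.^ N ℕ.* (q ℕ.^ n) ℕ.^ N ≤⟨ ℕₚ.*-mono-≤ (ℕₚ.^-monoʳ-≤ 2 N≤) (ℕₚ.≤-trans (ℕₚ.≤-reflexive powers) (ℕₚ.^-monoˡ-≤ (15 ℕ.* n) q^e≤)) ⟩
  2 ℕ.^ (21 ℕ.* n) ℕ.* (a ℕ.* q) ℕ.^ (15 ℕ.* n) ∎
  where
  open ℕₚ.≤-Reasoning
  N = 5 ℕ.* (4 ℕ.* n ℕ.+ 1)
  N≤ : N ≤ 21 ℕ.* n
  N≤ = begin
    N ≡⟨ expand n ⟩
    20 ℕ.* n ℕ.+ 5 ≤⟨ ℕₚ.+-monoʳ-≤ (20 ℕ.* n) 5≤n ⟩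
    20 ℕ.* n ℕ.+ n ≡⟨ add n ⟩
    21 ℕ.* n ∎
    where
    expand : ∀ n → 5 ℕ.* (4 ℕ.* n ℕ.+ 1) ≡ 20 ℕ.* n ℕ.+ 5
    expand = solve-∀
    add : ∀ n → 20 ℕ.* n ℕ.+ n ≡ 21 ℕ.* n
    add = solve-∀
  3e : 4 ℕ.* n ℕ.+ 1 ≡ 3 ℕ.* e
  3e = ℕₚ.+-cancelʳ-≡ 3 _ _ (trans (left n) (trans n≡e (right e)))
    where
    left : ∀ n → 4 ℕ.* n ℕ.+ 1 ℕ.+ 3 ≡ suc n ℕ.* 4
    left = solve-∀
    right : ∀ e → 3 ℕ.* suc e ≡ 3 ℕ.* e ℕ.+ 3
    right = solve-∀
  powers : (q ℕ.^ n) ℕ.^ N ≡ (q ℕ.^ e) ℕ.^ (15 ℕ.* n)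
  powers = begin-equality
    (q ℕ.^ n) ℕ.^ N ≡⟨ ℕₚ.^-*-assoc q n N ⟩
    q ℕ.^ (n ℕ.* N) ≡⟨ cong (λ x → q ℕ.^ (n ℕ.* (5 ℕ.* x))) 3e ⟩
    q ℕ.^ (n ℕ.* (5 ℕ.* (3 ℕ.* e))) ≡⟨ cong (q ℕ.^_) (regroup n e) ⟩
    q ℕ.^ (e ℕ.* (15 ℕ.* n)) ≡⟨ ℕₚ.^-*-assoc q e (15 ℕ.* n) ⟨
    (q ℕ.^ e) ℕ.^ (15 ℕ.* n) ∎
    where
    regroup : ∀ n e → n ℕ.* (5 ℕ.* (3 ℕ.* e)) ≡ e ℕ.* (15 ℕ.* n)
    regroup = solve-∀
  q^e≤ : q ℕ.^ e ≤ a ℕ.* q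
  q^e≤ = ℕₚ.*-cancelˡ-≤ q (ℕₚ.≤-trans a≥ (ℕₚ.≤-reflexive (swap a q)))
    where
    swap : ∀ a q → a ℕ.* (q ℕ.* q) ≡ q ℕ.* (a ℕ.* q)
    swap = solve-∀

suc-pred-dimension : ∀ i → suc (3 ℕ.* 2 ℕ.^ i ∸ 1) ≡ 3 ℕ.* 2 ℕ.^ i
suc-pred-dimension i = ℕₚ.m+[n∸m]≡n {1} (ℕₚ.≤-trans (s≤s z≤n) (ℕₚ.*-monoʳ-≤ 3 (ℕₚ.m^n>0 2 i)))

achromatic-bound : ∀ {q} (F : FiniteField q) n i → 1 ≤ i → n ≡ 3 ℕ.* 2 ℕ.^ i ∸ 1 → ∀ a → PG.IsAchromaticIndex F n a →
  numPoints q n ℕ.^ (5 ℕ.* (4 ℕ.* n ℕ.+ 1)) ≤ 2 ℕ.^ (21 ℕ.* n) ℕ.* (a ℕ.* q) ℕ.^ (15 ℕ.* n)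
achromatic-bound {q} F n i 1≤i refl a isIndex = exponents-bound {a = a} {n = n} {e = e} 2≤q 5≤n n≡e (numPoints-≤ n 2≤q) (begin
    q ℕ.^ suc e ≡⟨ cong (q ℕ.^_) suc-e ⟩
    q ℕ.^ (4 ℕ.* m) ≤⟨ colours-≥ i q ⟩
    colours i q ℕ.* (q ℕ.* q) ≤⟨ ℕₚ.*-monoˡ-≤ (q ℕ.* q) (achromatic-≥ F n i (trans suc-n (sym (dimension-≡ i))) a isIndex) ⟩
    a ℕ.* (q ℕ.* q) ∎)
  where
  open ℕₚ.≤-Reasoning
  2≤q = field-size F
  m = 2 ℕ.^ i
  e = 4 ℕ.* m ∸ 1
  suc-n : suc n ≡ 3 ℕ.* m
  suc-n = suc-pred-dimension i
  2≤m : 2 ≤ m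
  2≤m = ℕₚ.^-monoʳ-≤ 2 1≤i
  suc-e : suc e ≡ 4 ℕ.* m
  suc-e = ℕₚ.m+[n∸m]≡n {1} (ℕₚ.≤-trans (s≤s z≤n) (ℕₚ.*-monoʳ-≤ 4 2≤m))
  -- 3 · 2 - 1 = 5, attained at i = 1.
  5≤n : 5 ≤ n
  5≤n = ℕₚ.∸-monoˡ-≤ 1 (ℕₚ.*-monoʳ-≤ 3 2≤m)
  n≡e : suc n ℕ.* 4 ≡ 3 ℕ.* suc e
  n≡e = trans (cong (ℕ._* 4) suc-n) (trans (swap m) (cong (3 ℕ.*_) (sym suc-e)))
    where
    swap : ∀ m → 3 ℕ.* m ℕ.* 4 ≡ 3 ℕ.* (4 ℕ.* m)
    swap = solve-∀

open import Data.Nat using (ℕ; suc; _+_; _*_; _^_; _≤_; _∸_)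
open import Data.Product using (_×_)
open import Relation.Binary.PropositionalEquality using (_≡_)

theorem1 : ∀ (q : ℕ) (F : FiniteField q) (n : ℕ) → 2 ≤ n →
    ((∀ (i : ℕ) → 1 ≤ i → n ≡ 3 * 2 ^ i ∸ 1 →
    ∀ (a : ℕ) → PG.IsAchromaticIndex F n a →
    numPoints q n ^ (5 * (4 * n + 1)) ≤ 2 ^ (21 * n) * (a * q) ^ (15 * n))
    ×
    (∀ (p : ℕ) → PG.IsPseudoachromaticIndex F n p →
    (p * q) ^ 2 ≤ numPoints q n ^ 3))
theorem1 q F n@(suc m) 2≤n = achromatic-bound F n , pseudoachromatic-bound F m
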